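{- Let $n>1$, $r=2^n$ and $M=14^{2^n}+1$. Let $\pi=1-\zeta_7+\zeta_7^4\in\mathbb{Z}[\zeta_{14}]$ and $\alpha=(\pi/\bar\pi)^{1+3\sigma_5+5\sigma_3}$. For $k\geq0$ define $S_k^{(1)}=\alpha_1^{(k)}+\alpha_2^{(k)}+\alpha_3^{(k)}$, $S_k^{(2)}=\alpha_1^{(k)}\alpha_2^{(k)}+\alpha_1^{(k)}\alpha_3^{(k)}+\alpha_2^{(k)}\alpha_3^{(k)}$, $S_k^{(3)}=\alpha_1^{(k)}\alpha_2^{(k)}\alpha_3^{(k)}$, where $\alpha_1^{(k)}=\alpha^{14^k}+\bar\alpha^{14^k}$, $\alpha_2^{(k)}=\sigma_3(\alpha_1^{(k)})$, $\alpha_3^{(k)}=\sigma_5(\alpha_1^{(k)})$. Suppose that every integer $x$ with $1<x<7^r$ and $x^6\equiv1\pmod{7^r}$ does not divide $M$. Then $M$ is prime if and only if one of the following holds: (i) $M\equiv\pm8\pmod{29}$ and $S_{r-1}^{(1)}\equiv1$, $S_{r-1}^{(2)}\equiv-2$, $S_{r-1}^{(3)}\equiv-1\pmod M$; (ii) $M\equiv-5\pmod{29}$ and $S_{r-1}^{(1)}\equiv-1$, $S_{r-1}^{(2)}\equiv-2$, $S_{r-1}^{(3)}\equiv1\pmod M$.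
   Context: $\zeta_m=e^{2\pi\sqrt{ -1}/m}$ and a bar denotes complex conjugation. For $c$ coprime to $14$, $\sigma_c\in G=\mathrm{Gal}(\mathbb{Q}(\zeta_{14})/\mathbb{Q})$ sends $\zeta_{14}$ to $\zeta_{14}^c$; $1$ denotes $\sigma_1$ in $\mathbb{Z}[G]$. For $\tau=\sum_{\sigma\in G}k_\sigma\sigma\in\mathbb{Z}[G]$ and $\beta\neq0$, $\beta^\tau:=\prod_{\sigma}\sigma(\beta)^{k_\sigma}$. The $S_k^{(j)}$ are rational numbers with denominators prime to $M$; congruences modulo $M$ are understood in the ring of rationals with denominator prime to $M$. -}

module Defs where

open import Algebra.Bundles.Raw using (RawRing)
import Algebra.Definitions.RawSemiring as RawSemiringDefs
open import Data.Integer.Base as ℤ using (ℤ; +_; -[1+_])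
import Data.Integer.Divisibility as ℤᵈ
open import Data.List.Base as List using (List; []; _∷_)
open import Data.Nat.Base as ℕ using (ℕ; suc)
open import Data.Nat.Coprimality using (Coprime)
open import Data.Product.Base using (∃-syntax; _×_)
open import Data.Rational.Base as ℚ using (ℚ; 0ℚ; 1ℚ; ↧ₙ_; ≢-nonZero)
import Data.Rational.Properties as ℚₚ
open import Data.Unit.Base using (tt)
open import Data.Vec.Base as Vec using (Vec; []; _∷_)
import Data.Vec.Properties as Vecₚ
open import Level using (0ℓ)
open import Relation.Binary.PropositionalEquality using (_≡_)
open import Relation.Nullary.Decidable using (yes; no; toWitness)

------------------------------------------------------------------------
-- Congruences

infix 4 _≡_[modℤ_] _≡_[modℚ_] _≡_[mod_]

_≡_[modℤ_] : ℤ → ℤ → ℕ → Set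
a ≡ b [modℤ m ] = + m ℤᵈ.∣ a ℤ.- b

-- ℚ is kept in lowest terms, so this is membership in the ring of
-- rationals with denominator prime to m.
PrimeToDenominator : ℕ → ℚ → Set
PrimeToDenominator m p = Coprime (↧ₙ p) m

_≡_[modℚ_] : ℚ → ℚ → ℕ → Set
p ≡ q [modℚ m ] =
  PrimeToDenominator m p × PrimeToDenominator m q ×
  ∃[ t ] (PrimeToDenominator m t × (p ℚ.- q ≡ (+ m ℚ./ 1) ℚ.* t))

------------------------------------------------------------------------
-- The field ℚ(ζ₁₄) = ℚ[X]/(Φ₁₄)

-- (a₀ ∷ … ∷ a₅ ∷ []) stands for a₀ + a₁ ζ + … + a₅ ζ⁵ with ζ = ζ₁₄.
K : Set
K = Vec ℚ 6

fromℚ : ℚ → K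
fromℚ q = q ∷ 0ℚ ∷ 0ℚ ∷ 0ℚ ∷ 0ℚ ∷ 0ℚ ∷ []

scale : ℚ → K → K
scale q = Vec.map (q ℚ.*_)

-- Multiplication by ζ, using Φ₁₄(ζ) = ζ⁶ - ζ⁵ + ζ⁴ - ζ³ + ζ² - ζ + 1 = 0.
ζ·_ : K → K
ζ· (a₀ ∷ a₁ ∷ a₂ ∷ a₃ ∷ a₄ ∷ a₅ ∷ []) =
  (ℚ.- a₅) ∷ (a₀ ℚ.+ a₅) ∷ (a₁ ℚ.- a₅) ∷ (a₂ ℚ.+ a₅) ∷ (a₃ ℚ.- a₅) ∷ (a₄ ℚ.+ a₅) ∷ []

K-rawRing : RawRing 0ℓ 0ℓ
K-rawRing = record
  { Carrier = K
  ; _≈_     = _≡_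
  ; _+_     = Vec.zipWith ℚ._+_
  ; _*_     = λ a b → Vec.foldr′ (λ aᵢ acc → Vec.zipWith ℚ._+_ (scale aᵢ b) (ζ· acc)) (fromℚ 0ℚ) a
  ; -_      = Vec.map (λ q → ℚ.- q)
  ; 0#      = fromℚ 0ℚ
  ; 1#      = fromℚ 1ℚ
  }

open RawRing K-rawRing public using (_+_; _*_; -_; 0#; 1#; rawSemiring)
open RawSemiringDefs rawSemiring public using (_^_)

infixl 6 _-_
_-_ : K → K → K
a - b = a + (- b)

ζ₁₄ : K
ζ₁₄ = 0ℚ ∷ 1ℚ ∷ 0ℚ ∷ 0ℚ ∷ 0ℚ ∷ 0ℚ ∷ []

ζ₇ : K
ζ₇ = ζ₁₄ ^ 2

------------------------------------------------------------------------
-- The Galois group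

data G : Set where
  σ₁ σ₃ σ₅ σ₉ σ₁₁ σ₁₃ : G

residue : G → ℕ
residue σ₁  = 1
residue σ₃  = 3
residue σ₅  = 5
residue σ₉  = 9
residue σ₁₁ = 11
residue σ₁₃ = 13

-- a₀ + a₁ ζ + … + a₅ ζ⁵ ↦ a₀ + a₁ ζᶜ + … + a₅ ζ⁵ᶜ, where c = residue σ.
infixr 9 _⟨$⟩_
_⟨$⟩_ : G → K → K
σ ⟨$⟩ a = Vec.foldr′ (λ aᵢ acc → fromℚ aᵢ + (ζ₁₄ ^ residue σ) * acc) 0# a

-- Complex conjugation sends ζ₁₄ to ζ₁₄⁻¹ = ζ₁₄¹³.
conj : K → K
conj a = σ₁₃ ⟨$⟩ a

nonIdentity allG : List G
nonIdentity = σ₃ ∷ σ₅ ∷ σ₉ ∷ σ₁₁ ∷ σ₁₃ ∷ []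
allG        = σ₁ ∷ nonIdentity

∏[_]_ : List G → (G → K) → K
∏[ σs ] f = List.foldr (λ σ acc → f σ * acc) 1# σs

------------------------------------------------------------------------
-- Inverses, and the action of the group ring

invℚ : ℚ → ℚ
invℚ q with q ℚₚ.≟ 0ℚ
... | yes _   = 0ℚ
... | no  q≢0 = ℚ.1/_ q {{≢-nonZero q≢0}}

-- The norm ∏ σ(a) lies in ℚ, so it is its own constant coefficient.
norm : K → ℚ
norm a = Vec.head (∏[ allG ] (_⟨$⟩ a))

-- a⁻¹ = N(a)⁻¹ ∏_{σ ≠ 1} σ(a) for a ≠ 0; the junk value of 0⁻¹ is 0.
infix 10 _⁻¹
_⁻¹ : K → K
a ⁻¹ = scale (invℚ (norm a)) (∏[ nonIdentity ] (_⟨$⟩ a))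

infixl 7 _/_
_/_ : K → K → K
a / b = a * b ⁻¹

infixr 8 _^ℤ_
_^ℤ_ : K → ℤ → K
a ^ℤ (+ k)    = a ^ k
a ^ℤ -[1+ k ] = (a ⁻¹) ^ suc k

-- τ : ℤ[G] is the element ∑ τ(σ) σ.
ℤ[G] : Set
ℤ[G] = G → ℤ

infixr 8 _^ᴳ_
_^ᴳ_ : K → ℤ[G] → K
β ^ᴳ τ = ∏[ allG ] (λ σ → (σ ⟨$⟩ β) ^ℤ τ σ)

------------------------------------------------------------------------
-- The sequences S⁽¹⁾, S⁽²⁾, S⁽³⁾

π : K
π = 1# - ζ₇ + ζ₇ ^ 4

-- Proved by decision: a bare refl loses sharing and does not terminate in practice.
conj-π-inverse : conj π * conj π ⁻¹ ≡ 1#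
conj-π-inverse = toWitness {a? = Vecₚ.≡-dec ℚₚ._≟_ _ _} tt

1+3σ₅+5σ₃ : ℤ[G]
1+3σ₅+5σ₃ σ₁ = + 1
1+3σ₅+5σ₃ σ₅ = + 3
1+3σ₅+5σ₃ σ₃ = + 5
1+3σ₅+5σ₃ _  = + 0

α : K
α = (π / conj π) ^ᴳ 1+3σ₅+5σ₃

α₁ α₂ α₃ : ℕ → K
α₁ k = α ^ (14 ℕ.^ k) + conj α ^ (14 ℕ.^ k)
α₂ k = σ₃ ⟨$⟩ α₁ k
α₃ k = σ₅ ⟨$⟩ α₁ k

S⁽¹⁾ S⁽²⁾ S⁽³⁾ : ℕ → K
S⁽¹⁾ k = α₁ k + α₂ k + α₃ k
S⁽²⁾ k = α₁ k * α₂ k + α₁ k * α₃ k + α₂ k * α₃ k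
S⁽³⁾ k = α₁ k * α₂ k * α₃ k

-- The element s of K is a rational number, and as such congruent to c.
_≡_[mod_] : K → ℤ → ℕ → Set
s ≡ c [mod m ] = ∃[ q ] ((s ≡ fromℚ q) × (q ≡ c ℚ./ 1 [modℚ m ]))

-- Let χ be a character modulo 29 of order 14 with values in ℤ[ζ], ζ = ζ₁₄, and g = Σ χ(x) Xˣ its Gauss
-- sum in ℤ[ζ][X]/(X²⁹ - 1).  By Stickelberger's theorem g¹⁴ is α times the fourteenth power of an
-- element of ℚ(ζ), up to a root of unity; this is where the exponent 1 + 3σ₅ + 5σ₃ comes from.  Here
-- this is the identity g¹⁵ = a g with an explicit product a of Jacobi sums, so that no inverse of g
-- is needed.  If M is prime, then M ≡ 1 (mod 14) and Frobenius give g^M ≡ χ(M)⁻¹ g modulo M.  Comparing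
-- coefficients of X, α^(14^(r-1)) = α^((M-1)/14) is congruent to χ(M)⁻¹, a root of unity whose order
-- 14 or 7 is read off from M modulo 29, and the S⁽ⁱ⁾ are the symmetric functions of its three periods.
--
-- Conversely, the congruences make u = α^(14^(r-1)) a root of Φ₁₄ or Φ₇ modulo every prime p dividing M,
-- where u¹⁴ = 1 but u² ≠ 1.  Since x^(p⁶) = x in ℤ[ζ]/p, this forces 7^r to divide p⁶ - 1.  By
-- hypothesis p ≥ 7^r, and 49^r > M.
module Submission where

open import Algebra.Bundles using (CommutativeRing; AbelianGroup; RawRing)
open import Algebra.Morphism.Structures using (IsSemiringHomomorphism)
import Algebra.Properties.AbelianGroup as AbelianGroupProperties
import Algebra.Properties.Ring as RingProperties
import Algebra.Properties.Semiring.Mult as Mult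
import Algebra.Solver.Ring.NaturalCoefficients.Default as SemiringSolver
open import Data.Empty using (⊥; ⊥-elim)
open import Data.Fin.Base as Fin using (Fin; fromℕ; inject₁)
import Data.Fin.Properties as Finₚ
open import Data.Integer.Base as ℤ using (ℤ; +_; -[1+_]; -1ℤ) renaming (-_ to -ℤ_)
import Data.Integer.Properties as ℤₚ
import Data.Integer.Solver as ℤSolver
open import Data.Nat.Base as ℕ using (ℕ; zero; suc; _<_; _≤_; s≤s; z≤n; _∸_; _!)
open import Data.Nat.Combinatorics using (_C_; nCk≡n!/k![n-k]!; k![n∸k]!∣n!; nCn≡1)
open import Data.Nat.Coprimality as Coprimality using (Coprime)
open import Data.Nat.Divisibility as ∣ using (_∣_; _∤_; divides)
open import Data.Nat.DivMod as DivMod using (_%_)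
open import Data.Nat.GCD as GCD using (module Bézout)
open import Data.Nat.Primality
  using (Prime; prime?; prime⇒irreducible; prime⇒nonZero; prime⇒nonTrivial; euclidsLemma
        ; _Rough_; 2-rough; ∤⇒rough-suc; rough∧∣⇒prime; rough∧square>⇒prime)
import Data.Nat.Properties as ℕₚ
open import Data.Product.Base using (_,_; ∃-syntax; proj₁; proj₂)
open import Data.Rational.Base as ℚ using (ℚ; mkℚ; ↥_; ↧_; ↧ₙ_; 0ℚ; 1ℚ)
import Data.Rational.Properties as ℚₚ
import Data.Rational.Unnormalised.Base as ℚᵘ
import Data.Rational.Unnormalised.Properties as ℚᵘₚ
open import Data.Sum.Base using (_⊎_; inj₁; inj₂; [_,_]′)
open import Data.Unit.Base using (tt)
open import Data.Vec.Base as Vec using (Vec; []; _∷_; _∷ʳ_; padRight)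
import Data.Vec.Properties as Vecₚ
open import Data.Vec.Relation.Binary.Pointwise.Inductive as Pointwise using (Pointwise; []; _∷_)
open import Function.Base using (_∘_)
open import Function.Bundles using (_⇔_; mk⇔)
open import Level using (0ℓ)
open import Relation.Binary.PropositionalEquality as ≡ using (_≡_)
import Relation.Binary.Reasoning.Setoid as SetoidReasoning
open import Relation.Nullary.Decidable using (Dec; yes; no; toWitness)
open import Relation.Nullary.Negation.Core using (¬_)

-- Vectors, algebras generated by one element, and quotient rings

-- The coefficients of a Gauss sum add up to 0, so `g` is a zero divisor in ℤ[ζ][X]/(X²⁹ - 1) and
-- cannot be cancelled. This is why a spare factor `g` is carried along and one coefficient is read
-- off at the end. The obstacle on the other side is that α has denominators. As π has norm 29 and 1
-- + 3 + 5 = 9, b = 29⁹ α is integral, and the congruences move to ℤ[ζ] by clearing powers of 29,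
-- which is prime to M. The two sides meet in 29⁹ a = ζ⁶ b c¹⁴ with c c̄ = 29. In its N-th power, N
-- = 14^(r-1), the factor ζ^(6N) is 1 because r > 1 makes 14 divide N, and c^(14N) = c^(M-1) is 1
-- modulo a prime M. In the converse ℤ[ζ]/p may fail to be a field, so being a root of Φ₁₄ does not
-- by itself bound the order from below. An explicit identity does it instead: a root v of Φ₁₄ with
-- v² = 1 forces 7 = 0. A sign s exchanges primitive seventh and fourteenth roots of unity, so both
-- cases share one cubic.

module Vectors (R : CommutativeRing 0ℓ 0ℓ) where
  private module R = CommutativeRing R
  open R using (Carrier)

  infix 4 _≋_
  infixl 6 _⊕_
  infixr 7 _·_

  _≋_ : ∀ {n} → Vec Carrier n → Vec Carrier n → Set
  _≋_ = Pointwise R._≈_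

  _⊕_ : ∀ {n} → Vec Carrier n → Vec Carrier n → Vec Carrier n
  _⊕_ = Vec.zipWith R._+_

  _·_ : ∀ {n} → Carrier → Vec Carrier n → Vec Carrier n
  s · v = Vec.map (s R.*_) v

  ⊖_ : ∀ {n} → Vec Carrier n → Vec Carrier n
  ⊖_ = Vec.map (R.-_)

  𝟘 : ∀ {n} → Vec Carrier n
  𝟘 {n} = Vec.replicate n R.0#

  ⊕-abelianGroup : ℕ → AbelianGroup 0ℓ 0ℓ
  ⊕-abelianGroup n = record
    { Carrier = Vec Carrier n
    ; _≈_ = _≋_
    ; _∙_ = _⊕_
    ; ε = 𝟘
    ; _⁻¹ = ⊖_
    ; isAbelianGroup = record
      { isGroup = record
        { isMonoid = record
          { isSemigroup = record
            { isMagma = record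
              { isEquivalence = Pointwise.isEquivalence R.isEquivalence n
              ; ∙-cong = Pointwise.zipWith-cong R.+-cong
              }
            ; assoc = Pointwise.zipWith-assoc R.+-assoc
            }
          ; identity = Pointwise.zipWith-identityˡ R.+-identityˡ
                     , Pointwise.zipWith-identityʳ R.+-identityʳ
          }
        ; inverse = inverseˡ , λ v → ≋-trans (Pointwise.zipWith-comm R.+-comm v (⊖ v)) (inverseˡ v)
        ; ⁻¹-cong = Pointwise.map⁺ R.-‿cong
        }
      ; comm = Pointwise.zipWith-comm R.+-comm
      }
    }
    where
    ≋-trans : ∀ {n} {u v w : Vec Carrier n} → u ≋ v → v ≋ w → u ≋ w
    ≋-trans = Pointwise.trans R.trans
    inverseˡ : ∀ {n} (v : Vec Carrier n) → (⊖ v) ⊕ v ≋ 𝟘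
    inverseˡ []      = []
    inverseˡ (x ∷ v) = R.-‿inverseˡ x ∷ inverseˡ v

  module _ {n : ℕ} where
    open AbelianGroup (⊕-abelianGroup n) public
      using ()
      renaming ( refl to ≋-refl; sym to ≋-sym; trans to ≋-trans; reflexive to ≋-reflexive
               ; ∙-cong to ⊕-cong; assoc to ⊕-assoc; comm to ⊕-comm
               ; identityˡ to ⊕-identityˡ; identityʳ to ⊕-identityʳ; setoid to ≋-setoid
               ; commutativeSemigroup to ⊕-commutativeSemigroup)

  ·-cong : ∀ {n s t} {u v : Vec Carrier n} → s R.≈ t → u ≋ v → s · u ≋ t · v
  ·-cong s≈t = Pointwise.map⁺ (R.*-cong s≈t)

  ·-distribˡ : ∀ {n} s (u v : Vec Carrier n) → s · (u ⊕ v) ≋ s · u ⊕ s · v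
  ·-distribˡ s []      []      = []
  ·-distribˡ s (x ∷ u) (y ∷ v) = R.distribˡ s x y ∷ ·-distribˡ s u v

  ·-distribʳ : ∀ {n} s t (v : Vec Carrier n) → (s R.+ t) · v ≋ s · v ⊕ t · v
  ·-distribʳ s t []      = []
  ·-distribʳ s t (x ∷ v) = R.distribʳ x s t ∷ ·-distribʳ s t v

  ·-assoc : ∀ {n} s t (v : Vec Carrier n) → (s R.* t) · v ≋ s · t · v
  ·-assoc s t []      = []
  ·-assoc s t (x ∷ v) = R.*-assoc s t x ∷ ·-assoc s t v

  ·-comm : ∀ {n} s t (v : Vec Carrier n) → s · t · v ≋ t · s · v
  ·-comm s t v = ≋-trans (≋-sym (·-assoc s t v)) (≋-trans (·-cong (R.*-comm s t) ≋-refl) (·-assoc t s v))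

  ·-zeroˡ : ∀ {n} (v : Vec Carrier n) → R.0# · v ≋ 𝟘
  ·-zeroˡ []      = []
  ·-zeroˡ (x ∷ v) = R.zeroˡ x ∷ ·-zeroˡ v

  ·-zeroʳ : ∀ {n} s → s · 𝟘 {n} ≋ 𝟘
  ·-zeroʳ {zero}  s = []
  ·-zeroʳ {suc n} s = R.zeroʳ s ∷ ·-zeroʳ s

  record IsLinear {n} (T : Vec Carrier n → Vec Carrier n) : Set where
    field
      cong : ∀ {u v} → u ≋ v → T u ≋ T v
      ⊕-homo : ∀ u v → T (u ⊕ v) ≋ T u ⊕ T v
      ·-homo : ∀ s v → T (s · v) ≋ s · T v

    𝟘-homo : T 𝟘 ≋ 𝟘
    𝟘-homo = ≋-trans (cong (≋-sym (·-zeroˡ 𝟘))) (≋-trans (·-homo R.0# 𝟘) (·-zeroˡ (T 𝟘)))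

-- With expand, e generates the R[T]-module Vec R n, which makes it the quotient R[X]/I by the
-- annihilator I of e, with T as multiplication by X.
module Cyclic (R : CommutativeRing 0ℓ 0ℓ) {n : ℕ} (T : Vec (CommutativeRing.Carrier R) n → Vec (CommutativeRing.Carrier R) n)
              (T-linear : Vectors.IsLinear R T) where
  open Vectors R
  private
    module R = CommutativeRing R
    module T = IsLinear T-linear
    V = Vec R.Carrier n

  open SetoidReasoning (≋-setoid {n})
  open import Algebra.Properties.CommutativeSemigroup (⊕-commutativeSemigroup {n}) using (interchange)

  -- The polynomial with coefficients `a`, evaluated at the operator `T` and applied to `b`. Its
  -- length is independent of `n`, so that inductions can drop coefficients while the module stays
  -- fixed.
  horner : ∀ {k} → Vec R.Carrier k → V → V
  horner a b = Vec.foldr′ (λ aᵢ acc → aᵢ · b ⊕ T acc) 𝟘 a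

  infixl 7 _⊛_
  _⊛_ : V → V → V
  a ⊛ b = horner a b

  horner-cong : ∀ {k} {a a′ : Vec R.Carrier k} {b b′} → a ≋ a′ → b ≋ b′ → horner a b ≋ horner a′ b′
  horner-cong []         b≋b′ = ≋-refl
  horner-cong (x≈ ∷ a≋a′) b≋b′ = ⊕-cong (·-cong x≈ b≋b′) (T.cong (horner-cong a≋a′ b≋b′))

  horner-congʳ : ∀ {k} (a : Vec R.Carrier k) {b b′} → b ≋ b′ → horner a b ≋ horner a b′
  horner-congʳ a b≋b′ = horner-cong {a = a} ≋-refl b≋b′

  horner-⊕ˡ : ∀ {k} (a a′ : Vec R.Carrier k) b → horner (a ⊕ a′) b ≋ horner a b ⊕ horner a′ b
  horner-⊕ˡ []      []        b = ≋-sym (⊕-identityˡ 𝟘)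
  horner-⊕ˡ (x ∷ a) (x′ ∷ a′) b = begin
    (x R.+ x′) · b ⊕ T (horner (a ⊕ a′) b)
      ≈⟨ ⊕-cong (·-distribʳ x x′ b) (T.cong (horner-⊕ˡ a a′ b)) ⟩
    (x · b ⊕ x′ · b) ⊕ T (horner a b ⊕ horner a′ b)
      ≈⟨ ⊕-cong ≋-refl (T.⊕-homo _ _) ⟩
    (x · b ⊕ x′ · b) ⊕ (T (horner a b) ⊕ T (horner a′ b))
      ≈⟨ interchange _ _ _ _ ⟩
    (x · b ⊕ T (horner a b)) ⊕ (x′ · b ⊕ T (horner a′ b)) ∎

  horner-·ˡ : ∀ {k} s (a : Vec R.Carrier k) b → horner (s · a) b ≋ s · horner a b
  horner-·ˡ s []      b = ≋-sym (·-zeroʳ s)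
  horner-·ˡ s (x ∷ a) b = begin
    (s R.* x) · b ⊕ T (horner (s · a) b)   ≈⟨ ⊕-cong (·-assoc s x b) (T.cong (horner-·ˡ s a b)) ⟩
    s · x · b ⊕ T (s · horner a b)         ≈⟨ ⊕-cong ≋-refl (T.·-homo s _) ⟩
    s · x · b ⊕ s · T (horner a b)         ≈⟨ ·-distribˡ s _ _ ⟨
    s · (x · b ⊕ T (horner a b))           ∎

  -- A linear map that commutes with `T` commutes with every polynomial in `T`. Scalars, `T` itself
  -- and `horner a` are such maps, and the ring laws below come from these instances.
  horner-natural : ∀ {φ : V → V} → IsLinear φ → (∀ v → φ (T v) ≋ T (φ v)) →
                   ∀ {k} (a : Vec R.Carrier k) b → φ (horner a b) ≋ horner a (φ b)
  horner-natural φ-linear φT []      b = IsLinear.𝟘-homo φ-linear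
  horner-natural {φ} φ-linear φT (x ∷ a) b = begin
    φ (x · b ⊕ T (horner a b))     ≈⟨ φ.⊕-homo _ _ ⟩
    φ (x · b) ⊕ φ (T (horner a b)) ≈⟨ ⊕-cong (φ.·-homo x b) (φT _) ⟩
    x · φ b ⊕ T (φ (horner a b))   ≈⟨ ⊕-cong ≋-refl (T.cong (horner-natural φ-linear φT a b)) ⟩
    x · φ b ⊕ T (horner a (φ b))   ∎
    where module φ = IsLinear φ-linear

  horner-⊕ʳ : ∀ {k} (a : Vec R.Carrier k) b b′ → horner a (b ⊕ b′) ≋ horner a b ⊕ horner a b′
  horner-⊕ʳ []      b b′ = ≋-sym (⊕-identityˡ 𝟘)
  horner-⊕ʳ (x ∷ a) b b′ = begin
    x · (b ⊕ b′) ⊕ T (horner a (b ⊕ b′))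
      ≈⟨ ⊕-cong (·-distribˡ x b b′) (T.cong (horner-⊕ʳ a b b′)) ⟩
    (x · b ⊕ x · b′) ⊕ T (horner a b ⊕ horner a b′)
      ≈⟨ ⊕-cong ≋-refl (T.⊕-homo _ _) ⟩
    (x · b ⊕ x · b′) ⊕ (T (horner a b) ⊕ T (horner a b′))
      ≈⟨ interchange _ _ _ _ ⟩
    (x · b ⊕ T (horner a b)) ⊕ (x · b′ ⊕ T (horner a b′)) ∎

  ·-linear : ∀ s → IsLinear {n} (s ·_)
  ·-linear s = record { cong = ·-cong R.refl ; ⊕-homo = ·-distribˡ s ; ·-homo = ·-comm s }

  horner-·ʳ : ∀ {k} s (a : Vec R.Carrier k) b → horner a (s · b) ≋ s · horner a b
  horner-·ʳ s a b = ≋-sym (horner-natural (·-linear s) (λ v → ≋-sym (T.·-homo s v)) a b)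

  horner-Tʳ : ∀ {k} (a : Vec R.Carrier k) b → horner a (T b) ≋ T (horner a b)
  horner-Tʳ a b = ≋-sym (horner-natural T-linear (λ v → ≋-refl) a b)

  horner-linear : ∀ {k} (a : Vec R.Carrier k) → IsLinear (horner a)
  horner-linear a = record
    { cong = horner-congʳ a ; ⊕-homo = horner-⊕ʳ a ; ·-homo = λ s → horner-·ʳ s a }

  module _ (e : V) (expand : ∀ a → a ⊛ e ≋ a) where

    -- Both products are polynomials in `T` applied to the generator `e`, and polynomials in one
    -- operator commute.
    ⊛-comm : ∀ a b → a ⊛ b ≋ b ⊛ a
    ⊛-comm a b = begin
      a ⊛ b       ≈⟨ horner-congʳ a (expand b) ⟨
      a ⊛ (b ⊛ e) ≈⟨ horner-natural (horner-linear a) (horner-Tʳ a) b e ⟩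
      b ⊛ (a ⊛ e) ≈⟨ horner-congʳ b (expand a) ⟩
      b ⊛ a       ∎

    ⊛-assoc : ∀ a b c → (a ⊛ b) ⊛ c ≋ a ⊛ (b ⊛ c)
    ⊛-assoc a b c = begin
      (a ⊛ b) ⊛ c ≈⟨ ⊛-comm (a ⊛ b) c ⟩
      c ⊛ (a ⊛ b) ≈⟨ horner-natural (horner-linear c) (horner-Tʳ c) a b ⟩
      a ⊛ (c ⊛ b) ≈⟨ horner-congʳ a (⊛-comm c b) ⟩
      a ⊛ (b ⊛ c) ∎

    commutativeRing : CommutativeRing 0ℓ 0ℓ
    commutativeRing = record
      { Carrier = V
      ; _≈_ = _≋_
      ; _+_ = _⊕_
      ; _*_ = _⊛_
      ; -_ = ⊖_
      ; 0# = 𝟘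
      ; 1# = e
      ; isCommutativeRing = record
        { isRing = record
          { +-isAbelianGroup = AbelianGroup.isAbelianGroup (⊕-abelianGroup n)
          ; *-cong = horner-cong
          ; *-assoc = ⊛-assoc
          ; *-identity = (λ a → ≋-trans (⊛-comm e a) (expand a)) , expand
          ; distrib = horner-⊕ʳ , λ b a a′ → horner-⊕ˡ a a′ b
          }
        ; *-comm = ⊛-comm
        }
      }

module Quotient (R : CommutativeRing 0ℓ 0ℓ) (m : CommutativeRing.Carrier R) where
  open CommutativeRing R
  open RingProperties ring using (-‿distribʳ-*; -‿+-comm)
  open import Algebra.Properties.CommutativeSemigroup +-commutativeSemigroup using (interchange)
  open SetoidReasoning setoid

  infix 4 _≅_
  _≅_ : Carrier → Carrier → Set
  a ≅ b = ∃[ t ] a ≈ b + m * t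

  ≈⇒≅ : ∀ {a b} → a ≈ b → a ≅ b
  ≈⇒≅ {a} {b} a≈b = 0# , (begin
    a          ≈⟨ a≈b ⟩
    b          ≈⟨ +-identityʳ b ⟨
    b + 0#     ≈⟨ +-congˡ (zeroʳ m) ⟨
    b + m * 0# ∎)

  ≅-trans : ∀ {a b c} → a ≅ b → b ≅ c → a ≅ c
  ≅-trans {a} {b} {c} (s , a≅b) (t , b≅c) = t + s , (begin
    a                     ≈⟨ a≅b ⟩
    b + m * s             ≈⟨ +-congʳ b≅c ⟩
    c + m * t + m * s     ≈⟨ +-assoc c _ _ ⟩
    c + (m * t + m * s)   ≈⟨ +-congˡ (distribˡ m t s) ⟨
    c + m * (t + s)       ∎)

  ≅-sym : ∀ {a b} → a ≅ b → b ≅ a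
  ≅-sym {a} {b} (t , a≅b) = - t , sym (begin
    a + m * - t             ≈⟨ +-cong a≅b (sym (-‿distribʳ-* m t)) ⟩
    b + m * t + - (m * t)   ≈⟨ +-assoc b _ _ ⟩
    b + (m * t + - (m * t)) ≈⟨ +-congˡ (-‿inverseʳ (m * t)) ⟩
    b + 0#                  ≈⟨ +-identityʳ b ⟩
    b                       ∎)

  +-≅-cong : ∀ {a b c d} → a ≅ b → c ≅ d → a + c ≅ b + d
  +-≅-cong {a} {b} {c} {d} (s , a≅b) (t , c≅d) = s + t , (begin
    a + c                     ≈⟨ +-cong a≅b c≅d ⟩
    b + m * s + (d + m * t)   ≈⟨ interchange b _ d _ ⟩
    b + d + (m * s + m * t)   ≈⟨ +-congˡ (distribˡ m s t) ⟨
    b + d + m * (s + t)       ∎)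

  *-≅-congˡ : ∀ {a b} c → a ≅ b → c * a ≅ c * b
  *-≅-congˡ {a} {b} c (t , a≅b) = c * t , (begin
    c * a               ≈⟨ *-congˡ a≅b ⟩
    c * (b + m * t)     ≈⟨ distribˡ c b _ ⟩
    c * b + c * (m * t) ≈⟨ +-congˡ (x∙yz≈y∙xz c m t) ⟩
    c * b + m * (c * t) ∎)
    where open import Algebra.Properties.CommutativeSemigroup *-commutativeSemigroup using (x∙yz≈y∙xz)

  *-≅-cong : ∀ {a b c d} → a ≅ b → c ≅ d → a * c ≅ b * d
  *-≅-cong {a} {b} {c} {d} a≅b c≅d =
    ≅-trans (*-≅-congˡ a c≅d) (≅-trans (≈⇒≅ (*-comm a d)) (≅-trans (*-≅-congˡ d a≅b) (≈⇒≅ (*-comm d b))))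

  -‿≅-cong : ∀ {a b} → a ≅ b → - a ≅ - b
  -‿≅-cong {a} {b} (t , a≅b) = - t , (begin
    - a               ≈⟨ -‿cong a≅b ⟩
    - (b + m * t)     ≈⟨ -‿+-comm b (m * t) ⟨
    - b + - (m * t)   ≈⟨ +-congˡ (-‿distribʳ-* m t) ⟩
    - b + m * - t     ∎)

  quotientRing : CommutativeRing 0ℓ 0ℓ
  quotientRing = record
    { Carrier = Carrier
    ; _≈_ = _≅_
    ; _+_ = _+_
    ; _*_ = _*_
    ; -_ = -_
    ; 0# = 0#
    ; 1# = 1#
    ; isCommutativeRing = record
      { isRing = record
        { +-isAbelianGroup = record
          { isGroup = record
            { isMonoid = record
              { isSemigroup = record
                { isMagma = record
                  { isEquivalence = record { refl = ≈⇒≅ refl ; sym = ≅-sym ; trans = ≅-trans }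
                  ; ∙-cong = +-≅-cong
                  }
                ; assoc = λ a b c → ≈⇒≅ (+-assoc a b c)
                }
              ; identity = (λ a → ≈⇒≅ (+-identityˡ a)) , (λ a → ≈⇒≅ (+-identityʳ a))
              }
            ; inverse = (λ a → ≈⇒≅ (-‿inverseˡ a)) , (λ a → ≈⇒≅ (-‿inverseʳ a))
            ; ⁻¹-cong = -‿≅-cong
            }
          ; comm = λ a b → ≈⇒≅ (+-comm a b)
          }
        ; *-cong = *-≅-cong
        ; *-assoc = λ a b c → ≈⇒≅ (*-assoc a b c)
        ; *-identity = (λ a → ≈⇒≅ (*-identityˡ a)) , (λ a → ≈⇒≅ (*-identityʳ a))
        ; distrib = (λ a b c → ≈⇒≅ (distribˡ a b c)) , (λ a b c → ≈⇒≅ (distribʳ a b c))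
        }
      ; *-comm = λ a b → ≈⇒≅ (*-comm a b)
      }
    }

-- Powers, the Frobenius map, and x³ - x² - 2x + 1

prime∤! : ∀ {p} → Prime p → ∀ k → k < p → p ∣ k ! → ⊥
prime∤! p-prime zero    0<p p∣1  = ℕₚ.<⇒≱ (ℕ.nonTrivial⇒n>1 _) (∣.∣⇒≤ p∣1)
  where instance _ = prime⇒nonTrivial p-prime
prime∤! p-prime (suc k) k<p p∣k! with euclidsLemma (suc k) (k !) p-prime p∣k!
... | inj₁ p∣k  = ℕₚ.<⇒≱ k<p (∣.∣⇒≤ p∣k)
... | inj₂ p∣k! = prime∤! p-prime k (ℕₚ.<-trans (ℕₚ.n<1+n k) k<p) p∣k!

-- p divides p! = C · k! · (p - k)!, but neither of the two factorials.
prime∣C : ∀ {p} → Prime p → ∀ k → 0 < k → k < p → p ∣ p C k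
prime∣C {p} p-prime k 0<k k<p with euclidsLemma (p C k) (k ! ℕ.* (p ∸ k) !) p-prime p∣C*k![p-k]!
  where
  instance
    _ = ℕₚ.m*n≢0 (k !) ((p ∸ k) !) {{ℕₚ._!≢0 k}} {{ℕₚ._!≢0 (p ∸ k)}}
    _ = prime⇒nonZero p-prime
  C*k![p-k]!≡p! : (p C k) ℕ.* (k ! ℕ.* (p ∸ k) !) ≡ p !
  C*k![p-k]!≡p! = ≡.trans (≡.cong (ℕ._* (k ! ℕ.* (p ∸ k) !)) (nCk≡n!/k![n-k]! (ℕₚ.<⇒≤ k<p)))
                          (DivMod.m/n*n≡m (k![n∸k]!∣n! (ℕₚ.<⇒≤ k<p)))
  p∣p! : ∀ n → .{{ℕ.NonZero n}} → n ∣ n !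
  p∣p! (suc n) = ∣.m∣m*n (n !)
  p∣C*k![p-k]! : p ∣ (p C k) ℕ.* (k ! ℕ.* (p ∸ k) !)
  p∣C*k![p-k]! = ≡.subst (p ∣_) (≡.sym C*k![p-k]!≡p!) (p∣p! p)
... | inj₁ p∣C = p∣C
... | inj₂ p∣k![p-k]! = ⊥-elim ([ prime∤! p-prime k k<p , prime∤! p-prime (p ∸ k) p-k<p ]′
                                 (euclidsLemma (k !) ((p ∸ k) !) p-prime p∣k![p-k]!))
  where
  p-k<p : p ∸ k < p
  p-k<p = ℕₚ.∸-monoʳ-< 0<k (ℕₚ.<⇒≤ k<p)

module Powers (R : CommutativeRing 0ℓ 0ℓ) where
  open CommutativeRing R
  open import Algebra.Properties.Semiring.Exp semiring public using (_^_; ^-congˡ; ^-congʳ; ^-homo-*; ^-assocʳ)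
  open import Algebra.Properties.CommutativeSemiring.Exp commutativeSemiring public using (^-distrib-*)
  open SetoidReasoning setoid

  1^ : ∀ n → 1# ^ n ≈ 1#
  1^ zero    = refl
  1^ (suc n) = trans (*-identityˡ _) (1^ n)

  ^-∣ : ∀ {x m n} → x ^ m ≈ 1# → m ∣ n → x ^ n ≈ 1#
  ^-∣ {x} {m} x^m≈1 (divides k ≡.refl) = begin
    x ^ (k ℕ.* m) ≈⟨ ^-congʳ x (ℕₚ.*-comm k m) ⟩
    x ^ (m ℕ.* k) ≈⟨ ^-assocʳ x m k ⟨
    (x ^ m) ^ k   ≈⟨ ^-congˡ k x^m≈1 ⟩
    1# ^ k        ≈⟨ 1^ k ⟩
    1#            ∎

  ^-reduce : ∀ {x m} → x ^ m ≈ 1# → ∀ k j → x ^ (j ℕ.+ k ℕ.* m) ≈ x ^ j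
  ^-reduce {x} {m} x^m≈1 k j = begin
    x ^ (j ℕ.+ k ℕ.* m)   ≈⟨ ^-homo-* x j (k ℕ.* m) ⟩
    x ^ j * x ^ (k ℕ.* m) ≈⟨ *-congˡ (^-∣ x^m≈1 (∣.n∣m*n k)) ⟩
    x ^ j * 1#            ≈⟨ *-identityʳ _ ⟩
    x ^ j                 ∎

  ^-% : ∀ {x} m .{{_ : ℕ.NonZero m}} → x ^ m ≈ 1# → ∀ n → x ^ n ≈ x ^ (n DivMod.% m)
  ^-% {x} m x^m≈1 n = trans (^-congʳ x (DivMod.m≡m%n+[m/n]*n n m)) (^-reduce {m = m} x^m≈1 (n DivMod./ m) (n DivMod.% m))

  -- The two forms of the Bézout identity keep all exponents natural, so x need not be inverted.
  ^-Bézout : ∀ {x d m n} → Bézout.Identity d m n → x ^ m ≈ 1# → x ^ n ≈ 1# → x ^ d ≈ 1#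
  ^-Bézout {x} {d} {m} {n} (Bézout.+- a b d+bn≡am) x^m≈1 x^n≈1 =
    trans (sym (^-reduce {m = n} x^n≈1 b d)) (trans (^-congʳ x d+bn≡am) (^-∣ x^m≈1 (∣.n∣m*n a)))
  ^-Bézout {x} {d} {m} {n} (Bézout.-+ a b d+am≡bn) x^m≈1 x^n≈1 =
    trans (sym (^-reduce {m = m} x^m≈1 a d)) (trans (^-congʳ x d+am≡bn) (^-∣ x^n≈1 (∣.n∣m*n b)))

  cancel-unit : ∀ {u v} → u * v ≈ 1# → ∀ {x y} → x * u ≈ y * u → x ≈ y
  cancel-unit {u} {v} uv≈1 {x} {y} xu≈yu = begin
    x           ≈⟨ *-identityʳ x ⟨
    x * 1#      ≈⟨ *-congˡ uv≈1 ⟨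
    x * (u * v) ≈⟨ *-assoc x u v ⟨
    x * u * v   ≈⟨ *-congʳ xu≈yu ⟩
    y * u * v   ≈⟨ *-assoc y u v ⟩
    y * (u * v) ≈⟨ *-congˡ uv≈1 ⟩
    y * 1#      ≈⟨ *-identityʳ y ⟩
    y           ∎

  -- For a power q of the characteristic this turns u^q = u, the outcome of a Frobenius argument,
  -- into u^(q-1) = 1.
  fixed-unit⇒root : ∀ {u v} → u * v ≈ 1# → ∀ n → u ^ suc n ≈ u → u ^ n ≈ 1#
  fixed-unit⇒root uv≈1 n u^[1+n]≈u =
    cancel-unit uv≈1 (trans (*-comm _ _) (trans u^[1+n]≈u (sym (*-identityˡ _))))

  unit^ : ∀ {u v} → u * v ≈ 1# → ∀ n → u ^ n * v ^ n ≈ 1#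
  unit^ {u} {v} uv≈1 n = trans (sym (^-distrib-* u v n)) (trans (^-congˡ n uv≈1) (1^ n))

module Frobenius (R : CommutativeRing 0ℓ 0ℓ) {p : ℕ} (p-prime : Prime p)
                 (p×1≈0 : CommutativeRing._≈_ R (Mult._×_ (CommutativeRing.semiring R) p (CommutativeRing.1# R)) (CommutativeRing.0# R)) where
  open CommutativeRing R
  open Mult semiring
  open Powers R
  open import Algebra.Properties.Semiring.Sum semiring
    using (sum; sum-cong-≋; sum-init-last; sum-replicate-zero)
  open import Algebra.Properties.CommutativeSemiring.Binomial commutativeSemiring
    using (theorem; binomialTerm; binomial)
  open SetoidReasoning setoid

  ×≈0 : ∀ {n} x → p ∣ n → n × x ≈ 0#
  ×≈0 {n} x (divides k ≡.refl) = begin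
    (k ℕ.* p) × x      ≈⟨ ×-assocˡ x k p ⟨
    k × (p × x)        ≈⟨ ×-congʳ k (×-congʳ p (*-identityˡ x)) ⟨
    k × (p × (1# * x)) ≈⟨ ×-congʳ k (×-assoc-* p 1# x) ⟨
    k × (p × 1# * x)   ≈⟨ ×-congʳ k (trans (*-congʳ p×1≈0) (zeroˡ x)) ⟩
    k × 0#             ≈⟨ ×-zeroʳ k ⟩
    0#                 ∎
    where
    ×-zeroʳ : ∀ k → k × 0# ≈ 0#
    ×-zeroʳ zero    = refl
    ×-zeroʳ (suc k) = trans (+-identityˡ _) (×-zeroʳ k)

  ^p-+ : ∀ x y → (x + y) ^ p ≈ x ^ p + y ^ p
  ^p-+ x y = helper p ≡.refl
    where
    -- The exponent is generalised so that it can be matched as a successor, which splits the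
    -- binomial sum into its first, middle and last terms.
    helper : ∀ n → n ≡ p → (x + y) ^ n ≈ x ^ n + y ^ n
    helper zero 0≡p = ⊥-elim (ℕₚ.<⇒≢ (ℕ.>-nonZero⁻¹ p) 0≡p)
      where instance _ = prime⇒nonZero p-prime
    helper n@(suc n-1) ≡.refl = begin
      (x + y) ^ n             ≈⟨ theorem n x y ⟩
      sum t                   ≈⟨ refl ⟩
      t Fin.zero + sum (t ∘ Fin.suc)
        ≈⟨ +-congˡ (sum-init-last (t ∘ Fin.suc)) ⟩
      t Fin.zero + (sum {n-1} (t ∘ Fin.suc ∘ inject₁) + t (fromℕ n))
        ≈⟨ +-cong first (+-cong (trans (sum-cong-≋ middle) (sum-replicate-zero n-1)) last) ⟩
      y ^ n + (0# + x ^ n)     ≈⟨ +-congˡ (+-identityˡ _) ⟩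
      y ^ n + x ^ n           ≈⟨ +-comm _ _ ⟩
      x ^ n + y ^ n           ∎
      where
      t : Fin (suc n) → Carrier
      t = binomialTerm x y n
      first : t Fin.zero ≈ y ^ n
      first = trans (×-homo-1 _) (*-identityˡ _)
      middle : ∀ i → t (Fin.suc (inject₁ i)) ≈ 0#
      middle i = ×≈0 (binomial x y n (Fin.suc (inject₁ i)))
        (prime∣C p-prime _ (s≤s z≤n)
          (s≤s (≡.subst (_< n-1) (≡.sym (Finₚ.toℕ-inject₁ i)) (Finₚ.toℕ<n i))))
      last : t (fromℕ n) ≈ x ^ n
      last rewrite Finₚ.toℕ-fromℕ n-1 | nCn≡1 n | ℕₚ.n∸n≡0 n-1 = trans (×-homo-1 _) (*-identityʳ _)

  module _ (k : ℕ) where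
    private
      q = p ℕ.^ k

      iterate : ∀ k {x y} → (x + y) ^ (p ℕ.^ k) ≈ x ^ (p ℕ.^ k) + y ^ (p ℕ.^ k)
      iterate zero = trans (*-identityʳ _) (+-cong (sym (*-identityʳ _)) (sym (*-identityʳ _)))
      iterate (suc k) {x} {y} = begin
        (x + y) ^ (p ℕ.* p ℕ.^ k)                           ≈⟨ ^-assocʳ (x + y) p _ ⟨
        ((x + y) ^ p) ^ (p ℕ.^ k)                           ≈⟨ ^-congˡ (p ℕ.^ k) (^p-+ x y) ⟩
        (x ^ p + y ^ p) ^ (p ℕ.^ k)                         ≈⟨ iterate k ⟩
        (x ^ p) ^ (p ℕ.^ k) + (y ^ p) ^ (p ℕ.^ k)           ≈⟨ +-cong (^-assocʳ x p _) (^-assocʳ y p _) ⟩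
        x ^ (p ℕ.* p ℕ.^ k) + y ^ (p ℕ.* p ℕ.^ k)           ∎

    ^q-+ : ∀ x y → (x + y) ^ q ≈ x ^ q + y ^ q
    ^q-+ x y = iterate k

    0^q : 0# ^ q ≈ 0#
    0^q with q | ℕₚ.m^n≢0 p k {{prime⇒nonZero p-prime}}
    ... | suc q-1 | _ = zeroˡ _

    -- Fermat's little theorem, by induction from the additivity of the Frobenius map.
    ^q-× : ∀ n → (n × 1#) ^ q ≈ n × 1#
    ^q-× zero    = 0^q
    ^q-× (suc n) = trans (^q-+ 1# (n × 1#)) (+-cong (1^ q) (^q-× n))

    ^q-neg : ∀ x → (- x) ^ q ≈ - (x ^ q)
    ^q-neg x = inverseʳ-unique (x ^ q) ((- x) ^ q) (begin
      x ^ q + (- x) ^ q ≈⟨ ^q-+ x (- x) ⟨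
      (x + - x) ^ q     ≈⟨ ^-congˡ q (-‿inverseʳ x) ⟩
      0# ^ q            ≈⟨ 0^q ⟩
      0#                ∎)
      where open import Algebra.Properties.AbelianGroup +-abelianGroup using (inverseʳ-unique)

module CubicPeriods (R : CommutativeRing 0ℓ 0ℓ) where
  open CommutativeRing R
  open Powers R
  open RingProperties ring using (+-cancelʳ)
  open SetoidReasoning setoid
  open SemiringSolver commutativeSemiring using (solve; _:=_; _:+_; _:*_; _:^_; con)

  2# 3# 4# : Carrier
  2# = 1# + 1#
  3# = 2# + 1#
  4# = 2# + 2#

  -- x³ - x² - 2x + 1 is the minimal polynomial of ζ₁₄ + ζ₁₄⁻¹.  All identities are
  -- arranged so that no subtraction occurs.
  root : ∀ {y₁ y₂ y₃} → y₁ + y₂ + y₃ ≈ 1# →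
         y₁ * y₂ + y₁ * y₃ + y₂ * y₃ + 2# ≈ 0# → y₁ * y₂ * y₃ + 1# ≈ 0# →
         y₁ ^ 3 + 1# ≈ y₁ ^ 2 + 2# * y₁
  root {y₁} {y₂} {y₃} e₁ e₂ e₃ = +-cancelʳ (y₁ * y₂ * y₃) _ _ (begin
    y₁ ^ 3 + 1# + y₁ * y₂ * y₃                            ≈⟨ +-assoc _ _ _ ⟩
    y₁ ^ 3 + (1# + y₁ * y₂ * y₃)                          ≈⟨ +-congˡ (trans (+-comm _ _) e₃) ⟩
    y₁ ^ 3 + 0#                                           ≈⟨ +-congˡ (trans (*-congˡ e₂) (zeroʳ y₁)) ⟨
    y₁ ^ 3 + y₁ * (y₁ * y₂ + y₁ * y₃ + y₂ * y₃ + 2#)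
      ≈⟨ solve 3 (λ a b c → a :^ 3 :+ a :* (a :* b :+ a :* c :+ b :* c :+ con 2)
                            := a :^ 2 :* (a :+ b :+ c) :+ con 2 :* a :+ a :* b :* c) refl y₁ y₂ y₃ ⟩
    y₁ ^ 2 * (y₁ + y₂ + y₃) + 2# * y₁ + y₁ * y₂ * y₃
      ≈⟨ +-congʳ (+-congʳ (trans (*-congˡ e₁) (*-identityʳ _))) ⟩
    y₁ ^ 2 + 2# * y₁ + y₁ * y₂ * y₃                       ∎)

  module _ {v w : Carrier} (vw≈1 : v * w ≈ 1#) (y-root : (v + w) ^ 3 + 1# ≈ (v + w) ^ 2 + 2# * (v + w)) where

    private
      y : Carrier
      y = v + w

      v*y : v * y ≈ v * v + 1#
      v*y = trans (distribˡ v v w) (+-congˡ vw≈1)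

    -- Since v y = v² + 1, multiplying the cubic for y by v³ leaves a polynomial in v alone, namely
    -- Φ₁₄. The summands cancelled at the end are the surplus common to both sides.
    cyclotomic : v ^ 6 + v ^ 4 + v ^ 2 + 1# ≈ v ^ 5 + v ^ 3 + v
    cyclotomic = +-cancelʳ (2# * v ^ 4 + 2# * v ^ 2 + v ^ 3) _ _ (begin
      v ^ 6 + v ^ 4 + v ^ 2 + 1# + (2# * v ^ 4 + 2# * v ^ 2 + v ^ 3)
        ≈⟨ solve 1 (λ v → v :^ 6 :+ v :^ 4 :+ v :^ 2 :+ con 1 :+ (con 2 :* v :^ 4 :+ con 2 :* v :^ 2 :+ v :^ 3)
                          := (v :* v :+ con 1) :^ 3 :+ v :^ 3) refl v ⟩
      (v * v + 1#) ^ 3 + v ^ 3                ≈⟨ +-congʳ (^-congˡ 3 v*y) ⟨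
      (v * y) ^ 3 + v ^ 3
        ≈⟨ solve 2 (λ v y → (v :* y) :^ 3 :+ v :^ 3 := v :^ 3 :* (y :^ 3 :+ con 1)) refl v y ⟩
      v ^ 3 * (y ^ 3 + 1#)                    ≈⟨ *-congˡ y-root ⟩
      v ^ 3 * (y ^ 2 + 2# * y)
        ≈⟨ solve 2 (λ v y → v :^ 3 :* (y :^ 2 :+ con 2 :* y)
                            := v :* (v :* y) :^ 2 :+ con 2 :* v :^ 2 :* (v :* y)) refl v y ⟩
      v * (v * y) ^ 2 + 2# * v ^ 2 * (v * y)  ≈⟨ +-cong (*-congˡ (^-congˡ 2 v*y)) (*-congˡ v*y) ⟩
      v * (v * v + 1#) ^ 2 + 2# * v ^ 2 * (v * v + 1#)
        ≈⟨ solve 1 (λ v → v :* (v :* v :+ con 1) :^ 2 :+ con 2 :* v :^ 2 :* (v :* v :+ con 1)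
                          := v :^ 5 :+ v :^ 3 :+ v :+ (con 2 :* v :^ 4 :+ con 2 :* v :^ 2 :+ v :^ 3)) refl v ⟩
      v ^ 5 + v ^ 3 + v + (2# * v ^ 4 + 2# * v ^ 2 + v ^ 3) ∎)

    -- (v + 1) Φ₁₄(v) = v⁷ + 1.
    v⁷+1≈0 : v ^ 7 + 1# ≈ 0#
    v⁷+1≈0 = +-cancelʳ (v * (v ^ 5 + v ^ 3 + v) + (v ^ 5 + v ^ 3 + v)) _ _ (begin
      v ^ 7 + 1# + (v * (v ^ 5 + v ^ 3 + v) + (v ^ 5 + v ^ 3 + v))
        ≈⟨ solve 1 (λ v → v :^ 7 :+ con 1 :+ (v :* (v :^ 5 :+ v :^ 3 :+ v) :+ (v :^ 5 :+ v :^ 3 :+ v))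
                          := v :* (v :^ 6 :+ v :^ 4 :+ v :^ 2 :+ con 1) :+ (v :^ 6 :+ v :^ 4 :+ v :^ 2 :+ con 1)) refl v ⟩
      v * (v ^ 6 + v ^ 4 + v ^ 2 + 1#) + (v ^ 6 + v ^ 4 + v ^ 2 + 1#)
        ≈⟨ +-cong (*-congˡ cyclotomic) cyclotomic ⟩
      v * (v ^ 5 + v ^ 3 + v) + (v ^ 5 + v ^ 3 + v) ≈⟨ +-identityˡ _ ⟨
      0# + (v * (v ^ 5 + v ^ 3 + v) + (v ^ 5 + v ^ 3 + v)) ∎)

    v¹⁴≈1 : v ^ 14 ≈ 1#
    v¹⁴≈1 = +-cancelʳ (v ^ 7) _ _ (begin
      v ^ 14 + v ^ 7     ≈⟨ solve 1 (λ v → v :^ 14 :+ v :^ 7 := v :^ 7 :* (v :^ 7 :+ con 1)) refl v ⟩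
      v ^ 7 * (v ^ 7 + 1#) ≈⟨ trans (*-congˡ v⁷+1≈0) (zeroʳ _) ⟩
      0#                 ≈⟨ v⁷+1≈0 ⟨
      v ^ 7 + 1#         ≈⟨ +-comm _ _ ⟩
      1# + v ^ 7         ∎)

    -- With v² = 1 the cyclotomic relation reads 4 = 3v, and squaring gives 16 = 9.
    v²≈1⇒7≈0 : v ^ 2 ≈ 1# → 4# + 3# ≈ 0#
    v²≈1⇒7≈0 v²≈1 = +-cancelʳ (3# * 3#) _ _ (begin
      4# + 3# + 3# * 3#  ≈⟨ solve 0 (con 2 :+ con 2 :+ con 3 :+ con 3 :* con 3
                                     := (con 2 :+ con 2) :* (con 2 :+ con 2)) refl ⟩
      4# * 4#            ≈⟨ *-cong 4≈3v 4≈3v ⟩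
      3# * v * (3# * v)  ≈⟨ solve 1 (λ v → con 3 :* v :* (con 3 :* v) := con 3 :* con 3 :* v :^ 2) refl v ⟩
      3# * 3# * v ^ 2    ≈⟨ *-congˡ v²≈1 ⟩
      3# * 3# * 1#       ≈⟨ trans (*-identityʳ _) (sym (+-identityˡ _)) ⟩
      0# + 3# * 3#       ∎)
      where
      4≈3v : 4# ≈ 3# * v
      4≈3v = begin
        4#  ≈⟨ solve 0 (con 2 :+ con 2 := con 1 :* con 1 :* con 1 :+ con 1 :* con 1 :+ con 1 :+ con 1) refl ⟩
        1# * 1# * 1# + 1# * 1# + 1# + 1#
          ≈⟨ +-congʳ (+-cong (+-cong (*-cong (*-cong v²≈1 v²≈1) v²≈1) (*-cong v²≈1 v²≈1)) v²≈1) ⟨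
        v ^ 2 * v ^ 2 * v ^ 2 + v ^ 2 * v ^ 2 + v ^ 2 + 1#
          ≈⟨ solve 1 (λ v → v :^ 2 :* v :^ 2 :* v :^ 2 :+ v :^ 2 :* v :^ 2 :+ v :^ 2 :+ con 1
                            := v :^ 6 :+ v :^ 4 :+ v :^ 2 :+ con 1) refl v ⟩
        v ^ 6 + v ^ 4 + v ^ 2 + 1# ≈⟨ cyclotomic ⟩
        v ^ 5 + v ^ 3 + v
          ≈⟨ solve 1 (λ v → v :^ 5 :+ v :^ 3 :+ v := v :^ 2 :* v :^ 2 :* v :+ v :^ 2 :* v :+ v) refl v ⟩
        v ^ 2 * v ^ 2 * v + v ^ 2 * v + v
          ≈⟨ +-congʳ (+-cong (*-congʳ (*-cong v²≈1 v²≈1)) (*-congʳ v²≈1)) ⟩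
        1# * 1# * v + 1# * v + v
          ≈⟨ solve 1 (λ v → con 1 :* con 1 :* v :+ con 1 :* v :+ v := con 3 :* v) refl v ⟩
        3# * v ∎

-- The rings ℤ[ζ] and ℤ[ζ][X]/(X²⁹ - 1)

module Expansion (R : CommutativeRing 0ℓ 0ℓ) {m : ℕ} (T : Vec (CommutativeRing.Carrier R) (suc m) → Vec (CommutativeRing.Carrier R) (suc m))
                 (T-linear : Vectors.IsLinear R T)
                 (T-shift : ∀ v → Vectors._≋_ R (T (v ∷ʳ CommutativeRing.0# R)) (CommutativeRing.0# R ∷ v)) where
  open Vectors R
  private module R = CommutativeRing R
  private module T = IsLinear T-linear
  open Cyclic R T T-linear using (horner; _⊛_)

  e₀ : Vec R.Carrier (suc m)
  e₀ = R.1# ∷ 𝟘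

  private
    padRight-∷ʳ : ∀ {k n} (p : k ≤ n) (q : k ≤ suc n) (v : Vec R.Carrier k) →
                  padRight q R.0# v ≡ padRight p R.0# v ∷ʳ R.0#
    padRight-∷ʳ {n = zero}  z≤n     z≤n     [] = ≡.refl
    padRight-∷ʳ {n = suc n} z≤n     z≤n     [] = ≡.cong (R.0# ∷_) (padRight-∷ʳ z≤n z≤n [])
    padRight-∷ʳ             (s≤s p) (s≤s q) (x ∷ v) = ≡.cong (x ∷_) (padRight-∷ʳ p q v)

    -- The vector to which `T` is applied holds at most m coefficients, so its last coordinate is 0
    -- and `T-shift` applies: nothing overflows into the relation that defines `T`.
    horner-padRight : ∀ {k} (k≤n : k ≤ suc m) (a : Vec R.Carrier k) → horner a e₀ ≋ padRight k≤n R.0# a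
    horner-padRight z≤n []       = ≋-refl
    horner-padRight (s≤s k≤m) (x ∷ a) = ≋-trans
      (⊕-cong ≋-refl (≋-trans (T.cong (≋-trans (horner-padRight k≤1+m a)
                                               (≋-reflexive (padRight-∷ʳ k≤m k≤1+m a))))
                              (T-shift _)))
      (R.trans (R.+-identityʳ _) (R.*-identityʳ x)
       ∷ ≋-trans (⊕-cong (·-zeroʳ x) ≋-refl) (⊕-identityˡ _))
      where k≤1+m = ℕₚ.m≤n⇒m≤1+n k≤m

  expand : ∀ a → a ⊛ e₀ ≋ a
  expand a = ≋-trans (horner-padRight ℕₚ.≤-refl a) (≋-reflexive (Vecₚ.padRight-refl R.0# a))

IsHom : (R S : CommutativeRing 0ℓ 0ℓ) → (CommutativeRing.Carrier R → CommutativeRing.Carrier S) → Set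
IsHom R S = IsSemiringHomomorphism (RawRing.rawSemiring (CommutativeRing.rawRing R)) (RawRing.rawSemiring (CommutativeRing.rawRing S))

module Evaluation (R S : CommutativeRing 0ℓ 0ℓ) {c : CommutativeRing.Carrier R → CommutativeRing.Carrier S}
                  (c-hom : IsHom R S c) where
  open Vectors R
  open CommutativeRing S
  open Mult semiring using (_×_)
  open import Algebra.Properties.CommutativeSemigroup +-commutativeSemigroup using (interchange)
  open import Algebra.Properties.CommutativeSemigroup *-commutativeSemigroup using (x∙yz≈y∙xz)
  private
    module R = CommutativeRing R
    module R× = Mult R.semiring
    module c = IsSemiringHomomorphism c-hom

  eval : ∀ {k} → Carrier → Vec R.Carrier k → Carrier
  eval y a = Vec.foldr′ (λ aᵢ acc → c aᵢ + y * acc) 0# a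

  eval-congˡ : ∀ {k y z} (a : Vec R.Carrier k) → y ≈ z → eval y a ≈ eval z a
  eval-congˡ []      y≈z = refl
  eval-congˡ (x ∷ a) y≈z = +-congˡ (*-cong y≈z (eval-congˡ a y≈z))

  eval-congʳ : ∀ {k} y {a b : Vec R.Carrier k} → a ≋ b → eval y a ≈ eval y b
  eval-congʳ y []        = refl
  eval-congʳ y (p ∷ a≋b) = +-cong (c.⟦⟧-cong p) (*-congˡ (eval-congʳ y a≋b))

  -- Used for the Frobenius map, where it moves an exponent from a polynomial to its argument, and
  -- for Galois automorphisms, where it composes them.
  eval-natural : ∀ {φ : Carrier → Carrier} → φ 0# ≈ 0# → (∀ x y → φ (x + y) ≈ φ x + φ y) →
                 (∀ x y → φ (x * y) ≈ φ x * φ y) → (∀ b → φ (c b) ≈ c b) →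
                 ∀ {k} y (a : Vec R.Carrier k) → φ (eval y a) ≈ eval (φ y) a
  eval-natural φ0 φ+ φ* φc y []      = φ0
  eval-natural φ0 φ+ φ* φc y (x ∷ a) =
    trans (φ+ _ _) (+-cong (φc x) (trans (φ* _ _) (*-congˡ (eval-natural φ0 φ+ φ* φc y a))))

  eval-⊕ : ∀ {k} y (a b : Vec R.Carrier k) → eval y (a ⊕ b) ≈ eval y a + eval y b
  eval-⊕ y []      []      = sym (+-identityˡ 0#)
  eval-⊕ y (x ∷ a) (z ∷ b) = trans
    (+-cong (c.+-homo x z) (trans (*-congˡ (eval-⊕ y a b)) (distribˡ y _ _)))
    (interchange _ _ _ _)

  eval-· : ∀ {k} y s (a : Vec R.Carrier k) → eval y (s · a) ≈ c s * eval y a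
  eval-· y s []      = sym (zeroʳ (c s))
  eval-· y s (x ∷ a) = trans
    (+-cong (c.*-homo s x) (trans (*-congˡ (eval-· y s a)) (x∙yz≈y∙xz y _ _)))
    (sym (distribˡ (c s) _ _))

  eval-𝟘 : ∀ y k → eval y (𝟘 {k}) ≈ 0#
  eval-𝟘 y zero    = refl
  eval-𝟘 y (suc k) = trans (+-cong c.0#-homo (trans (*-congˡ (eval-𝟘 y k)) (zeroʳ y))) (+-identityˡ 0#)

  eval-const : ∀ y k r → eval y (r ∷ 𝟘 {k}) ≈ c r
  eval-const y k r = trans (+-congˡ (trans (*-congˡ (eval-𝟘 y k)) (zeroʳ y))) (+-identityʳ _)

  module _ {n : ℕ} {T : Vec R.Carrier n → Vec R.Carrier n} {T-linear : IsLinear T} where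
    open Cyclic R T T-linear using (horner; _⊛_)

    -- The hypothesis says that y satisfies the relation built into `T`; evaluation then factors
    -- through the quotient of the polynomial ring.
    eval-⊛ : ∀ {y} → (∀ a → eval y (T a) ≈ y * eval y a) →
             ∀ a b → eval y (a ⊛ b) ≈ eval y a * eval y b
    eval-⊛ {y} eval-T a b = helper a
      where
      helper : ∀ {k} (a : Vec R.Carrier k) → eval y (horner a b) ≈ eval y a * eval y b
      helper []      = trans (eval-𝟘 y n) (sym (zeroˡ _))
      helper (x ∷ a) = trans (eval-⊕ y (x · b) _) (trans
        (+-cong (eval-· y x b) (trans (eval-T _) (trans (*-congˡ (helper a)) (sym (*-assoc y _ _)))))
        (sym (distribʳ (eval y b) (c x) _)))

  c-× : ∀ n → n × 1# ≈ c (n R×.× R.1#)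
  c-× zero    = sym c.0#-homo
  c-× (suc n) = trans (+-cong (sym c.1#-homo) (c-× n)) (sym (c.+-homo R.1# _))

module Adjunction (R : CommutativeRing 0ℓ 0ℓ) {m : ℕ} (T : Vec (CommutativeRing.Carrier R) (suc m) → Vec (CommutativeRing.Carrier R) (suc m))
                  (T-linear : Vectors.IsLinear R T)
                  (T-shift : ∀ v → Vectors._≋_ R (T (v ∷ʳ CommutativeRing.0# R)) (CommutativeRing.0# R ∷ v)) where
  open Vectors R
  private module R = CommutativeRing R
  open Expansion R T T-linear T-shift public using (e₀)
  open Expansion R T T-linear T-shift using (expand)
  private module C = Cyclic R T T-linear

  extension : CommutativeRing 0ℓ 0ℓ
  extension = C.commutativeRing e₀ expand

  open CommutativeRing extension
  private module T = IsLinear T-linear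

  const : R.Carrier → Carrier
  const r = r ∷ 𝟘

  X : Carrier
  X = T e₀

  const≈·e₀ : ∀ r → const r ≈ r · e₀
  const≈·e₀ r = R.sym (R.*-identityʳ r) ∷ ≋-sym (·-zeroʳ r)

  const-* : ∀ r v → const r * v ≈ r · v
  const-* r v = trans (*-congʳ (const≈·e₀ r)) (trans (C.horner-·ˡ r e₀ v) (·-cong R.refl (*-identityˡ v)))

  const-hom : IsHom R extension const
  const-hom = record
    { isNearSemiringHomomorphism = record
      { +-isMonoidHomomorphism = record
        { isMagmaHomomorphism = record
          { isRelHomomorphism = record { cong = λ r≈s → r≈s ∷ ≋-refl }
          ; homo = λ r s → R.refl ∷ ≋-sym (⊕-identityˡ 𝟘)
          }
        ; ε-homo = ≋-refl
        }
      ; *-homo = λ r s → sym (trans (const-* r (const s)) (R.refl ∷ ·-zeroʳ r))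
      }
    ; 1#-homo = ≋-refl
    }

  X-* : ∀ v → X * v ≈ T v
  X-* v = trans (*-comm X v) (trans (C.horner-Tʳ v e₀) (T.cong (*-identityʳ v)))

  open Evaluation R extension const-hom using (eval)
  open Powers extension using (_^_; ^-∣; ^-%; ^-congˡ; ^-assocʳ)

  T^ : ℕ → Carrier → Carrier
  T^ zero    v = v
  T^ (suc k) v = T (T^ k v)

  T^-cong : ∀ k {u v} → u ≈ v → T^ k u ≈ T^ k v
  T^-cong zero    u≈v = u≈v
  T^-cong (suc k) u≈v = T.cong (T^-cong k u≈v)

  X^-* : ∀ k v → X ^ k * v ≈ T^ k v
  X^-* zero    v = *-identityˡ v
  X^-* (suc k) v = trans (*-assoc X (X ^ k) v) (trans (X-* (X ^ k * v)) (T.cong (X^-* k v)))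

  -- Evaluation at Xⁿ in which multiplication by X is iterated `T`. On closed vectors this form is
  -- cheap enough to be decided by computation.
  evalᵀ : ℕ → ∀ {k} → Vec R.Carrier k → Carrier
  evalᵀ n a = Vec.foldr′ (λ aᵢ acc → const aᵢ + T^ n acc) 0# a

  eval-X^ : ∀ n {k} (a : Vec R.Carrier k) → eval (X ^ n) a ≈ evalᵀ n a
  eval-X^ n []      = refl
  eval-X^ n (x ∷ a) = +-congˡ {x = const x} (trans (X^-* n (eval (X ^ n) a)) (T^-cong n (eval-X^ n a)))

  -- A record, so that the type checker never normalises T^ k at a numeral k.
  record HasOrder (k : ℕ) : Set where
    field T^k≡1 : T^ k 1# ≡ 1#

  module _ (k : ℕ) (k-order : HasOrder k) where
    open HasOrder k-order

    X^≈1 : X ^ k ≈ 1#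
    X^≈1 = trans (sym (*-identityʳ (X ^ k))) (trans (X^-* k 1#) (reflexive T^k≡1))

    X^-∣ : ∀ {n} → k ∣ n → X ^ n ≈ 1#
    X^-∣ = ^-∣ {X} {k} X^≈1

    T^-∣ : ∀ j {n} → k ∣ n → T^ j 1# ^ n ≈ 1#
    T^-∣ j {n} k∣n = trans (^-congˡ n (trans (sym (X^-* j 1#)) (*-identityʳ (X ^ j))))
      (trans (^-assocʳ X j n) (X^-∣ (∣.∣n⇒∣m*n j k∣n)))

    X^-fixed : ∀ {n l} → n ≡ suc (k ℕ.* l) → X ^ n ≈ X
    X^-fixed {l = l} ≡.refl = trans (*-congˡ {X} (X^-∣ (∣.m∣m*n l))) (*-identityʳ X)

    eval-X^-% : .{{_ : ℕ.NonZero k}} → ∀ {n m} → n % k ≡ m → ∀ {l} (a : Vec R.Carrier l) →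
                eval (X ^ n) a ≈ evalᵀ m a
    eval-X^-% {n} ≡.refl a = trans (eval-congˡ a (^-% {X} k X^≈1 n)) (eval-X^ (n % k) a)
      where open Evaluation R extension const-hom using (eval-congˡ)

  eval-X : ∀ a → eval X a ≈ a
  eval-X a = trans (helper a) (*-identityʳ a)
    where
    helper : ∀ {k} (a : Vec R.Carrier k) → eval X a ≈ C.horner a e₀
    helper []      = refl
    helper (x ∷ a) = +-cong (const≈·e₀ x) (trans (X-* _) (T.cong (helper a)))

module CyclotomicCompanion (R : CommutativeRing 0ℓ 0ℓ) where
  open Vectors R
  private module R = CommutativeRing R
  open R using (Carrier; _≈_)
  open RingProperties R.ring using (-0#≈0#; -‿+-comm; -‿distribʳ-*)
  open import Algebra.Properties.CommutativeSemigroup R.+-commutativeSemigroup using (interchange)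

  X·_ : Vec Carrier 6 → Vec Carrier 6
  X· (a₀ ∷ a₁ ∷ a₂ ∷ a₃ ∷ a₄ ∷ a₅ ∷ []) =
    (R.- a₅) ∷ (a₀ R.+ a₅) ∷ (a₁ R.- a₅) ∷ (a₂ R.+ a₅) ∷ (a₃ R.- a₅) ∷ (a₄ R.+ a₅) ∷ []

  X·-linear : IsLinear X·_
  X·-linear = record
    { cong = λ { (p₀ ∷ p₁ ∷ p₂ ∷ p₃ ∷ p₄ ∷ p₅ ∷ []) →
        R.-‿cong p₅ ∷ R.+-cong p₀ p₅ ∷ R.+-cong p₁ (R.-‿cong p₅) ∷ R.+-cong p₂ p₅
        ∷ R.+-cong p₃ (R.-‿cong p₅) ∷ R.+-cong p₄ p₅ ∷ [] }
    ; ⊕-homo = λ { (a₀ ∷ a₁ ∷ a₂ ∷ a₃ ∷ a₄ ∷ a₅ ∷ []) (b₀ ∷ b₁ ∷ b₂ ∷ b₃ ∷ b₄ ∷ b₅ ∷ []) →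
        R.sym (-‿+-comm a₅ b₅) ∷ interchange a₀ b₀ a₅ b₅ ∷ sub-interchange a₁ b₁ a₅ b₅
        ∷ interchange a₂ b₂ a₅ b₅ ∷ sub-interchange a₃ b₃ a₅ b₅ ∷ interchange a₄ b₄ a₅ b₅ ∷ [] }
    ; ·-homo = λ { s (a₀ ∷ a₁ ∷ a₂ ∷ a₃ ∷ a₄ ∷ a₅ ∷ []) →
        -‿distribʳ-* s a₅ ∷ R.sym (R.distribˡ s a₀ a₅) ∷ sub-distribˡ s a₁ a₅
        ∷ R.sym (R.distribˡ s a₂ a₅) ∷ sub-distribˡ s a₃ a₅ ∷ R.sym (R.distribˡ s a₄ a₅) ∷ [] }
    }
    where
    sub-interchange : ∀ a b c d → (a R.+ b) R.- (c R.+ d) ≈ (a R.- c) R.+ (b R.- d)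
    sub-interchange a b c d = R.trans (R.+-congˡ (R.sym (-‿+-comm c d))) (interchange a b _ _)
    sub-distribˡ : ∀ s a b → s R.* a R.- s R.* b ≈ s R.* (a R.- b)
    sub-distribˡ s a b = R.trans (R.+-congˡ (-‿distribʳ-* s b)) (R.sym (R.distribˡ s a _))

  X·-shift : ∀ v → X· (v ∷ʳ R.0#) ≋ R.0# ∷ v
  X·-shift (a₀ ∷ a₁ ∷ a₂ ∷ a₃ ∷ a₄ ∷ []) =
    -0#≈0# ∷ R.+-identityʳ a₀ ∷ -identityʳ a₁ ∷ R.+-identityʳ a₂ ∷ -identityʳ a₃ ∷ R.+-identityʳ a₄ ∷ []
    where
    -identityʳ : ∀ a → a R.- R.0# ≈ a
    -identityʳ a = R.trans (R.+-congˡ -0#≈0#) (R.+-identityʳ a)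

module Rotation (R : CommutativeRing 0ℓ 0ℓ) where
  open Vectors R
  private module R = CommutativeRing R
  open R using (Carrier; _≈_)

  lastOf : ∀ {n} → Carrier → Vec Carrier n → Carrier
  lastOf x []      = x
  lastOf x (y ∷ v) = lastOf y v

  pushFront : ∀ {n} → Carrier → Vec Carrier n → Vec Carrier n
  pushFront x []      = []
  pushFront x (y ∷ v) = x ∷ pushFront y v

  -- Multiplication by X modulo Xⁿ - 1: the top coefficient wraps round to the constant term.
  rotate : ∀ {n} → Vec Carrier n → Vec Carrier n
  rotate []      = []
  rotate (x ∷ v) = lastOf x v ∷ pushFront x v

  private
    lastOf-cong : ∀ {n x y} {u v : Vec Carrier n} → x ≈ y → u ≋ v → lastOf x u ≈ lastOf y v
    lastOf-cong x≈y []        = x≈y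
    lastOf-cong x≈y (p ∷ u≋v) = lastOf-cong p u≋v

    lastOf-⊕ : ∀ {n} x y (u v : Vec Carrier n) → lastOf (x R.+ y) (u ⊕ v) ≈ lastOf x u R.+ lastOf y v
    lastOf-⊕ x y []      []      = R.refl
    lastOf-⊕ _ _ (x ∷ u) (y ∷ v) = lastOf-⊕ x y u v

    lastOf-· : ∀ {n} s x (v : Vec Carrier n) → lastOf (s R.* x) (s · v) ≈ s R.* lastOf x v
    lastOf-· s x []      = R.refl
    lastOf-· s _ (x ∷ v) = lastOf-· s x v

    lastOf-∷ʳ : ∀ {n} x y (v : Vec Carrier n) → lastOf x (v ∷ʳ y) ≡ y
    lastOf-∷ʳ x y []      = ≡.refl
    lastOf-∷ʳ _ y (x ∷ v) = lastOf-∷ʳ x y v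

    pushFront-cong : ∀ {n x y} {u v : Vec Carrier n} → x ≈ y → u ≋ v → pushFront x u ≋ pushFront y v
    pushFront-cong x≈y []        = []
    pushFront-cong x≈y (p ∷ u≋v) = x≈y ∷ pushFront-cong p u≋v

    pushFront-⊕ : ∀ {n} x y (u v : Vec Carrier n) → pushFront (x R.+ y) (u ⊕ v) ≋ pushFront x u ⊕ pushFront y v
    pushFront-⊕ x y []        []        = []
    pushFront-⊕ x y (x′ ∷ u) (y′ ∷ v) = R.refl ∷ pushFront-⊕ x′ y′ u v

    pushFront-· : ∀ {n} s x (v : Vec Carrier n) → pushFront (s R.* x) (s · v) ≋ s · pushFront x v
    pushFront-· s x []       = []
    pushFront-· s x (x′ ∷ v) = R.refl ∷ pushFront-· s x′ v

    pushFront-∷ʳ : ∀ {n} x y (v : Vec Carrier n) → pushFront x (v ∷ʳ y) ≡ x ∷ v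
    pushFront-∷ʳ x y []       = ≡.refl
    pushFront-∷ʳ x y (x′ ∷ v) = ≡.cong (x ∷_) (pushFront-∷ʳ x′ y v)

  rotate-linear : ∀ {n} → IsLinear (rotate {n})
  rotate-linear = record
    { cong = λ { [] → [] ; (p ∷ u≋v) → lastOf-cong p u≋v ∷ pushFront-cong p u≋v }
    ; ⊕-homo = λ { [] [] → [] ; (x ∷ u) (y ∷ v) → lastOf-⊕ x y u v ∷ pushFront-⊕ x y u v }
    ; ·-homo = λ { s [] → [] ; s (x ∷ v) → lastOf-· s x v ∷ pushFront-· s x v }
    }

  rotate-shift : ∀ {n} (v : Vec Carrier n) → rotate (v ∷ʳ R.0#) ≋ R.0# ∷ v
  rotate-shift []      = ≋-refl
  rotate-shift (x ∷ v) = R.reflexive (lastOf-∷ʳ x R.0# v) ∷ ≋-reflexive (pushFront-∷ʳ x R.0# v)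

module OX = CyclotomicCompanion ℤₚ.+-*-commutativeRing
module Oᴬ = Adjunction ℤₚ.+-*-commutativeRing OX.X·_ OX.X·-linear OX.X·-shift
module OC = Cyclic ℤₚ.+-*-commutativeRing OX.X·_ OX.X·-linear

module AX = Rotation Oᴬ.extension
-- With 28 + 1 coordinates this is ℤ[ζ][X]/(X²⁹ - 1).
module Aᴬ = Adjunction Oᴬ.extension {28} AX.rotate AX.rotate-linear AX.rotate-shift

IsHom-quotient : ∀ R S {c} → IsHom R S c → ∀ m → IsHom R (Quotient.quotientRing S m) c
IsHom-quotient R S c-hom m = record
  { isNearSemiringHomomorphism = record
    { +-isMonoidHomomorphism = record
      { isMagmaHomomorphism = record
        { isRelHomomorphism = record { cong = ≈⇒≅ ∘ ⟦⟧-cong }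
        ; homo = λ x y → ≈⇒≅ (+-homo x y)
        }
      ; ε-homo = ≈⇒≅ 0#-homo
      }
    ; *-homo = λ x y → ≈⇒≅ (*-homo x y)
    }
  ; 1#-homo = ≈⇒≅ 1#-homo
  }
  where
  open IsSemiringHomomorphism c-hom
  open Quotient S m using (≈⇒≅)

module IntegralHom (S : CommutativeRing 0ℓ 0ℓ) {c : ℤ → CommutativeRing.Carrier S}
                   (c-hom : IsHom ℤₚ.+-*-commutativeRing S c) where
  open CommutativeRing S
  open Powers S
  open Mult semiring using (_×_)
  open Evaluation ℤₚ.+-*-commutativeRing S c-hom
  open SetoidReasoning setoid
  private module c = IsSemiringHomomorphism c-hom

  c-neg : ∀ z → c (ℤ.- z) ≈ - c z
  c-neg z = inverseˡ-unique (c (ℤ.- z)) (c z)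
    (trans (sym (c.+-homo (ℤ.- z) z)) (trans (c.⟦⟧-cong (ℤₚ.+-inverseˡ z)) c.0#-homo))
    where open AbelianGroupProperties +-abelianGroup using (inverseˡ-unique)

  n×1≡n : ∀ n → Mult._×_ (CommutativeRing.semiring ℤₚ.+-*-commutativeRing) n (+ 1) ≡ + n
  n×1≡n zero    = ≡.refl
  n×1≡n (suc n) = ≡.cong (ℤ._+_ (+ 1)) (n×1≡n n)

  c-ℕ : ∀ n → c (+ n) ≈ n × 1#
  c-ℕ n = trans (c.⟦⟧-cong (≡.sym (n×1≡n n))) (sym (c-× n))

  c-^ : ∀ z n → c (z ℤ.^ n) ≈ c z ^ n
  c-^ z zero    = c.1#-homo
  c-^ z (suc n) = trans (c.*-homo z (z ℤ.^ n)) (*-congˡ (c-^ z n))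

  Φ₁₄-root : Carrier → Set
  Φ₁₄-root y = y ^ 6 + y ^ 4 + y ^ 2 + 1# ≈ y ^ 5 + y ^ 3 + y

  eval-X· : ∀ {y} → Φ₁₄-root y → ∀ a → eval y (OX.X· a) ≈ y * eval y a
  eval-X· {y} Φ (a₀ ∷ a₁ ∷ a₂ ∷ a₃ ∷ a₄ ∷ a₅ ∷ []) = begin
    c (ℤ.- a₅) + y * (c (a₀ ℤ.+ a₅) + y * (c (a₁ ℤ.- a₅) + y * (c (a₂ ℤ.+ a₅) + y * (c (a₃ ℤ.- a₅) + y * (c (a₄ ℤ.+ a₅) + y * 0#)))))
      ≈⟨ +-congˡ (*-congˡ (split (c.+-homo a₀ a₅) (split (c.+-homo a₁ _) (split (c.+-homo a₂ a₅)
           (split (c.+-homo a₃ _) (trans (+-congʳ (c.+-homo a₄ a₅)) (xy∙z≈xz∙y _ _ _))))))) ⟩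
    n + y * (q + (k + y * (n + y * (k + y * (n + y * k)))))
      ≈⟨ solve 4 (λ y q n k → n :+ y :* (q :+ (k :+ y :* (n :+ y :* (k :+ y :* (n :+ y :* k)))))
           := y :* q :+ (n :* (y :^ 4 :+ y :^ 2 :+ con 1) :+ k :* (y :^ 5 :+ y :^ 3 :+ y))) refl y q n k ⟩
    y * q + (n * (y ^ 4 + y ^ 2 + 1#) + k * (y ^ 5 + y ^ 3 + y))
      -- The relation is used to trade the odd powers for even ones. Then n + k = 0 removes the
      -- lower terms, and what survives is the term k y⁶ of y times the polynomial.
      ≈⟨ +-congˡ (+-congˡ (*-congˡ Φ)) ⟨
    y * q + (n * (y ^ 4 + y ^ 2 + 1#) + k * (y ^ 6 + y ^ 4 + y ^ 2 + 1#))
      ≈⟨ solve 4 (λ r n k y → r :+ (n :* (y :^ 4 :+ y :^ 2 :+ con 1) :+ k :* (y :^ 6 :+ y :^ 4 :+ y :^ 2 :+ con 1))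
           := r :+ ((n :+ k) :* (y :^ 4 :+ y :^ 2 :+ con 1) :+ k :* y :^ 6)) refl (y * q) n k y ⟩
    y * q + ((n + k) * (y ^ 4 + y ^ 2 + 1#) + k * y ^ 6)
      ≈⟨ +-congˡ (trans (+-congʳ (trans (*-congʳ (trans (+-congʳ (c-neg a₅)) (-‿inverseˡ k))) (zeroˡ _))) (+-identityˡ _)) ⟩
    y * q + k * y ^ 6
      ≈⟨ solve 3 (λ y q k → y :* q :+ k :* y :^ 6 := y :* (q :+ y :* (y :* (y :* (y :* (y :* k)))))) refl y q k ⟩
    y * (q + y * (y * (y * (y * (y * k)))))
      ≈⟨ *-congˡ (split′ (split′ (split′ (split′ (split′ (trans (+-congˡ (zeroʳ y)) (+-comm k 0#))))))) ⟨
    y * (c a₀ + y * (c a₁ + y * (c a₂ + y * (c a₃ + y * (c a₄ + y * (k + y * 0#))))))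
      ∎
    where
    open SemiringSolver commutativeSemiring using (solve; _:=_; _:+_; _:*_; _:^_; con)
    open import Algebra.Properties.CommutativeSemigroup +-commutativeSemigroup
      using (interchange; xy∙z≈xz∙y)
    k n q : Carrier
    k = c a₅
    n = c (ℤ.- a₅)
    q = c a₀ + y * (c a₁ + y * (c a₂ + y * (c a₃ + y * (c a₄ + y * 0#))))
    split : ∀ {x x₁ x₂ z z₁ z₂} → x ≈ x₁ + x₂ → z ≈ z₁ + z₂ → x + y * z ≈ (x₁ + y * z₁) + (x₂ + y * z₂)
    split p r = trans (+-cong p (trans (*-congˡ r) (distribˡ y _ _))) (interchange _ _ _ _)
    split′ : ∀ {x z z₁ z₂} → z ≈ z₁ + z₂ → x + y * z ≈ (x + y * z₁) + y * z₂
    split′ r = trans (+-congˡ (trans (*-congˡ r) (distribˡ y _ _))) (sym (+-assoc _ _ _))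

  module _ {p : ℕ} (p-prime : Prime p) (p×1≈0 : p × 1# ≈ 0#) (k : ℕ) where
    open Frobenius S p-prime p×1≈0

    c-^q : ∀ z → c z ^ (p ℕ.^ k) ≈ c z
    c-^q (+ n) = trans (^-congˡ (p ℕ.^ k) (c-ℕ n)) (trans (^q-× k n) (sym (c-ℕ n)))
    c-^q -[1+ n ] = begin
      c -[1+ n ] ^ q       ≈⟨ ^-congˡ q (c-neg (+ suc n)) ⟩
      (- c (+ suc n)) ^ q  ≈⟨ ^q-neg k (c (+ suc n)) ⟩
      - (c (+ suc n) ^ q)  ≈⟨ -‿cong (c-^q (+ suc n)) ⟩
      - c (+ suc n)        ≈⟨ c-neg (+ suc n) ⟨
      c -[1+ n ]           ∎
      where q = p ℕ.^ k

    eval-fixed : ∀ {y} → y ^ (p ℕ.^ k) ≈ y → ∀ {l} (a : Vec ℤ l) → eval y a ^ (p ℕ.^ k) ≈ eval y a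
    eval-fixed {y} y^q≈y a = trans
      (eval-natural (0^q k) (^q-+ k) (λ x z → ^-distrib-* x z (p ℕ.^ k)) c-^q y a)
      (eval-congˡ a y^q≈y)

-- Gauss sums

module GaussPower (S : CommutativeRing 0ℓ 0ℓ) where
  open CommutativeRing S
  open Powers S
  open SetoidReasoning setoid
  open SemiringSolver commutativeSemiring using (solve; _:=_; _:*_; _:^_)

  -- Here gₖ is the Gauss sum of χᵏ. The reduction runs g¹⁴ to g₂⁷ to g₄³ g₂ to g₈ g₄ g₂ to g₁₂ g₂,
  -- each step paying with a Jacobi sum. Since 12 + 2 = 14, the last two characters are inverse to
  -- each other.
  g¹⁵ : ∀ {g g₂ g₄ g₈ g₁₂ J₁ J₂ J₃ J₄ m} → g * g ≈ J₁ * g₂ → g₂ * g₂ ≈ J₂ * g₄ → g₄ * g₄ ≈ J₃ * g₈ →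
        g₈ * g₄ ≈ J₄ * g₁₂ → g₁₂ * g₂ * g ≈ m * g → g ^ 15 ≈ m * J₁ ^ 7 * J₂ ^ 3 * J₃ * J₄ * g
  g¹⁵ {g} {g₂} {g₄} {g₈} {g₁₂} {J₁} {J₂} {J₃} {J₄} {m} h₁ h₂ h₃ h₄ h₅ = begin
    g ^ 15
      ≈⟨ solve 1 (λ g → g :^ 15 := (g :* g) :^ 7 :* g) refl g ⟩
    (g * g) ^ 7 * g
      ≈⟨ *-congʳ (^-congˡ 7 h₁) ⟩
    (J₁ * g₂) ^ 7 * g
      ≈⟨ solve 3 (λ g g₂ J₁ → (J₁ :* g₂) :^ 7 :* g := J₁ :^ 7 :* (g₂ :* g₂) :^ 3 :* g₂ :* g) refl g g₂ J₁ ⟩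
    J₁ ^ 7 * (g₂ * g₂) ^ 3 * g₂ * g
      ≈⟨ *-congʳ (*-congʳ (*-congˡ (^-congˡ 3 h₂))) ⟩
    J₁ ^ 7 * (J₂ * g₄) ^ 3 * g₂ * g
      ≈⟨ solve 5 (λ g g₂ g₄ J₁ J₂ → J₁ :^ 7 :* (J₂ :* g₄) :^ 3 :* g₂ :* g
                                   := J₁ :^ 7 :* J₂ :^ 3 :* (g₄ :* g₄) :* g₄ :* g₂ :* g) refl g g₂ g₄ J₁ J₂ ⟩
    J₁ ^ 7 * J₂ ^ 3 * (g₄ * g₄) * g₄ * g₂ * g
      ≈⟨ *-congʳ (*-congʳ (*-congʳ (*-congˡ h₃))) ⟩
    J₁ ^ 7 * J₂ ^ 3 * (J₃ * g₈) * g₄ * g₂ * g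
      ≈⟨ solve 7 (λ g g₂ g₄ g₈ J₁ J₂ J₃ → J₁ :^ 7 :* J₂ :^ 3 :* (J₃ :* g₈) :* g₄ :* g₂ :* g
                   := J₁ :^ 7 :* J₂ :^ 3 :* J₃ :* (g₈ :* g₄) :* g₂ :* g) refl g g₂ g₄ g₈ J₁ J₂ J₃ ⟩
    J₁ ^ 7 * J₂ ^ 3 * J₃ * (g₈ * g₄) * g₂ * g
      ≈⟨ *-congʳ (*-congʳ (*-congˡ h₄)) ⟩
    J₁ ^ 7 * J₂ ^ 3 * J₃ * (J₄ * g₁₂) * g₂ * g
      ≈⟨ solve 7 (λ g g₂ g₁₂ J₁ J₂ J₃ J₄ → J₁ :^ 7 :* J₂ :^ 3 :* J₃ :* (J₄ :* g₁₂) :* g₂ :* g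
                   := J₁ :^ 7 :* J₂ :^ 3 :* J₃ :* J₄ :* (g₁₂ :* g₂ :* g)) refl g g₂ g₁₂ J₁ J₂ J₃ J₄ ⟩
    J₁ ^ 7 * J₂ ^ 3 * J₃ * J₄ * (g₁₂ * g₂ * g)
      ≈⟨ *-congˡ h₅ ⟩
    J₁ ^ 7 * J₂ ^ 3 * J₃ * J₄ * (m * g)
      ≈⟨ solve 6 (λ g J₁ J₂ J₃ J₄ m → J₁ :^ 7 :* J₂ :^ 3 :* J₃ :* J₄ :* (m :* g)
                   := m :* J₁ :^ 7 :* J₂ :^ 3 :* J₃ :* J₄ :* g) refl g J₁ J₂ J₃ J₄ m ⟩
    m * J₁ ^ 7 * J₂ ^ 3 * J₃ * J₄ * g ∎

  -- No cancellation: the factor g left over by one step is consumed by the next.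
  ^-step : ∀ {g a} k → g ^ suc k ≈ a * g → ∀ n → g ^ suc (k ℕ.* n) ≈ a ^ n * g
  ^-step {g} {a} k g^[1+k]≈ag zero = trans (^-congʳ g (≡.cong suc (ℕₚ.*-zeroʳ k))) (*-comm g 1#)
  ^-step {g} {a} k g^[1+k]≈ag (suc n) = begin
    g ^ suc (k ℕ.* suc n)           ≈⟨ ^-congʳ g (≡.trans (≡.cong suc (ℕₚ.*-suc k n)) (≡.sym (ℕₚ.+-suc k _))) ⟩
    g ^ (k ℕ.+ suc (k ℕ.* n))       ≈⟨ ^-homo-* g k (suc (k ℕ.* n)) ⟩
    g ^ k * g ^ suc (k ℕ.* n)       ≈⟨ *-congˡ (^-step k g^[1+k]≈ag n) ⟩
    g ^ k * (a ^ n * g)             ≈⟨ x∙yz≈zx∙y _ _ _ ⟩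
    g * g ^ k * a ^ n               ≈⟨ *-congʳ g^[1+k]≈ag ⟩
    a * g * a ^ n                   ≈⟨ xy∙z≈xz∙y _ _ _ ⟩
    a * a ^ n * g                   ∎
    where open import Algebra.Properties.CommutativeSemigroup *-commutativeSemigroup using (x∙yz≈zx∙y; xy∙z≈xz∙y)

module HomPowers (R S : CommutativeRing 0ℓ 0ℓ) {f : CommutativeRing.Carrier R → CommutativeRing.Carrier S}
                 (f-hom : IsHom R S f) where
  private
    module R where
      open CommutativeRing R public
      open Powers R public
  open CommutativeRing S
  open Powers S
  open IsSemiringHomomorphism f-hom

  ^-homo : ∀ x n → f (x R.^ n) ≈ f x ^ n
  ^-homo x zero    = 1#-homo
  ^-homo x (suc n) = trans (*-homo x (x R.^ n)) (*-congˡ (^-homo x n))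

  monomial-homo : ∀ m x y z w → f (m R.* x R.^ 7 R.* y R.^ 3 R.* z R.* w) ≈ f m * f x ^ 7 * f y ^ 3 * f z * f w
  monomial-homo m x y z w = trans (*-homo _ w) (*-congʳ (trans (*-homo _ z) (*-congʳ
    (trans (*-homo _ _) (*-cong (trans (*-homo m _) (*-congˡ (^-homo x 7))) (^-homo y 3))))))

module GaussSums (R S : CommutativeRing 0ℓ 0ℓ) {f : CommutativeRing.Carrier R → CommutativeRing.Carrier S}
                 (f-hom : IsHom R S f) where
  private
    module R where
      open CommutativeRing R public
      open Powers R public
  open CommutativeRing S
  open Powers S
  open HomPowers R S f-hom

  module JacobiSums (g g₂ g₄ g₈ g₁₂ : Carrier) (m J₁ J₂ J₃ J₄ : R.Carrier)
                    (h₁ : g * g ≈ f J₁ * g₂) (h₂ : g₂ * g₂ ≈ f J₂ * g₄) (h₃ : g₄ * g₄ ≈ f J₃ * g₈)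
                    (h₄ : g₈ * g₄ ≈ f J₄ * g₁₂) (h₅ : g₁₂ * g₂ * g ≈ f m * g) where

    a : R.Carrier
    a = m R.* J₁ R.^ 7 R.* J₂ R.^ 3 R.* J₃ R.* J₄

    g^[1+14n] : ∀ n → g ^ suc (14 ℕ.* n) ≈ f (a R.^ n) * g
    g^[1+14n] n = trans
      (GaussPower.^-step S 14
        (trans (GaussPower.g¹⁵ S h₁ h₂ h₃ h₄ h₅) (*-congʳ (sym (monomial-homo m J₁ J₂ J₃ J₄)))) n)
      (*-congʳ (sym (^-homo a n)))

module O where
  open CommutativeRing Oᴬ.extension public
  open Powers Oᴬ.extension public
  open Oᴬ public using (const; const-*; const-hom; eval-X) renaming (X to ζ)

  infix 4 _≟_
  _≟_ : (x y : Carrier) → Dec (x ≡ y)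
  _≟_ = Vecₚ.≡-dec ℤₚ._≟_

module A where
  open CommutativeRing Aᴬ.extension public
  open Powers Aᴬ.extension public
  open Aᴬ public using (const; const-*; const-hom; eval-X; X; T^; evalᵀ; eval-X^-%)
  open Evaluation Oᴬ.extension Aᴬ.extension const-hom public using (eval)

  infix 4 _≟_
  _≟_ : (x y : Carrier) → Dec (x ≡ y)
  _≟_ = Vecₚ.≡-dec O._≟_


-- Discrete logarithms of 1, …, 28 to the base 2 modulo 29.
logs : Vec ℕ 28
logs = 0 ∷ 1 ∷ 5 ∷ 2 ∷ 22 ∷ 6 ∷ 12 ∷ 3 ∷ 10 ∷ 23 ∷ 25 ∷ 7 ∷ 18 ∷ 13 ∷ 27 ∷ 4 ∷ 21 ∷ 11 ∷ 9 ∷ 24 ∷ 17 ∷ 26 ∷ 20 ∷ 8 ∷ 16 ∷ 19 ∷ 15 ∷ 14 ∷ []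

opaque
  -- The Gauss sum of χᵏ, where χ is the character modulo 29 with χ(2) = ζ⁵.
  gauss : ℕ → A.Carrier
  gauss k = O.0# ∷ Vec.map (λ i → O.ζ O.^ ((5 ℕ.* k ℕ.* i) % 14)) logs

  -- The Jacobi sums J(χ, χ), J(χ², χ²), J(χ⁴, χ⁴) and J(χ⁸, χ⁴) in the basis 1, ζ, ..., ζ⁵. The
  -- products of Gauss sums computed below certify the coordinates.
  J₁ J₂ J₃ J₄ : O.Carrier
  J₁ = -[1+ 1 ] ∷ + 2 ∷ + 0 ∷ + 2 ∷ -[1+ 2 ] ∷ + 6 ∷ []
  J₂ = + 4 ∷ -[1+ 2 ] ∷ + 4 ∷ -[1+ 3 ] ∷ + 6 ∷ -[1+ 5 ] ∷ []
  J₃ = + 0 ∷ -[1+ 1 ] ∷ -[1+ 0 ] ∷ -[1+ 1 ] ∷ + 0 ∷ + 4 ∷ []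
  J₄ = -[1+ 2 ] ∷ + 4 ∷ -[1+ 3 ] ∷ + 0 ∷ -[1+ 3 ] ∷ + 0 ∷ []

  29ᴼ ζ² ζ¹³ : O.Carrier
  29ᴼ = O.const (+ 29)
  ζ²  = O.ζ O.^ 2
  ζ¹³ = O.ζ O.^ 13

private
  scaleᴬ : O.Carrier → A.Carrier → A.Carrier
  scaleᴬ x = Vec.map (x O.*_)

  by-scaling : ∀ {u} x v → u ≡ scaleᴬ x v → u A.≈ A.const x A.* v
  by-scaling x v u≡xv = A.trans (A.reflexive u≡xv) (A.sym (A.const-* x v))

  opaque
    unfolding gauss

    gauss₁² : gauss 1 A.* gauss 1 ≡ scaleᴬ J₁ (gauss 2)
    gauss₁² = toWitness {a? = _ A.≟ _} tt

    gauss₂² : gauss 2 A.* gauss 2 ≡ scaleᴬ J₂ (gauss 4)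
    gauss₂² = toWitness {a? = _ A.≟ _} tt

    gauss₄² : gauss 4 A.* gauss 4 ≡ scaleᴬ J₃ (gauss 8)
    gauss₄² = toWitness {a? = _ A.≟ _} tt

    gauss₈gauss₄ : gauss 8 A.* gauss 4 ≡ scaleᴬ J₄ (gauss 12)
    gauss₈gauss₄ = toWitness {a? = _ A.≟ _} tt

    -- χ¹² and χ² are inverse and even, so their Gauss sums multiply to 29 - (1 + X + ... + X²⁸).
    -- The third factor kills the bracket because the values of χ add up to 0; without it the
    -- product would not be the scalar 29.
    gauss₁₂gauss₂ : gauss 12 A.* gauss 2 A.* gauss 1 ≡ scaleᴬ 29ᴼ (gauss 1)
    gauss₁₂gauss₂ = toWitness {a? = _ A.≟ _} tt

    -- Replacing X by Xᵐ reindexes the sum and multiplies it by χ(m)⁻¹. The exponents 21, 24 and 8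
    -- are the residues of M modulo 29, with χ(21) = χ(8) = ζ and χ(24) = ζ¹².
    gauss-at-21 : A.evalᵀ 21 (gauss 1) ≡ scaleᴬ ζ¹³ (gauss 1)
    gauss-at-21 = toWitness {a? = _ A.≟ _} tt

    gauss-at-24 : A.evalᵀ 24 (gauss 1) ≡ scaleᴬ ζ² (gauss 1)
    gauss-at-24 = toWitness {a? = _ A.≟ _} tt

    gauss-at-8 : A.evalᵀ 8 (gauss 1) ≡ scaleᴬ ζ¹³ (gauss 1)
    gauss-at-8 = toWitness {a? = _ A.≟ _} tt

g : A.Carrier
g = gauss 1

module GaussPowers = GaussSums.JacobiSums Oᴬ.extension Aᴬ.extension A.const-hom
  (gauss 1) (gauss 2) (gauss 4) (gauss 8) (gauss 12) 29ᴼ J₁ J₂ J₃ J₄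
  (by-scaling J₁ (gauss 2) gauss₁²) (by-scaling J₂ (gauss 4) gauss₂²) (by-scaling J₃ (gauss 8) gauss₄²)
  (by-scaling J₄ (gauss 12) gauss₈gauss₄) (by-scaling 29ᴼ (gauss 1) gauss₁₂gauss₂)
open GaussPowers public using (a; g^[1+14n])

evalᵀ-21 : A.evalᵀ 21 g A.≈ A.const ζ¹³ A.* g
evalᵀ-21 = by-scaling ζ¹³ (gauss 1) gauss-at-21

evalᵀ-24 : A.evalᵀ 24 g A.≈ A.const ζ² A.* g
evalᵀ-24 = by-scaling ζ² (gauss 1) gauss-at-24

evalᵀ-8 : A.evalᵀ 8 g A.≈ A.const ζ¹³ A.* g
evalᵀ-8 = by-scaling ζ¹³ (gauss 1) gauss-at-8

opaque
  unfolding gauss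
  -- χ(1) = 1; this makes X the coefficient to compare.
  g-coefficient : Vec.head (Vec.tail g) ≡ O.1#
  g-coefficient = ≡.refl

-- The power residue symbol modulo a prime M

module QuotientProperties (R : CommutativeRing 0ℓ 0ℓ) (m : CommutativeRing.Carrier R) where
  open CommutativeRing R
  open Quotient R m

  module Q where
    open CommutativeRing quotientRing public
    open Powers quotientRing public
    open Mult (CommutativeRing.semiring quotientRing) public using (_×_)

  -- These are not definitionally equal for variable n, because _^_ depends on the whole ring record.
  ^-≡ : ∀ x n → x Q.^ n ≡ Powers._^_ R x n
  ^-≡ x zero    = ≡.refl
  ^-≡ x (suc n) = ≡.cong (x *_) (^-≡ x n)

  ^-≅-congˡ : ∀ n {x y} → x ≅ y → Powers._^_ R x n ≅ Powers._^_ R y n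
  ^-≅-congˡ n {x} {y} x≅y = ≡.subst₂ _≅_ (^-≡ x n) (^-≡ y n) (Q.^-congˡ n x≅y)

  m≅0 : m ≅ 0#
  m≅0 = 1# , trans (sym (*-identityʳ m)) (sym (+-identityˡ _))

  ≅-homo : ∀ S {f} → IsHom R S f → ∀ {x y} → x ≅ y → Quotient._≅_ S (f m) (f x) (f y)
  ≅-homo S {f} f-hom {x} {y} (t , x≈y+mt) =
    f t , S.trans (⟦⟧-cong x≈y+mt) (S.trans (+-homo y (m * t)) (S.+-congˡ (*-homo m t)))
    where
    module S = CommutativeRing S
    open IsSemiringHomomorphism f-hom

ζ-order : Oᴬ.HasOrder 14
ζ-order = record { T^k≡1 = toWitness {a? = _ O.≟ _} tt }

X-order : Aᴬ.HasOrder 29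
X-order = record { T^k≡1 = toWitness {a? = _ A.≟ _} tt }

module OMod (m : ℕ) where
  open Quotient Oᴬ.extension (O.const (+ m)) public
  open QuotientProperties Oᴬ.extension (O.const (+ m)) public
  module B = Q

  const-hom : IsHom ℤₚ.+-*-commutativeRing quotientRing O.const
  const-hom = IsHom-quotient ℤₚ.+-*-commutativeRing Oᴬ.extension O.const-hom (O.const (+ m))

  module Int = IntegralHom quotientRing const-hom

  p×1≅0 : m B.× B.1# B.≈ B.0#
  p×1≅0 = B.trans (B.sym (Int.c-ℕ m)) m≅0

  module _ (m-prime : Prime m) (k : ℕ) (ζ-fixed : O.ζ O.^ (m ℕ.^ k) O.≈ O.ζ) where

    -- Every element is an integer polynomial in ζ, and modulo m a power of Frobenius fixes the
    -- integer coefficients; so only ζ has to be tested.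
    ^q-fixed : ∀ x → x B.^ (m ℕ.^ k) ≅ x
    ^q-fixed x = B.trans (B.^-congˡ q (≈⇒≅ (O.sym (O.eval-X x))))
      (B.trans (Int.eval-fixed m-prime p×1≅0 k ζ^q≅ζ x) (≈⇒≅ (O.eval-X x)))
      where
      q = m ℕ.^ k
      ζ^q≅ζ : O.ζ B.^ q ≅ O.ζ
      ζ^q≅ζ = ≡.subst (_≅ O.ζ) (≡.sym (^-≡ O.ζ q)) (≈⇒≅ ζ-fixed)

module Reciprocity {M N : ℕ} (M-prime : Prime M) (M≡1+14N : M ≡ suc (14 ℕ.* N)) where
  private
    constᴬ = A.const
    μ = constᴬ (O.const (+ M))
    module OM = OMod M
    module AM where
      open Quotient Aᴬ.extension μ public
      open QuotientProperties Aᴬ.extension μ public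
      open Q public

    const-homᴬ : IsHom Oᴬ.extension AM.quotientRing constᴬ
    const-homᴬ = IsHom-quotient Oᴬ.extension Aᴬ.extension A.const-hom μ

    M^1≡M : M ℕ.^ 1 ≡ M
    M^1≡M = ℕₚ.*-identityʳ M

    M×1≅0 : M AM.× AM.1# AM.≈ AM.0#
    M×1≅0 = AM.trans (Evaluation.c-× Oᴬ.extension AM.quotientRing const-homᴬ M)
      (AM.trans (IsSemiringHomomorphism.⟦⟧-cong const-homᴬ
                  (O.sym (IntegralHom.c-ℕ Oᴬ.extension O.const-hom M))) AM.m≅0)

  ^M-fixed : ∀ x → x O.^ M OM.≅ x
  ^M-fixed x = ≡.subst (OM._≅ x) (≡.trans (≡.cong (x OM.B.^_) M^1≡M) (OM.^-≡ x M)) (OM.^q-fixed M-prime 1 ζ-fixed x)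
    where
    ζ-fixed : O.ζ O.^ (M ℕ.^ 1) O.≈ O.ζ
    ζ-fixed = Oᴬ.X^-fixed 14 ζ-order {l = N} (≡.trans M^1≡M M≡1+14N)

  private
    open Frobenius AM.quotientRing M-prime M×1≅0
    module E = Evaluation Oᴬ.extension AM.quotientRing const-homᴬ

    const-fixed : ∀ x → constᴬ x AM.^ M AM.≈ constᴬ x
    const-fixed x = AM.trans (AM.reflexive (AM.^-≡ (constᴬ x) M)) (AM.trans (AM.≈⇒≅ (A.sym (HomPowers.^-homo Oᴬ.extension Aᴬ.extension A.const-hom x M)))
                             (QuotientProperties.≅-homo Oᴬ.extension (O.const (+ M)) Aᴬ.extension A.const-hom (^M-fixed x)))

    0^M≅0 : AM.0# AM.^ M AM.≈ AM.0#
    0^M≅0 = ≡.subst (λ q → AM.0# AM.^ q AM.≈ AM.0#) M^1≡M (0^q 1)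

    -- The coefficients of `g` lie in ℤ[ζ] and are fixed by `^M-fixed`, so Frobenius acts on X
    -- alone.
    g^M≅eval : g A.^ M AM.≈ A.eval (A.X A.^ M) g
    g^M≅eval = AM.trans (AM.^-≅-congˡ M (AM.≈⇒≅ (A.sym (A.eval-X g))))
      (≡.subst₂ (λ u y → u AM.≅ A.eval y g) (AM.^-≡ (A.eval A.X g) M) (AM.^-≡ A.X M)
        (E.eval-natural 0^M≅0 ^p-+ (λ x y → AM.^-distrib-* x y M) const-fixed A.X g))

    g^M≈a^Ng : g A.^ M A.≈ constᴬ (a O.^ N) A.* g
    g^M≈a^Ng = A.trans (A.^-congʳ g M≡1+14N) (g^[1+14n] N)

    coefficient : A.Carrier → O.Carrier
    coefficient v = Vec.head (Vec.tail v)

    coefficient-cong : ∀ {u v} → u A.≈ v → coefficient u O.≈ coefficient v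
    coefficient-cong {_ ∷ _ ∷ _} {_ ∷ _ ∷ _} (_ ∷ p ∷ _) = p

    coefficient-+ : ∀ u v → coefficient (u A.+ v) ≡ coefficient u O.+ coefficient v
    coefficient-+ (_ ∷ _ ∷ _) (_ ∷ _ ∷ _) = ≡.refl

    coefficient-const-* : ∀ x v → coefficient (constᴬ x A.* v) O.≈ x O.* coefficient v
    coefficient-const-* x v = O.trans (coefficient-cong (A.const-* x v)) (lemma v)
      where
      lemma : ∀ (v : A.Carrier) → coefficient (Vec.map (x O.*_) v) O.≈ x O.* coefficient v
      lemma (_ ∷ _ ∷ _) = O.refl

    coefficient-const-*-g : ∀ x → coefficient (constᴬ x A.* g) O.≈ x
    coefficient-const-*-g x = O.trans (coefficient-const-* x g)
      (O.trans (O.*-congˡ {x = x} (O.reflexive g-coefficient)) (O.*-identityʳ x))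

  -- Both a^N g and z g are congruent to g^M. As `g` is a zero divisor, the conclusion comes from
  -- the coefficient of X, which is 1 in `g`; the same projection of the witness `t` serves as the
  -- new witness.
  a^N≅z : ∀ {m} → M % 29 ≡ m → ∀ z → A.evalᵀ m g A.≈ constᴬ z A.* g → a O.^ N OM.≅ z
  a^N≅z {m} M%29≡m z Xᵐ-g = coefficient t , (begin
    a O.^ N                                          ≈⟨ coefficient-const-*-g (a O.^ N) ⟨
    coefficient (constᴬ (a O.^ N) A.* g)             ≈⟨ coefficient-cong a^Ng≈zg+μt ⟩
    coefficient (constᴬ z A.* g A.+ μ A.* t)         ≈⟨ O.reflexive (coefficient-+ (constᴬ z A.* g) (μ A.* t)) ⟩
    coefficient (constᴬ z A.* g) O.+ coefficient (μ A.* t)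
      ≈⟨ O.+-cong (coefficient-const-*-g z) (coefficient-const-* (O.const (+ M)) t) ⟩
    z O.+ O.const (+ M) O.* coefficient t            ∎)
    where
    open SetoidReasoning O.setoid
    g^M≅zg : g A.^ M AM.≅ constᴬ z A.* g
    g^M≅zg = AM.trans g^M≅eval (AM.≈⇒≅ (A.trans (A.eval-X^-% 29 X-order {M} M%29≡m g) Xᵐ-g))
    a^Ng≅zg : constᴬ (a O.^ N) A.* g AM.≅ constᴬ z A.* g
    a^Ng≅zg = AM.trans (AM.≈⇒≅ (A.sym g^M≈a^Ng)) g^M≅zg
    t = proj₁ a^Ng≅zg
    a^Ng≈zg+μt = proj₂ a^Ng≅zg

-- Galois conjugates and periods

-- τ plays the role of complex conjugation and σ₃, σ₅ that of ζ ↦ ζ³, ζ⁵.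
module Periods (S : CommutativeRing 0ℓ 0ℓ)
               {σ₃ σ₅ τ : CommutativeRing.Carrier S → CommutativeRing.Carrier S}
               (σ₃-hom : IsHom S S σ₃) (σ₅-hom : IsHom S S σ₅) where
  open CommutativeRing S
  open SetoidReasoning setoid
  private
    module σ₃ = IsSemiringHomomorphism σ₃-hom
    module σ₅ = IsSemiringHomomorphism σ₅-hom
  open SemiringSolver commutativeSemiring using (solve; _:=_; _:+_; _:*_)

  e₁ e₂ e₃ : Carrier → Carrier
  e₁ y = y + σ₃ y + σ₅ y
  e₂ y = y * σ₃ y + y * σ₅ y + σ₃ y * σ₅ y
  e₃ y = y * σ₃ y * σ₅ y

  e₁-cong : ∀ {x y} → x ≈ y → e₁ x ≈ e₁ y
  e₁-cong x≈y = +-cong (+-cong x≈y (σ₃.⟦⟧-cong x≈y)) (σ₅.⟦⟧-cong x≈y)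

  e₂-cong : ∀ {x y} → x ≈ y → e₂ x ≈ e₂ y
  e₂-cong x≈y = +-cong (+-cong (*-cong x≈y (σ₃.⟦⟧-cong x≈y)) (*-cong x≈y (σ₅.⟦⟧-cong x≈y)))
                       (*-cong (σ₃.⟦⟧-cong x≈y) (σ₅.⟦⟧-cong x≈y))

  e₃-cong : ∀ {x y} → x ≈ y → e₃ x ≈ e₃ y
  e₃-cong x≈y = *-cong (*-cong x≈y (σ₃.⟦⟧-cong x≈y)) (σ₅.⟦⟧-cong x≈y)

  module _ {d : Carrier} (σ₃d≈d : σ₃ d ≈ d) (σ₅d≈d : σ₅ d ≈ d) (y : Carrier) where
    private
      σ₃dy : σ₃ (d * y) ≈ d * σ₃ y
      σ₃dy = trans (σ₃.*-homo d y) (*-congʳ σ₃d≈d)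
      σ₅dy : σ₅ (d * y) ≈ d * σ₅ y
      σ₅dy = trans (σ₅.*-homo d y) (*-congʳ σ₅d≈d)

    e₁-scale : e₁ (d * y) ≈ d * e₁ y
    e₁-scale = trans (+-cong (+-congˡ σ₃dy) σ₅dy)
      (solve 4 (λ d a b c → d :* a :+ d :* b :+ d :* c := d :* (a :+ b :+ c)) refl d y (σ₃ y) (σ₅ y))

    e₂-scale : e₂ (d * y) ≈ d * d * e₂ y
    e₂-scale = trans (+-cong (+-cong (*-congˡ σ₃dy) (*-congˡ σ₅dy)) (*-cong σ₃dy σ₅dy))
      (solve 4 (λ d a b c → d :* a :* (d :* b) :+ d :* a :* (d :* c) :+ d :* b :* (d :* c)
                            := d :* d :* (a :* b :+ a :* c :+ b :* c)) refl d y (σ₃ y) (σ₅ y))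

    e₃-scale : e₃ (d * y) ≈ d * d * d * e₃ y
    e₃-scale = trans (*-cong (*-congˡ σ₃dy) σ₅dy)
      (solve 4 (λ d a b c → d :* a :* (d :* b) :* (d :* c) := d :* d :* d :* (a :* b :* c))
             refl d y (σ₃ y) (σ₅ y))

  module _ (σ₃σ₃≈σ₅τ : ∀ x → σ₃ (σ₃ x) ≈ σ₅ (τ x)) (ττ≈id : ∀ x → τ (τ x) ≈ x) (σ₃σ₅≈id : ∀ x → σ₃ (σ₅ x) ≈ x)
           (x : Carrier) where
    private
      y : Carrier
      y = x + τ x

      -- σ₃² and σ₅ differ by τ, which fixes y = x + τ x. Hence σ₃ permutes y, σ₃ y, σ₅ y cyclically
      -- and fixes their symmetric functions.
      σ₃σ₃y : σ₃ (σ₃ y) ≈ σ₅ y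
      σ₃σ₃y = begin
        σ₃ (σ₃ y)                   ≈⟨ σ₃σ₃≈σ₅τ y ⟩
        σ₅ (τ y)                    ≈⟨ σ₃σ₃≈σ₅τ y ⟨
        σ₃ (σ₃ y)                   ≈⟨ trans (σ₃.⟦⟧-cong (σ₃.+-homo x (τ x))) (σ₃.+-homo _ _) ⟩
        σ₃ (σ₃ x) + σ₃ (σ₃ (τ x))   ≈⟨ +-cong (σ₃σ₃≈σ₅τ x) (trans (σ₃σ₃≈σ₅τ (τ x)) (σ₅.⟦⟧-cong (ττ≈id x))) ⟩
        σ₅ (τ x) + σ₅ x             ≈⟨ +-comm _ _ ⟩
        σ₅ x + σ₅ (τ x)             ≈⟨ σ₅.+-homo x (τ x) ⟨
        σ₅ y                        ∎

    e₁-fixed : σ₃ (e₁ (x + τ x)) ≈ e₁ (x + τ x)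
    e₁-fixed = begin
      σ₃ (y + σ₃ y + σ₅ y)               ≈⟨ trans (σ₃.+-homo _ _) (+-congʳ (σ₃.+-homo _ _)) ⟩
      σ₃ y + σ₃ (σ₃ y) + σ₃ (σ₅ y)       ≈⟨ +-cong (+-congˡ σ₃σ₃y) (σ₃σ₅≈id y) ⟩
      σ₃ y + σ₅ y + y                    ≈⟨ solve 3 (λ a b c → b :+ c :+ a := a :+ b :+ c) refl y (σ₃ y) (σ₅ y) ⟩
      y + σ₃ y + σ₅ y                    ∎

    e₂-fixed : σ₃ (e₂ (x + τ x)) ≈ e₂ (x + τ x)
    e₂-fixed = begin
      σ₃ (y * σ₃ y + y * σ₅ y + σ₃ y * σ₅ y)
        ≈⟨ trans (σ₃.+-homo _ _) (+-cong (trans (σ₃.+-homo _ _) (+-cong (σ₃.*-homo _ _) (σ₃.*-homo _ _))) (σ₃.*-homo _ _)) ⟩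
      σ₃ y * σ₃ (σ₃ y) + σ₃ y * σ₃ (σ₅ y) + σ₃ (σ₃ y) * σ₃ (σ₅ y)
        ≈⟨ +-cong (+-cong (*-congˡ σ₃σ₃y) (*-congˡ (σ₃σ₅≈id y))) (*-cong σ₃σ₃y (σ₃σ₅≈id y)) ⟩
      σ₃ y * σ₅ y + σ₃ y * y + σ₅ y * y
        ≈⟨ solve 3 (λ a b c → b :* c :+ b :* a :+ c :* a := a :* b :+ a :* c :+ b :* c) refl y (σ₃ y) (σ₅ y) ⟩
      y * σ₃ y + y * σ₅ y + σ₃ y * σ₅ y ∎

    e₃-fixed : σ₃ (e₃ (x + τ x)) ≈ e₃ (x + τ x)
    e₃-fixed = begin
      σ₃ (y * σ₃ y * σ₅ y)               ≈⟨ trans (σ₃.*-homo _ _) (*-congʳ (σ₃.*-homo _ _)) ⟩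
      σ₃ y * σ₃ (σ₃ y) * σ₃ (σ₅ y)       ≈⟨ *-cong (*-congˡ σ₃σ₃y) (σ₃σ₅≈id y) ⟩
      σ₃ y * σ₅ y * y                    ≈⟨ solve 3 (λ a b c → b :* c :* a := a :* b :* c) refl y (σ₃ y) (σ₅ y) ⟩
      y * σ₃ y * σ₅ y                    ∎

module HornerExpansion (S : CommutativeRing 0ℓ 0ℓ) where
  open CommutativeRing S

  private
    step : ∀ {x y z w p p′ xp} → y * p ≈ p′ → x * p ≈ xp → p′ * z ≈ w → p * (x + y * z) ≈ xp + w
    step {x} {y} {z} {w} {p} yp≈p′ xp≈ p′z≈w = trans (distribˡ p x (y * z))
      (+-cong (trans (*-comm p x) xp≈) (trans (x∙yz≈yx∙z p y z) (trans (*-congʳ yp≈p′) p′z≈w)))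
      where open import Algebra.Properties.CommutativeSemigroup *-commutativeSemigroup using (x∙yz≈yx∙z)

    last-step : ∀ {x y p xp} → x * p ≈ xp → p * (x + y * 0#) ≈ xp
    last-step {x} {y} {p} xp≈ = trans (*-congˡ (trans (+-congˡ (zeroʳ y)) (+-identityʳ x))) (trans (*-comm p x) xp≈)

  -- The powers of y and their multiples by the coefficients enter as proved equations, so that in
  -- the application only closed products of `η₃` are left to compute.
  horner-expansion : ∀ {y x₀ x₁ x₂ x₃ x₄ x₅ p₀ p₁ p₂ p₃ p₄ p₅ z₀ z₁ z₂ z₃ z₄ z₅} → p₀ ≈ 1# →
    y * p₀ ≈ p₁ → y * p₁ ≈ p₂ → y * p₂ ≈ p₃ → y * p₃ ≈ p₄ → y * p₄ ≈ p₅ →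
    x₀ * p₀ ≈ z₀ → x₁ * p₁ ≈ z₁ → x₂ * p₂ ≈ z₂ → x₃ * p₃ ≈ z₃ → x₄ * p₄ ≈ z₄ → x₅ * p₅ ≈ z₅ →
    x₀ + y * (x₁ + y * (x₂ + y * (x₃ + y * (x₄ + y * (x₅ + y * 0#))))) ≈
    z₀ + (z₁ + (z₂ + (z₃ + (z₄ + z₅))))
  horner-expansion e₀ e₁ e₂ e₃ e₄ e₅ f₀ f₁ f₂ f₃ f₄ f₅ =
    trans (sym (*-identityˡ _)) (trans (*-congʳ (sym e₀))
      (step e₁ f₀ (step e₂ f₁ (step e₃ f₂ (step e₄ f₃ (step e₅ f₄ (last-step f₅)))))))

module σᴼ where
  open Evaluation ℤₚ.+-*-commutativeRing Oᴬ.extension O.const-hom public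
  open IntegralHom Oᴬ.extension O.const-hom public using (Φ₁₄-root; eval-X·)

  eval-hom : ∀ {η} → Φ₁₄-root η → IsHom Oᴬ.extension Oᴬ.extension (eval η)
  eval-hom {η} Φ = record
    { isNearSemiringHomomorphism = record
      { +-isMonoidHomomorphism = record
        { isMagmaHomomorphism = record
          { isRelHomomorphism = record { cong = eval-congʳ η }
          ; homo = eval-⊕ η
          }
        ; ε-homo = eval-𝟘 η 6
        }
      ; *-homo = eval-⊛ {T-linear = OX.X·-linear} {η} (eval-X· Φ)
      }
    ; 1#-homo = eval-const η 5 (+ 1)
    }

  -- Automorphisms of ℤ[ζ] compose through their effect on ζ; each relation between them becomes one
  -- closed check.
  eval-eval : ∀ {η} → Φ₁₄-root η → ∀ θ (x : O.Carrier) → eval η (eval θ x) O.≈ eval (eval η θ) x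
  eval-eval {η} Φ θ x = eval-natural 0#-homo +-homo *-homo (λ z → eval-const η 5 z) θ x
    where open IsSemiringHomomorphism (eval-hom Φ)

opaque
  -- ζ³, ζ⁵ and ζ¹³
  η₃ η₅ η₁₃ : O.Carrier
  η₃  = + 0 ∷ + 0 ∷ + 0 ∷ + 1 ∷ + 0 ∷ + 0 ∷ []
  η₅  = + 0 ∷ + 0 ∷ + 0 ∷ + 0 ∷ + 0 ∷ + 1 ∷ []
  η₁₃ = + 1 ∷ -[1+ 0 ] ∷ + 1 ∷ -[1+ 0 ] ∷ + 1 ∷ -[1+ 0 ] ∷ []

σ₃ᴼ σ₅ᴼ τᴼ : O.Carrier → O.Carrier
σ₃ᴼ = σᴼ.eval η₃
σ₅ᴼ = σᴼ.eval η₅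
τᴼ  = σᴼ.eval η₁₃

opaque
  unfolding η₃

  η₃-root : σᴼ.Φ₁₄-root η₃
  η₃-root = O.reflexive (toWitness {a? = _ O.≟ _} tt)
  η₅-root : σᴼ.Φ₁₄-root η₅
  η₅-root = O.reflexive (toWitness {a? = _ O.≟ _} tt)
  η₁₃-root : σᴼ.Φ₁₄-root η₁₃
  η₁₃-root = O.reflexive (toWitness {a? = _ O.≟ _} tt)

  σ₃η₃ : σ₃ᴼ η₃ ≡ σ₅ᴼ η₁₃
  σ₃η₃ = toWitness {a? = _ O.≟ _} tt
  σ₃η₅ : σ₃ᴼ η₅ ≡ O.ζ
  σ₃η₅ = toWitness {a? = _ O.≟ _} tt
  τη₁₃ : τᴼ η₁₃ ≡ O.ζ
  τη₁₃ = toWitness {a? = _ O.≟ _} tt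

σ₃-hom : IsHom Oᴬ.extension Oᴬ.extension σ₃ᴼ
σ₃-hom = σᴼ.eval-hom η₃-root
σ₅-hom : IsHom Oᴬ.extension Oᴬ.extension σ₅ᴼ
σ₅-hom = σᴼ.eval-hom η₅-root
τ-hom : IsHom Oᴬ.extension Oᴬ.extension τᴼ
τ-hom = σᴼ.eval-hom η₁₃-root

-- 3 · 3 ≡ 5 · 13 modulo 14; the next two relations are 13² ≡ 1 and 3 · 5 ≡ 1.
σ₃σ₃≈σ₅τ : ∀ x → σ₃ᴼ (σ₃ᴼ x) O.≈ σ₅ᴼ (τᴼ x)
σ₃σ₃≈σ₅τ x = O.trans (σᴼ.eval-eval η₃-root η₃ x)
  (O.trans (σᴼ.eval-congˡ {y = _} x (O.reflexive σ₃η₃)) (O.sym (σᴼ.eval-eval η₅-root η₁₃ x)))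

ττ≈id : ∀ x → τᴼ (τᴼ x) O.≈ x
ττ≈id x = O.trans (σᴼ.eval-eval η₁₃-root η₁₃ x) (O.trans (σᴼ.eval-congˡ {y = _} x (O.reflexive τη₁₃)) (O.eval-X x))

σ₃σ₅≈id : ∀ x → σ₃ᴼ (σ₅ᴼ x) O.≈ x
σ₃σ₅≈id x = O.trans (σᴼ.eval-eval η₃-root η₅ x) (O.trans (σᴼ.eval-congˡ {y = _} x (O.reflexive σ₃η₅)) (O.eval-X x))

module Pᴼ = Periods Oᴬ.extension {σ₃ᴼ} {σ₅ᴼ} {τᴼ} σ₃-hom σ₅-hom

private
  -- The powers ζ⁶, ζ⁹, ζ¹² and ζ¹⁵ of `η₃` in reduced form.
  q₂ q₃ q₄ q₅ : O.Carrier
  q₂ = -1ℤ ∷ + 1 ∷ -1ℤ ∷ + 1 ∷ -1ℤ ∷ + 1 ∷ []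
  q₃ = + 0 ∷ + 0 ∷ -1ℤ ∷ + 0 ∷ + 0 ∷ + 0 ∷ []
  q₄ = + 0 ∷ + 0 ∷ + 0 ∷ + 0 ∷ + 0 ∷ -1ℤ ∷ []
  q₅ = + 0 ∷ + 1 ∷ + 0 ∷ + 0 ∷ + 0 ∷ + 0 ∷ []

  opaque
    unfolding η₃

    η₃*η₃ : η₃ O.* η₃ ≡ q₂
    η₃*η₃ = ≡.refl
    η₃*q₂ : η₃ O.* q₂ ≡ q₃
    η₃*q₂ = ≡.refl
    η₃*q₃ : η₃ O.* q₃ ≡ q₄
    η₃*q₃ = ≡.refl
    η₃*q₄ : η₃ O.* q₄ ≡ q₅
    η₃*q₄ = ≡.refl

  expansion : ∀ a₀ a₁ a₂ a₃ a₄ a₅ → σ₃ᴼ (a₀ ∷ a₁ ∷ a₂ ∷ a₃ ∷ a₄ ∷ a₅ ∷ []) O.≈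
      Vec.map (a₀ ℤ.*_) O.1# O.+ (Vec.map (a₁ ℤ.*_) η₃ O.+ (Vec.map (a₂ ℤ.*_) q₂ O.+
        (Vec.map (a₃ ℤ.*_) q₃ O.+ (Vec.map (a₄ ℤ.*_) q₄ O.+ Vec.map (a₅ ℤ.*_) q₅))))
  expansion a₀ a₁ a₂ a₃ a₄ a₅ = HornerExpansion.horner-expansion Oᴬ.extension
      {y = η₃} {O.const a₀} {O.const a₁} {O.const a₂} {O.const a₃} {O.const a₄} {O.const a₅}
      {O.1#} {η₃} {q₂} {q₃} {q₄} {q₅}
      O.refl (O.*-identityʳ η₃) (O.reflexive η₃*η₃) (O.reflexive η₃*q₂)
      (O.reflexive η₃*q₃) (O.reflexive η₃*q₄)
      (O.const-* a₀ O.1#) (O.const-* a₁ η₃) (O.const-* a₂ q₂) (O.const-* a₃ q₃) (O.const-* a₄ q₄) (O.const-* a₅ q₅)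

opaque
  unfolding η₃
  σ₃-coordinates : ∀ a₀ a₁ a₂ a₃ a₄ a₅ → σ₃ᴼ (a₀ ∷ a₁ ∷ a₂ ∷ a₃ ∷ a₄ ∷ a₅ ∷ []) O.≈
    (a₀ ℤ.- a₂ ∷ a₂ ℤ.+ a₅ ∷ ℤ.- a₂ ℤ.- a₃ ∷ a₁ ℤ.+ a₂ ∷ ℤ.- a₂ ∷ a₂ ℤ.- a₄ ∷ [])
  σ₃-coordinates a₀ a₁ a₂ a₃ a₄ a₅ = O.trans (expansion a₀ a₁ a₂ a₃ a₄ a₅)
    ( solve 6 (λ x₀ x₁ x₂ x₃ x₄ x₅ → row (+ 1) (+ 0) -1ℤ (+ 0) (+ 0) (+ 0) x₀ x₁ x₂ x₃ x₄ x₅ := x₀ :- x₂) ≡.refl a₀ a₁ a₂ a₃ a₄ a₅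
    ∷ solve 6 (λ x₀ x₁ x₂ x₃ x₄ x₅ → row (+ 0) (+ 0) (+ 1) (+ 0) (+ 0) (+ 1) x₀ x₁ x₂ x₃ x₄ x₅ := x₂ :+ x₅) ≡.refl a₀ a₁ a₂ a₃ a₄ a₅
    ∷ solve 6 (λ x₀ x₁ x₂ x₃ x₄ x₅ → row (+ 0) (+ 0) -1ℤ -1ℤ (+ 0) (+ 0) x₀ x₁ x₂ x₃ x₄ x₅ := :- x₂ :- x₃) ≡.refl a₀ a₁ a₂ a₃ a₄ a₅
    ∷ solve 6 (λ x₀ x₁ x₂ x₃ x₄ x₅ → row (+ 0) (+ 1) (+ 1) (+ 0) (+ 0) (+ 0) x₀ x₁ x₂ x₃ x₄ x₅ := x₁ :+ x₂) ≡.refl a₀ a₁ a₂ a₃ a₄ a₅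
    ∷ solve 6 (λ x₀ x₁ x₂ x₃ x₄ x₅ → row (+ 0) (+ 0) -1ℤ (+ 0) (+ 0) (+ 0) x₀ x₁ x₂ x₃ x₄ x₅ := :- x₂) ≡.refl a₀ a₁ a₂ a₃ a₄ a₅
    ∷ solve 6 (λ x₀ x₁ x₂ x₃ x₄ x₅ → row (+ 0) (+ 0) (+ 1) (+ 0) -1ℤ (+ 0) x₀ x₁ x₂ x₃ x₄ x₅ := x₂ :- x₄) ≡.refl a₀ a₁ a₂ a₃ a₄ a₅
    ∷ [] )
    where
    open ℤSolver.+-*-Solver using (solve; _:=_; _:+_; _:*_; _:-_; :-_; con; Polynomial)
    row : (c₀ c₁ c₂ c₃ c₄ c₅ : ℤ) (x₀ x₁ x₂ x₃ x₄ x₅ : Polynomial 6) → Polynomial 6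
    row c₀ c₁ c₂ c₃ c₄ c₅ x₀ x₁ x₂ x₃ x₄ x₅ =
      x₀ :* con c₀ :+ (x₁ :* con c₁ :+ (x₂ :* con c₂ :+ (x₃ :* con c₃ :+ (x₄ :* con c₄ :+ x₅ :* con c₅))))

-- 3 is a primitive root modulo 14, so σ₃ generates the Galois group. In coordinates the fixed-point
-- equations are triangular and are solved in the order a₂, a₄, a₅, a₁, a₃.
σ₃-fixed⇒rational : ∀ {x} → σ₃ᴼ x O.≈ x → x O.≈ O.const (Vec.head x)
σ₃-fixed⇒rational {a₀ ∷ a₁ ∷ a₂ ∷ a₃ ∷ a₄ ∷ a₅ ∷ []} σx≈x
  with O.trans (O.sym (σ₃-coordinates a₀ a₁ a₂ a₃ a₄ a₅)) σx≈x
... | p₀ ∷ p₁ ∷ p₂ ∷ p₃ ∷ p₄ ∷ p₅ ∷ [] = ≡.refl ∷ a₁≡0 ∷ a₂≡0 ∷ a₃≡0 ∷ a₄≡0 ∷ a₅≡0 ∷ []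
  where
  open AbelianGroupProperties ℤₚ.+-0-abelianGroup using (identityʳ-unique)
  a₂≡0 : a₂ ≡ + 0
  a₂≡0 = ℤₚ.neg-injective (identityʳ-unique a₀ (ℤ.- a₂) p₀)
  a₄≡0 : a₄ ≡ + 0
  a₄≡0 = ≡.trans (≡.sym p₄) (≡.cong (ℤ.-_) a₂≡0)
  a₅≡0 : a₅ ≡ + 0
  a₅≡0 = ≡.trans (≡.sym p₅) (≡.cong₂ ℤ._-_ a₂≡0 a₄≡0)
  a₁≡0 : a₁ ≡ + 0
  a₁≡0 = ≡.trans (≡.sym p₁) (≡.cong₂ ℤ._+_ a₂≡0 a₅≡0)
  a₃≡0 : a₃ ≡ + 0
  a₃≡0 = ≡.trans (≡.sym p₃) (≡.cong₂ ℤ._+_ a₁≡0 a₂≡0)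

-- Powers of 7 dividing the order of a unit

proper-divisor-of-power : ∀ {p} → Prime p → ∀ k {d} → d ∣ p ℕ.^ suc k → p ℕ.^ suc k ∤ d → d ∣ p ℕ.^ k
proper-divisor-of-power {p} p-prime k {d} (divides m p^[1+k]≡md) p^[1+k]∤d with p ∣.∣? m
... | yes (divides m′ m≡m′p) = divides m′ (ℕₚ.*-cancelˡ-≡ (p ℕ.^ k) (m′ ℕ.* d) p (begin
  p ℕ.* p ℕ.^ k     ≡⟨ p^[1+k]≡md ⟩
  m ℕ.* d           ≡⟨ ≡.cong (ℕ._* d) (≡.trans m≡m′p (ℕₚ.*-comm m′ p)) ⟩
  p ℕ.* m′ ℕ.* d    ≡⟨ ℕₚ.*-assoc p m′ d ⟩
  p ℕ.* (m′ ℕ.* d)  ∎))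
  where
  open ≡.≡-Reasoning
  instance _ = prime⇒nonZero p-prime
-- The cofactor m is coprime to p but divides a power of p. So m = 1 and d is the full power, which
-- is excluded.
... | no p∤m = ⊥-elim (p^[1+k]∤d (∣.∣-reflexive (begin
  p ℕ.* p ℕ.^ k     ≡⟨ p^[1+k]≡md ⟩
  m ℕ.* d           ≡⟨ ≡.cong (ℕ._* d) m≡1 ⟩
  1 ℕ.* d           ≡⟨ ℕₚ.*-identityˡ d ⟩
  d                 ∎)))
  where
  open ≡.≡-Reasoning
  m⊥p : Coprime m p
  m⊥p (e∣m , e∣p) with prime⇒irreducible p-prime e∣p
  ... | inj₁ e≡1    = e≡1
  ... | inj₂ ≡.refl = ⊥-elim (p∤m e∣m)
  ∣1 : ∀ j → m ∣ p ℕ.^ j → m ∣ 1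
  ∣1 zero    m∣1   = m∣1
  ∣1 (suc j) m∣p^  = ∣1 j (Coprimality.coprime-divisor m⊥p m∣p^)
  m≡1 : m ≡ 1
  m≡1 = ∣.∣1⇒≡1 (∣1 (suc k) (divides d (≡.trans p^[1+k]≡md (ℕₚ.*-comm m d))))

14^n≡2^n*7^n : ∀ n → 14 ℕ.^ n ≡ 2 ℕ.^ n ℕ.* 7 ℕ.^ n
14^n≡2^n*7^n zero    = ≡.refl
14^n≡2^n*7^n (suc n) = ≡.trans (≡.cong (14 ℕ.*_) (14^n≡2^n*7^n n)) (interchange 2 7 (2 ℕ.^ n) (7 ℕ.^ n))
  where open import Algebra.Properties.CommutativeSemigroup ℕₚ.*-commutativeSemigroup using (interchange)

7-prime : Prime 7
7-prime = toWitness {a? = prime? 7} tt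

module Conjugates (S : CommutativeRing 0ℓ 0ℓ) where
  open CommutativeRing S
  open Powers S
  open CubicPeriods S using (root; v¹⁴≈1; v²≈1⇒7≈0; 2#; 3#; 4#)
  open SetoidReasoning setoid
  open SemiringSolver commutativeSemiring using (solve; _:=_; _:+_; _:*_; _:^_)

  -- A record, so that the type checker never normalises c ^ 14.
  record Factorisation (E a u b c : Carrier) : Set where
    field relation : E * a ≈ u * b * c ^ 14

  power-relation : ∀ {E a u b c} → Factorisation E a u b c →
                   ∀ N → E ^ N * a ^ N ≈ u ^ N * b ^ N * c ^ (14 ℕ.* N)
  power-relation {E} {a} {u} {b} {c} F N = begin
    E ^ N * a ^ N                  ≈⟨ ^-distrib-* E a N ⟨
    (E * a) ^ N                    ≈⟨ ^-congˡ N (Factorisation.relation F) ⟩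
    (u * b * c ^ 14) ^ N           ≈⟨ ^-distrib-* (u * b) (c ^ 14) N ⟩
    (u * b) ^ N * (c ^ 14) ^ N     ≈⟨ *-cong (^-distrib-* u b N) (^-assocʳ c 14 N) ⟩
    u ^ N * b ^ N * c ^ (14 ℕ.* N) ∎

  -- Applied twice, this inverts 29⁹ = (29³)³ once 29 is inverted.
  cube-unit : ∀ {x y} → x * y ≈ 1# → x * x * x * (y * y * y) ≈ 1#
  cube-unit {x} {y} xy≈1 = begin
    x * x * x * (y * y * y)     ≈⟨ solve 2 (λ x y → x :* x :* x :* (y :* y :* y) := (x :* y) :^ 3) refl x y ⟩
    (x * y) ^ 3                 ≈⟨ ^-congˡ 3 xy≈1 ⟩
    1# ^ 3                      ≈⟨ 1^ 3 ⟩
    1#                          ∎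

  -- `E`, `b`, `b̄` stand for 29⁹, 29⁹ α and 29⁹ ᾱ modulo a prime, `e` for the inverse of `E`, and
  -- `y₂`, `y₃` for the two conjugates of `b ^ N + b̄ ^ N`. The names `-s` and `-2#` are variables
  -- tied to negation by equations, which keeps subtraction away from the semiring solver.
  module _ {E e b b̄ s -s -2# : Carrier} (Ee≈1 : E * e ≈ 1#) (bb̄≈EE : b * b̄ ≈ E * E)
           (ss≈1 : s * s ≈ 1#) (-s+s≈0 : -s + s ≈ 0#) (-2+2≈0 : -2# + 2# ≈ 0#)
           (N : ℕ) {y₂ y₃ : Carrier}
           (h₁ : b ^ N + b̄ ^ N + y₂ + y₃ ≈ E ^ N * s)
           (h₂ : (b ^ N + b̄ ^ N) * y₂ + (b ^ N + b̄ ^ N) * y₃ + y₂ * y₃ ≈ E ^ N * E ^ N * -2#)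
           (h₃ : (b ^ N + b̄ ^ N) * y₂ * y₃ ≈ E ^ N * E ^ N * E ^ N * -s) where

    β β⁻¹ : Carrier
    β   = e * b
    β⁻¹ = e * b̄

    β*β⁻¹≈1 : β * β⁻¹ ≈ 1#
    β*β⁻¹≈1 = begin
      e * b * (e * b̄)   ≈⟨ solve 3 (λ e b c → e :* b :* (e :* c) := e :* e :* (b :* c)) refl e b b̄ ⟩
      e * e * (b * b̄)   ≈⟨ *-congˡ bb̄≈EE ⟩
      e * e * (E * E)   ≈⟨ solve 2 (λ e E → e :* e :* (E :* E) := E :* e :* (E :* e)) refl e E ⟩
      E * e * (E * e)   ≈⟨ *-cong Ee≈1 Ee≈1 ⟩
      1# * 1#           ≈⟨ *-identityˡ 1# ⟩
      1#                ∎

    private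
      D y₁ D⁻¹ k v v⁻¹ : Carrier
      D   = E ^ N
      y₁  = b ^ N + b̄ ^ N
      D⁻¹ = e ^ N
      -- Division by D clears the power of 29⁹. The factor s = -1 turns primitive seventh roots of
      -- unity into fourteenth roots, so that v = s β^N satisfies the same cubic in both cases.
      k   = s * D⁻¹
      v   = k * b ^ N
      v⁻¹ = k * b̄ ^ N

      kD≈s : k * D ≈ s
      kD≈s = trans (*-assoc s D⁻¹ D) (trans (*-congˡ (trans (*-comm D⁻¹ D) (unit^ Ee≈1 N))) (*-identityʳ s))

      v*v⁻¹≈1 : v * v⁻¹ ≈ 1#
      v*v⁻¹≈1 = begin
        k * b ^ N * (k * b̄ ^ N)     ≈⟨ solve 3 (λ k b c → k :* b :* (k :* c) := k :* k :* (b :* c)) refl k (b ^ N) (b̄ ^ N) ⟩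
        k * k * (b ^ N * b̄ ^ N)     ≈⟨ *-congˡ (trans (sym (^-distrib-* b b̄ N)) (trans (^-congˡ N bb̄≈EE) (^-distrib-* E E N))) ⟩
        k * k * (D * D)             ≈⟨ solve 2 (λ k D → k :* k :* (D :* D) := k :* D :* (k :* D)) refl k D ⟩
        k * D * (k * D)             ≈⟨ *-cong kD≈s kD≈s ⟩
        s * s                       ≈⟨ ss≈1 ⟩
        1#                          ∎

      g₁ : k * y₁ + k * y₂ + k * y₃ ≈ 1#
      g₁ = begin
        k * y₁ + k * y₂ + k * y₃    ≈⟨ solve 4 (λ k a b c → k :* a :+ k :* b :+ k :* c := k :* (a :+ b :+ c)) refl k y₁ y₂ y₃ ⟩
        k * (y₁ + y₂ + y₃)          ≈⟨ *-congˡ h₁ ⟩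
        k * (D * s)                 ≈⟨ *-assoc k D s ⟨
        k * D * s                   ≈⟨ *-congʳ kD≈s ⟩
        s * s                       ≈⟨ ss≈1 ⟩
        1#                          ∎

      g₂ : k * y₁ * (k * y₂) + k * y₁ * (k * y₃) + k * y₂ * (k * y₃) + 2# ≈ 0#
      g₂ = begin
        k * y₁ * (k * y₂) + k * y₁ * (k * y₃) + k * y₂ * (k * y₃) + 2#
          ≈⟨ +-congʳ (solve 4 (λ k a b c → k :* a :* (k :* b) :+ k :* a :* (k :* c) :+ k :* b :* (k :* c)
                                := k :* k :* (a :* b :+ a :* c :+ b :* c)) refl k y₁ y₂ y₃) ⟩
        k * k * (y₁ * y₂ + y₁ * y₃ + y₂ * y₃) + 2#   ≈⟨ +-congʳ (*-congˡ h₂) ⟩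
        k * k * (D * D * -2#) + 2#
          ≈⟨ +-congʳ (solve 3 (λ k D m → k :* k :* (D :* D :* m) := k :* D :* (k :* D) :* m) refl k D -2#) ⟩
        k * D * (k * D) * -2# + 2#  ≈⟨ +-congʳ (*-congʳ (trans (*-cong kD≈s kD≈s) ss≈1)) ⟩
        1# * -2# + 2#               ≈⟨ +-congʳ (*-identityˡ -2#) ⟩
        -2# + 2#                    ≈⟨ -2+2≈0 ⟩
        0#                          ∎

      g₃ : k * y₁ * (k * y₂) * (k * y₃) + 1# ≈ 0#
      g₃ = begin
        k * y₁ * (k * y₂) * (k * y₃) + 1#
          ≈⟨ +-congʳ (solve 4 (λ k a b c → k :* a :* (k :* b) :* (k :* c) := k :* k :* k :* (a :* b :* c)) refl k y₁ y₂ y₃) ⟩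
        k * k * k * (y₁ * y₂ * y₃) + 1#       ≈⟨ +-congʳ (*-congˡ h₃) ⟩
        k * k * k * (D * D * D * -s) + 1#
          ≈⟨ +-congʳ (solve 3 (λ k D m → k :* k :* k :* (D :* D :* D :* m) := k :* D :* (k :* D) :* (k :* D :* m)) refl k D -s) ⟩
        k * D * (k * D) * (k * D * -s) + 1#   ≈⟨ +-cong (*-cong (trans (*-cong kD≈s kD≈s) ss≈1) (*-congʳ kD≈s)) (sym ss≈1) ⟩
        1# * (s * -s) + s * s                 ≈⟨ +-congʳ (*-identityˡ _) ⟩
        s * -s + s * s                        ≈⟨ distribˡ s -s s ⟨
        s * (-s + s)                          ≈⟨ *-congˡ -s+s≈0 ⟩
        s * 0#                                ≈⟨ zeroʳ s ⟩
        0#                                    ∎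

      y-root : (v + v⁻¹) ^ 3 + 1# ≈ (v + v⁻¹) ^ 2 + 2# * (v + v⁻¹)
      y-root = trans (+-congʳ (^-congˡ 3 (sym ky₁))) (trans (root g₁ g₂ g₃) (+-cong (^-congˡ 2 ky₁) (*-congˡ ky₁)))
        where
        ky₁ : k * y₁ ≈ v + v⁻¹
        ky₁ = distribˡ k _ _

      v≈sβᴺ : v ≈ s * β ^ N
      v≈sβᴺ = trans (*-assoc s D⁻¹ (b ^ N)) (*-congˡ (sym (^-distrib-* e b N)))

      -- An even exponent removes the sign s.
      v^2m : ∀ m → v ^ (2 ℕ.* m) ≈ β ^ (2 ℕ.* m ℕ.* N)
      v^2m m = begin
        v ^ (2 ℕ.* m)                          ≈⟨ ^-congˡ (2 ℕ.* m) v≈sβᴺ ⟩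
        (s * β ^ N) ^ (2 ℕ.* m)                ≈⟨ ^-distrib-* s (β ^ N) (2 ℕ.* m) ⟩
        s ^ (2 ℕ.* m) * (β ^ N) ^ (2 ℕ.* m)    ≈⟨ *-cong (^-∣ {s} {2} s²≈1 (∣.m∣m*n m)) (^-assocʳ β N (2 ℕ.* m)) ⟩
        1# * β ^ (N ℕ.* (2 ℕ.* m))             ≈⟨ *-identityˡ _ ⟩
        β ^ (N ℕ.* (2 ℕ.* m))                  ≈⟨ ^-congʳ β (ℕₚ.*-comm N (2 ℕ.* m)) ⟩
        β ^ (2 ℕ.* m ℕ.* N)                    ∎
        where
        s²≈1 : s ^ 2 ≈ 1#
        s²≈1 = trans (*-congˡ (*-identityʳ s)) ss≈1

    β^14N≈1 : β ^ (14 ℕ.* N) ≈ 1#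
    β^14N≈1 = trans (sym (v^2m 7)) (v¹⁴≈1 v*v⁻¹≈1 y-root)

    β^2N≈1⇒7≈0 : β ^ (2 ℕ.* N) ≈ 1# → 4# + 3# ≈ 0#
    β^2N≈1⇒7≈0 β^2N≈1 = v²≈1⇒7≈0 v*v⁻¹≈1 y-root (trans (v^2m 1) β^2N≈1)

    -- Here r is one less than in the theorem. Raising β to the power 2^(r+1) strips the 2-part of
    -- 14N = 14^(r+1). If 7^(r+1) did not divide n, its gcd with n would divide 7^r. The power x
    -- would then satisfy x^(7^r) = β^(2N) = 1, which forces 7 = 0.
    7^r∣ : ¬ (4# + 3# ≈ 0#) → ∀ r → N ≡ 14 ℕ.^ r → ∀ {n} → β ^ n ≈ 1# → 7 ℕ.^ suc r ∣ n
    7^r∣ 7≉0 r ≡.refl {n} β^n≈1 with 7 ℕ.^ suc r ∣.∣? n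
    ... | yes 7^[1+r]∣n = 7^[1+r]∣n
    ... | no  7^[1+r]∤n = ⊥-elim (7≉0 (β^2N≈1⇒7≈0 (begin
      β ^ (2 ℕ.* N)                  ≈⟨ ^-congʳ β 2N≡ ⟩
      β ^ (2 ℕ.^ suc r ℕ.* 7 ℕ.^ r)  ≈⟨ ^-assocʳ β (2 ℕ.^ suc r) (7 ℕ.^ r) ⟨
      x ^ (7 ℕ.^ r)                  ≈⟨ ^-∣ {x} {d} x^d≈1 d∣7^r ⟩
      1#                             ∎)))
      where
      x : Carrier
      x = β ^ (2 ℕ.^ suc r)
      d : ℕ
      d = GCD.gcd (7 ℕ.^ suc r) n
      2N≡ : 2 ℕ.* 14 ℕ.^ r ≡ 2 ℕ.^ suc r ℕ.* 7 ℕ.^ r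
      2N≡ = ≡.trans (≡.cong (2 ℕ.*_) (14^n≡2^n*7^n r)) (≡.sym (ℕₚ.*-assoc 2 (2 ℕ.^ r) (7 ℕ.^ r)))
      x^7^[1+r]≈1 : x ^ (7 ℕ.^ suc r) ≈ 1#
      x^7^[1+r]≈1 = trans (^-assocʳ β (2 ℕ.^ suc r) (7 ℕ.^ suc r))
        (trans (^-congʳ β (≡.sym (14^n≡2^n*7^n (suc r)))) β^14N≈1)
      x^n≈1 : x ^ n ≈ 1#
      x^n≈1 = trans (^-assocʳ β (2 ℕ.^ suc r) n) (^-∣ {β} {n} β^n≈1 (∣.n∣m*n (2 ℕ.^ suc r)))
      d∣7^r : d ∣ 7 ℕ.^ r
      d∣7^r = proper-divisor-of-power 7-prime r (GCD.gcd[m,n]∣m (7 ℕ.^ suc r) n)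
        (λ 7^∣d → 7^[1+r]∤n (∣.∣-trans 7^∣d (GCD.gcd[m,n]∣n (7 ℕ.^ suc r) n)))
      x^d≈1 : x ^ d ≈ 1#
      x^d≈1 = ^-Bézout {x} {d} {7 ℕ.^ suc r} {n}
        (Bézout.identity (GCD.gcd-GCD (7 ℕ.^ suc r) n)) x^7^[1+r]≈1 x^n≈1

-- The congruences in ℤ[ζ]

opaque
  -- A common denominator of α: π has norm 29, so the inverse of each conjugate of π̄ costs one
  -- factor 29, and α contains 1 + 3 + 5 such inverses.
  29⁹ : ℤ
  29⁹ = + 14507145975869

  -- b = 29⁹ α, c = σ₁₃(π) σ₉(π) σ₁₁(π), c̄ is its complex conjugate, and u = ζ⁶.
  b c c̄ u : O.Carrier
  b = -[1+ 3680484505228 ] ∷ -[1+ 7244641797106 ] ∷ + 5473199950127 ∷ -[1+ 1487354653238 ] ∷ + 12999759002867 ∷ -[1+ 1403168410370 ] ∷ []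
  c = -[1+ 5 ] ∷ + 4 ∷ -[1+ 3 ] ∷ + 6 ∷ -[1+ 3 ] ∷ + 3 ∷ []
  c̄ = -[1+ 1 ] ∷ -[1+ 3 ] ∷ + 1 ∷ + 0 ∷ -[1+ 1 ] ∷ + 0 ∷ []
  u = Oᴬ.T^ 6 O.1#

Eᴼ : O.Carrier
Eᴼ = O.const 29⁹

module Conjᴼ = Conjugates Oᴬ.extension

opaque
  unfolding gauss η₃ b

  factorisation : Conjᴼ.Factorisation Eᴼ a u b c
  factorisation = record { relation = O.reflexive (toWitness {a? = _ O.≟ _} tt) }

  -- α ᾱ = 1, since α is a product of conjugates of π/π̄.
  bb̄≡EE : b O.* τᴼ b ≡ Eᴼ O.* Eᴼ
  bb̄≡EE = toWitness {a? = _ O.≟ _} tt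

  29ᴼ≡ : 29ᴼ ≡ O.const (+ 29)
  29ᴼ≡ = ≡.refl

  E≡29⁹ : let q = 29ᴼ O.* 29ᴼ O.* 29ᴼ in Eᴼ ≡ q O.* q O.* q
  E≡29⁹ = toWitness {a? = _ O.≟ _} tt

  -- The six factors of c and c̄ are all the conjugates of π. The equation makes c a unit modulo
  -- anything prime to 29.
  cc̄≡29 : c O.* c̄ ≡ 29ᴼ
  cc̄≡29 = toWitness {a? = _ O.≟ _} tt

  u^N≈1 : ∀ {N} → 14 ∣ N → u O.^ N O.≈ O.1#
  u^N≈1 = Oᴬ.T^-∣ 14 ζ-order 6

-- s = 1 occurs for primitive fourteenth roots of unity, whose periods are the roots of x³ - x² - 2x
-- + 1. For primitive seventh roots the periods change sign and s = -1.
record PeriodValues (z : O.Carrier) (s : ℤ) : Set where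
  field
    e₁-value : Pᴼ.e₁ (z O.+ τᴼ z) ≡ O.const s
    e₂-value : Pᴼ.e₂ (z O.+ τᴼ z) ≡ O.const -[1+ 1 ]
    e₃-value : Pᴼ.e₃ (z O.+ τᴼ z) ≡ O.const (ℤ.- s)

opaque
  unfolding gauss η₃

  values-ζ¹³ : PeriodValues ζ¹³ (+ 1)
  values-ζ¹³ = record
    { e₁-value = toWitness {a? = _ O.≟ _} tt
    ; e₂-value = toWitness {a? = _ O.≟ _} tt
    ; e₃-value = toWitness {a? = _ O.≟ _} tt
    }

  values-ζ² : PeriodValues ζ² -1ℤ
  values-ζ² = record
    { e₁-value = toWitness {a? = _ O.≟ _} tt
    ; e₂-value = toWitness {a? = _ O.≟ _} tt
    ; e₃-value = toWitness {a? = _ O.≟ _} tt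
    }

yᴼ Dᴼ : ℕ → O.Carrier
yᴼ N = b O.^ N O.+ τᴼ b O.^ N
Dᴼ N = Eᴼ O.^ N

-- The conditions on the S⁽ⁱ⁾ with denominators 29^(9N) cleared. In this form they live in ℤ[ζ] and
-- pass to divisors of m.
record Congruences (m N : ℕ) (s : ℤ) : Set where
  open OMod m using (_≅_)
  field
    cong₁ : Pᴼ.e₁ (yᴼ N) ≅ Dᴼ N O.* O.const s
    cong₂ : Pᴼ.e₂ (yᴼ N) ≅ Dᴼ N O.* Dᴼ N O.* O.const -[1+ 1 ]
    cong₃ : Pᴼ.e₃ (yᴼ N) ≅ Dᴼ N O.* Dᴼ N O.* Dᴼ N O.* O.const (ℤ.- s)

Coprime⇒inverse : ∀ {k m} → Coprime k m → ∃[ x ] ∃[ t ] + k ℤ.* x ≡ + 1 ℤ.+ + m ℤ.* t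
Coprime⇒inverse {k} {m} k⊥m with Coprimality.coprime-Bézout k⊥m
... | Bézout.+- x y 1+ym≡xk = + x , + y , (begin
  + k ℤ.* + x              ≡⟨ ℤₚ.pos-* k x ⟨
  + (k ℕ.* x)              ≡⟨ ≡.cong +_ (≡.trans (ℕₚ.*-comm k x) (≡.sym 1+ym≡xk)) ⟩
  + (1 ℕ.+ y ℕ.* m)        ≡⟨ ≡.cong (λ j → + (1 ℕ.+ j)) (ℕₚ.*-comm y m) ⟩
  + 1 ℤ.+ + (m ℕ.* y)      ≡⟨ ≡.cong (ℤ._+_ (+ 1)) (ℤₚ.pos-* m y) ⟩
  + 1 ℤ.+ + m ℤ.* + y      ∎)
  where open ≡.≡-Reasoning
... | Bézout.-+ x y 1+xk≡ym = ℤ.- + x , ℤ.- + y , (begin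
  + k ℤ.* ℤ.- + x                            ≡⟨ solve 2 (λ k x → k :* :- x := con (+ 1) :- (con (+ 1) :+ x :* k)) ≡.refl (+ k) (+ x) ⟩
  + 1 ℤ.- (+ 1 ℤ.+ + x ℤ.* + k)              ≡⟨ ≡.cong (λ j → + 1 ℤ.- (+ 1 ℤ.+ j)) (ℤₚ.pos-* x k) ⟨
  + 1 ℤ.- + (1 ℕ.+ x ℕ.* k)                  ≡⟨ ≡.cong (λ j → + 1 ℤ.- + j) 1+xk≡ym ⟩
  + 1 ℤ.- + (y ℕ.* m)                        ≡⟨ ≡.cong (λ j → + 1 ℤ.- j) (ℤₚ.pos-* y m) ⟩
  + 1 ℤ.- + y ℤ.* + m                        ≡⟨ solve 2 (λ y m → con (+ 1) :- y :* m := con (+ 1) :+ m :* :- y) ≡.refl (+ y) (+ m) ⟩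
  + 1 ℤ.+ + m ℤ.* ℤ.- + y                    ∎)
  where
  open ≡.≡-Reasoning
  open ℤSolver.+-*-Solver using (solve; _:=_; _:+_; _:*_; _:-_; :-_; con)

module OModProperties (m : ℕ) where
  open OMod m
  private module constᴹ = IsSemiringHomomorphism const-hom

  opaque
    const-inverse : ∀ {k} → Coprime k m → ∃[ x ] O.const (+ k) O.* x ≅ O.1#
    const-inverse {k} k⊥m =
      let x , t , kx≡1+mt = Coprime⇒inverse k⊥m in
      O.const x , B.trans (B.sym (constᴹ.*-homo (+ k) x)) (B.trans (constᴹ.⟦⟧-cong kx≡1+mt)
        (B.trans (constᴹ.+-homo (+ 1) (+ m ℤ.* t)) (B.trans (B.+-congˡ {O.1#} (B.trans (constᴹ.*-homo (+ m) t)
          (B.trans (B.*-congʳ {O.const t} m≅0) (B.zeroˡ (O.const t))))) (B.+-identityʳ O.1#))))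

  head-cong : ∀ {x y} → x ≅ y → ∃[ t ] Vec.head x ≡ Vec.head y ℤ.+ + m ℤ.* t
  head-cong {x} {y} (t , x≈y+mt) = Vec.head t ,
    ≡.trans (heads x≈y+mt) (≡.trans (head-+ y (O.const (+ m) O.* t))
      (≡.cong (ℤ._+_ (Vec.head y)) (≡.trans (heads (O.const-* (+ m) t)) (head-map t))))
    where
    heads : ∀ {x y : O.Carrier} → x O.≈ y → Vec.head x ≡ Vec.head y
    heads {_ ∷ _} {_ ∷ _} (p ∷ _) = p
    head-+ : ∀ (x y : O.Carrier) → Vec.head (x O.+ y) ≡ Vec.head x ℤ.+ Vec.head y
    head-+ (_ ∷ _) (_ ∷ _) = ≡.refl
    head-map : ∀ (x : O.Carrier) → Vec.head (Vec.map (+ m ℤ.*_) x) ≡ + m ℤ.* Vec.head x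
    head-map (_ ∷ _) = ≡.refl

  eval-hom-mod : ∀ η → σᴼ.Φ₁₄-root η → IsHom quotientRing quotientRing (σᴼ.eval η)
  eval-hom-mod η Φ = record
    { isNearSemiringHomomorphism = record
      { +-isMonoidHomomorphism = record
        { isMagmaHomomorphism = record
          { isRelHomomorphism = record { cong = cong }
          ; homo = λ x y → ≈⇒≅ (σ.+-homo x y)
          }
        ; ε-homo = ≈⇒≅ σ.0#-homo
        }
      ; *-homo = λ x y → ≈⇒≅ (σ.*-homo x y)
      }
    ; 1#-homo = ≈⇒≅ σ.1#-homo
    }
    where
    module σ = IsSemiringHomomorphism (σᴼ.eval-hom Φ)
    cong : ∀ {x y} → x ≅ y → σᴼ.eval η x ≅ σᴼ.eval η y
    cong {x} {y} (t , x≈y+mt) = σᴼ.eval η t , O.trans (σ.⟦⟧-cong x≈y+mt) (O.trans (σ.+-homo y (O.const (+ m) O.* t))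
      (O.+-congˡ {σᴼ.eval η y} (O.trans (σ.*-homo (O.const (+ m)) t)
        (O.*-congʳ {σᴼ.eval η t} (σᴼ.eval-const η 5 (+ m))))))

eval-D : ∀ {η} → σᴼ.Φ₁₄-root η → ∀ N → σᴼ.eval η (Dᴼ N) O.≈ Dᴼ N
eval-D {η} Φ N = O.trans (HomPowers.^-homo Oᴬ.extension Oᴬ.extension (σᴼ.eval-hom Φ) Eᴼ N)
                         (O.^-congˡ N (σᴼ.eval-const η 5 29⁹))

module Forward {M N : ℕ} (M-prime : Prime M) (M≡1+14N : M ≡ suc (14 ℕ.* N)) (14∣N : 14 ∣ N) (29⊥M : Coprime 29 M) where
  open OMod M
  open OModProperties M
  open Reciprocity {M} {N} M-prime M≡1+14N
  private
    module PM = Periods quotientRing {σ₃ᴼ} {σ₅ᴼ} {τᴼ} (eval-hom-mod η₃ η₃-root) (eval-hom-mod η₅ η₅-root)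
    module τ = IsSemiringHomomorphism (eval-hom-mod η₁₃ η₁₃-root)

    -- 14N = M - 1, Frobenius gives c^M ≡ c, and c is a unit modulo M because c c̄ = 29 is.
    c^14N≅1 : c O.^ (14 ℕ.* N) ≅ O.1#
    c^14N≅1 = B.trans (B.reflexive (≡.sym (^-≡ c (14 ℕ.* N)))) (B.fixed-unit⇒root {c} {c̄ O.* x} unit (14 ℕ.* N)
      (B.trans (B.reflexive (≡.trans (^-≡ c (suc (14 ℕ.* N))) (≡.cong (c O.^_) (≡.sym M≡1+14N)))) (^M-fixed c)))
      where
      x = proj₁ (const-inverse 29⊥M)
      29x≅1 : O.const (+ 29) O.* x ≅ O.1#
      29x≅1 = proj₂ (const-inverse 29⊥M)
      unit : c O.* (c̄ O.* x) ≅ O.1#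
      unit = B.trans (B.sym (B.*-assoc c c̄ x)) (B.trans (B.*-congʳ {x} (B.reflexive (≡.trans cc̄≡29 29ᴼ≡))) 29x≅1)

    -- In the N-th power of `factorisation` the factors u^N and c^(14N) become 1, so a^N may be
    -- replaced by α^N.
    b^N≅ : ∀ {z} → a O.^ N ≅ z → b O.^ N ≅ Dᴼ N O.* z
    b^N≅ {z} a^N≅z = begin
      b O.^ N                                        ≈⟨ B.trans (B.*-identityʳ _) (B.*-identityˡ (b O.^ N)) ⟨
      O.1# O.* b O.^ N O.* O.1#                      ≈⟨ B.*-cong (B.*-congʳ {b O.^ N} (≈⇒≅ (u^N≈1 14∣N))) c^14N≅1 ⟨
      u O.^ N O.* b O.^ N O.* c O.^ (14 ℕ.* N)       ≈⟨ ≈⇒≅ (Conjᴼ.power-relation factorisation N) ⟨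
      Dᴼ N O.* a O.^ N                               ≈⟨ B.*-congˡ {Dᴼ N} a^N≅z ⟩
      Dᴼ N O.* z                                     ∎
      where open SetoidReasoning B.setoid

    yᴼ≅ : ∀ {z} → a O.^ N ≅ z → yᴼ N ≅ Dᴼ N O.* (z O.+ τᴼ z)
    yᴼ≅ {z} a^N≅z = begin
      b O.^ N O.+ τᴼ b O.^ N
        ≈⟨ B.+-congˡ {b O.^ N} (≈⇒≅ (HomPowers.^-homo Oᴬ.extension Oᴬ.extension τ-hom b N)) ⟨
      b O.^ N O.+ τᴼ (b O.^ N)
        ≈⟨ B.+-cong (b^N≅ a^N≅z) (τ.⟦⟧-cong (b^N≅ a^N≅z)) ⟩
      Dᴼ N O.* z O.+ τᴼ (Dᴼ N O.* z)
        ≈⟨ B.+-congˡ {Dᴼ N O.* z} (B.trans (τ.*-homo (Dᴼ N) z) (B.*-congʳ {τᴼ z} (≈⇒≅ (eval-D η₁₃-root N)))) ⟩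
      Dᴼ N O.* z O.+ Dᴼ N O.* τᴼ z
        ≈⟨ B.distribˡ (Dᴼ N) z (τᴼ z) ⟨
      Dᴼ N O.* (z O.+ τᴼ z) ∎
      where open SetoidReasoning B.setoid

  congruences : ∀ {z s} → PeriodValues z s → a O.^ N ≅ z → Congruences M N s
  congruences {z} {s} values a^N≅z = record
    { cong₁ = B.trans (PM.e₁-cong y≅) (B.trans (PM.e₁-scale σ₃D σ₅D v) (B.*-congˡ {Dᴼ N} (B.reflexive e₁-value)))
    ; cong₂ = B.trans (PM.e₂-cong y≅) (B.trans (PM.e₂-scale σ₃D σ₅D v) (B.*-congˡ {Dᴼ N O.* Dᴼ N} (B.reflexive e₂-value)))
    ; cong₃ = B.trans (PM.e₃-cong y≅) (B.trans (PM.e₃-scale σ₃D σ₅D v) (B.*-congˡ {Dᴼ N O.* Dᴼ N O.* Dᴼ N} (B.reflexive e₃-value)))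
    }
    where
    open PeriodValues values
    v = z O.+ τᴼ z
    y≅ = yᴼ≅ a^N≅z
    σ₃D = ≈⇒≅ (eval-D η₃-root N)
    σ₅D = ≈⇒≅ (eval-D η₅-root N)

-- The order of α modulo a prime divisor of M

^-%-≡ : ∀ m k → .{{_ : ℕ.NonZero k}} → ∀ n → (m ℕ.^ n) % k ≡ ((m % k) ℕ.^ n) % k
^-%-≡ m k zero    = ≡.refl
^-%-≡ m k (suc n) = begin
  (m ℕ.* m ℕ.^ n) % k                          ≡⟨ DivMod.%-distribˡ-* m (m ℕ.^ n) k ⟩
  (m % k ℕ.* ((m ℕ.^ n) % k)) % k              ≡⟨ ≡.cong₂ (λ x y → (x ℕ.* y) % k) (≡.sym (DivMod.m%n%n≡m%n m k)) (^-%-≡ m k n) ⟩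
  ((m % k) % k ℕ.* (((m % k) ℕ.^ n) % k)) % k  ≡⟨ DivMod.%-distribˡ-* (m % k) ((m % k) ℕ.^ n) k ⟨
  (m % k ℕ.* (m % k) ℕ.^ n) % k                ∎
  where open ≡.≡-Reasoning

-- The unit group modulo 14 has order 6. Its six residues are evaluated, and every other residue
-- shares 2 or 7 with 14.
Coprime⇒^6%14≡1 : ∀ {p} → Coprime p 14 → (p ℕ.^ 6) % 14 ≡ 1
Coprime⇒^6%14≡1 {p} p⊥14 = ≡.trans (^-%-≡ p 14 6) (helper (p % 14) ≡.refl (DivMod.m%n<n p 14))
  where
  module _ {k : ℕ} (p%14≡k : p % 14 ≡ k) where
    common : ∀ d → d ∣ 14 → d ∣ k → d ≡ 1
    common d d∣14 d∣k = p⊥14 (∣.∣n∣m%n⇒∣m d∣14 (≡.subst (d ∣_) (≡.sym p%14≡k) d∣k) , d∣14)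
    even : 2 ∣ k → ⊥
    even 2∣k with () ← common 2 (divides 7 ≡.refl) 2∣k
    seven : 7 ∣ k → ⊥
    seven 7∣k with () ← common 7 (divides 2 ≡.refl) 7∣k
  helper : ∀ k → p % 14 ≡ k → k ℕ.< 14 → (k ℕ.^ 6) % 14 ≡ 1
  helper 1  _ _ = ≡.refl
  helper 3  _ _ = ≡.refl
  helper 5  _ _ = ≡.refl
  helper 9  _ _ = ≡.refl
  helper 11 _ _ = ≡.refl
  helper 13 _ _ = ≡.refl
  helper 0  e _ = ⊥-elim (even e (divides 0 ≡.refl))
  helper 2  e _ = ⊥-elim (even e (divides 1 ≡.refl))
  helper 4  e _ = ⊥-elim (even e (divides 2 ≡.refl))
  helper 6  e _ = ⊥-elim (even e (divides 3 ≡.refl))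
  helper 8  e _ = ⊥-elim (even e (divides 4 ≡.refl))
  helper 10 e _ = ⊥-elim (even e (divides 5 ≡.refl))
  helper 12 e _ = ⊥-elim (even e (divides 6 ≡.refl))
  helper 7  e _ = ⊥-elim (seven e (divides 1 ≡.refl))
  helper (suc (suc (suc (suc (suc (suc (suc (suc (suc (suc (suc (suc (suc (suc k)))))))))))))) _ k<14 =
    ⊥-elim (ℕₚ.<⇒≱ k<14 (ℕₚ.m≤m+n 14 k))

module Backward {p : ℕ} (p-prime : Prime p) (p⊥14 : Coprime p 14) (29⊥p : Coprime 29 p) where
  open OMod p
  open OModProperties p
  private
    module CB = Conjugates quotientRing
    module constᴹ = IsSemiringHomomorphism const-hom

    p^6≡ : p ℕ.^ 6 ≡ suc (14 ℕ.* (p ℕ.^ 6 DivMod./ 14))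
    p^6≡ = ≡.trans (DivMod.m≡m%n+[m/n]*n (p ℕ.^ 6) 14)
      (≡.cong₂ ℕ._+_ (Coprime⇒^6%14≡1 p⊥14) (ℕₚ.*-comm (p ℕ.^ 6 DivMod./ 14) 14))

    -- p⁶ ≡ 1 modulo 14, so the sixth power of Frobenius fixes ζ, however p factors in ℤ[ζ].
    p^6-fixed : ∀ x → x B.^ (p ℕ.^ 6) ≅ x
    p^6-fixed = ^q-fixed p-prime 6 (Oᴬ.X^-fixed 14 ζ-order {l = p ℕ.^ 6 DivMod./ 14} p^6≡)

    7≇0 : ¬ (CubicPeriods.4# quotientRing O.+ CubicPeriods.3# quotientRing ≅ O.0#)
    7≇0 7≅0 = ℕₚ.<⇒≢ (ℕ.nonTrivial⇒n>1 p) (≡.sym (p⊥14 (∣.∣-refl , ∣.∣-trans p∣7 (divides 2 ≡.refl))))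
      where
      instance _ = prime⇒nonTrivial p-prime
      p∣7 : p ∣ 7
      p∣7 = let t , 7≡pt = head-cong 7≅0 in
        ∣.divides ℤ.∣ t ∣ (≡.trans (≡.cong ℤ.∣_∣ (≡.trans 7≡pt (ℤₚ.+-identityˡ (+ p ℤ.* t))))
          (≡.trans (ℤₚ.abs-* (+ p) t) (ℕₚ.*-comm p ℤ.∣ t ∣)))

    x y q e : O.Carrier
    x = proj₁ (const-inverse 29⊥p)
    y = x O.* x O.* x
    q = 29ᴼ O.* 29ᴼ O.* 29ᴼ
    e = y O.* y O.* y

    29x≅1 : 29ᴼ O.* x ≅ O.1#
    29x≅1 = ≡.subst (λ k → k O.* x ≅ O.1#) (≡.sym 29ᴼ≡) (proj₂ (const-inverse 29⊥p))

    Ee≅1 : Eᴼ O.* e ≅ O.1#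
    Ee≅1 = ≡.subst (λ k → k O.* e ≅ O.1#) (≡.sym E≡29⁹) (CB.cube-unit {q} {y} (CB.cube-unit {29ᴼ} {x} 29x≅1))

  -- The image e b of α is a unit fixed by x ↦ x^(p⁶), so its n-th power is 1 for n = p⁶ - 1, and
  -- `7^r∣` applies; 7 is nonzero modulo p because p is coprime to 14.
  order-divisible : ∀ r {s} → s ℤ.* s ≡ + 1 → Congruences p (14 ℕ.^ r) s → ∀ {n} → p ℕ.^ 6 ≡ suc n → 7 ℕ.^ suc r ∣ n
  order-divisible r {s} ss≡1 C {n} p^6≡1+n = CB.7^r∣ Ee≅1 (B.reflexive bb̄≡EE) ss≅1 -s+s≅0 -2+2≅0
      (14 ℕ.^ r) h₁ h₂ h₃ 7≇0 r ≡.refl β^n≅1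
    where
    open Congruences C
    N = 14 ℕ.^ r
    ss≅1 : O.const s O.* O.const s ≅ O.1#
    ss≅1 = B.trans (B.sym (constᴹ.*-homo s s)) (constᴹ.⟦⟧-cong ss≡1)
    -s+s≅0 : O.const (ℤ.- s) O.+ O.const s ≅ O.0#
    -s+s≅0 = B.trans (B.sym (constᴹ.+-homo (ℤ.- s) s)) (constᴹ.⟦⟧-cong (ℤₚ.+-inverseˡ s))
    -2+2≅0 : O.const -[1+ 1 ] O.+ CubicPeriods.2# quotientRing ≅ O.0#
    -2+2≅0 = ≈⇒≅ O.refl
    y₁ D : O.Carrier
    y₁ = b B.^ N O.+ τᴼ b B.^ N
    D = Eᴼ B.^ N
    y₁≡ : yᴼ N ≡ y₁
    y₁≡ = ≡.sym (≡.cong₂ O._+_ (^-≡ b N) (^-≡ (τᴼ b) N))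
    D≡ : Dᴼ N ≡ D
    D≡ = ≡.sym (^-≡ Eᴼ N)
    y₂ y₃ : O.Carrier
    y₂ = σ₃ᴼ (yᴼ N)
    y₃ = σ₅ᴼ (yᴼ N)
    h₁ : y₁ O.+ y₂ O.+ y₃ ≅ D O.* O.const s
    h₁ = ≡.subst₂ (λ y d → y O.+ y₂ O.+ y₃ ≅ d O.* O.const s) y₁≡ D≡ cong₁
    h₂ : y₁ O.* y₂ O.+ y₁ O.* y₃ O.+ y₂ O.* y₃ ≅ D O.* D O.* O.const -[1+ 1 ]
    h₂ = ≡.subst₂ (λ y d → y O.* y₂ O.+ y O.* y₃ O.+ y₂ O.* y₃ ≅ d O.* d O.* O.const -[1+ 1 ]) y₁≡ D≡ cong₂
    h₃ : y₁ O.* y₂ O.* y₃ ≅ D O.* D O.* D O.* O.const (ℤ.- s)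
    h₃ = ≡.subst₂ (λ y d → y O.* y₂ O.* y₃ ≅ d O.* d O.* d O.* O.const (ℤ.- s)) y₁≡ D≡ cong₃
    β*β⁻¹≅1 : e O.* b O.* (e O.* τᴼ b) ≅ O.1#
    β*β⁻¹≅1 = CB.β*β⁻¹≈1 Ee≅1 (B.reflexive bb̄≡EE) ss≅1 -s+s≅0 -2+2≅0 N h₁ h₂ h₃
    β^n≅1 : (e O.* b) B.^ n ≅ O.1#
    β^n≅1 = B.fixed-unit⇒root {e O.* b} β*β⁻¹≅1 n
      (≡.subst (λ m → (e O.* b) B.^ m ≅ e O.* b) p^6≡1+n (p^6-fixed (e O.* b)))

open import Data.Product.Base using (_×_)
open import Defs

-- Congruences between rational numbers

private
  module ℚᴿ = CommutativeRing ℚₚ.+-*-commutativeRing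
  ℚ-commutativeSemiring = ℚᴿ.commutativeSemiring

ι : ℤ → ℚ
ι z = z ℚ./ 1

private
  toℚᵘ-ι : ∀ z → ℚ.toℚᵘ (ι z) ℚᵘ.≃ ℚᵘ.mkℚᵘ z 0
  toℚᵘ-ι z = ℚₚ.toℚᵘ-fromℚᵘ (ℚᵘ.mkℚᵘ z 0)

ι-+ : ∀ x y → ι (x ℤ.+ y) ≡ ι x ℚ.+ ι y
ι-+ x y = ℚₚ.toℚᵘ-injective (begin
  ℚ.toℚᵘ (ι (x ℤ.+ y))                     ≈⟨ toℚᵘ-ι (x ℤ.+ y) ⟩
  ℚᵘ.mkℚᵘ (x ℤ.+ y) 0                      ≈⟨ ℚᵘ.*≡* (≡.cong (ℤ._* + 1) (≡.cong₂ ℤ._+_ (≡.sym (ℤₚ.*-identityʳ x)) (≡.sym (ℤₚ.*-identityʳ y)))) ⟩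
  ℚᵘ.mkℚᵘ x 0 ℚᵘ.+ ℚᵘ.mkℚᵘ y 0             ≈⟨ ℚᵘₚ.+-cong (toℚᵘ-ι x) (toℚᵘ-ι y) ⟨
  ℚ.toℚᵘ (ι x) ℚᵘ.+ ℚ.toℚᵘ (ι y)           ≈⟨ ℚₚ.toℚᵘ-homo-+ (ι x) (ι y) ⟨
  ℚ.toℚᵘ (ι x ℚ.+ ι y)                     ∎)
  where open SetoidReasoning ℚᵘₚ.≃-setoid

ι-* : ∀ x y → ι (x ℤ.* y) ≡ ι x ℚ.* ι y
ι-* x y = ℚₚ.toℚᵘ-injective (begin
  ℚ.toℚᵘ (ι (x ℤ.* y))                     ≈⟨ toℚᵘ-ι (x ℤ.* y) ⟩
  ℚᵘ.mkℚᵘ x 0 ℚᵘ.* ℚᵘ.mkℚᵘ y 0             ≈⟨ ℚᵘₚ.*-cong (toℚᵘ-ι x) (toℚᵘ-ι y) ⟨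
  ℚ.toℚᵘ (ι x) ℚᵘ.* ℚ.toℚᵘ (ι y)           ≈⟨ ℚₚ.toℚᵘ-homo-* (ι x) (ι y) ⟨
  ℚ.toℚᵘ (ι x ℚ.* ι y)                     ∎)
  where open SetoidReasoning ℚᵘₚ.≃-setoid

ι-injective : ∀ {x y} → ι x ≡ ι y → x ≡ y
ι-injective {x} {y} ιx≡ιy with ℚᵘₚ.≃-trans (ℚᵘₚ.≃-sym (toℚᵘ-ι x)) (ℚᵘₚ.≃-trans (ℚᵘₚ.≃-reflexive (≡.cong ℚ.toℚᵘ ιx≡ιy)) (toℚᵘ-ι y))
... | ℚᵘ.*≡* x*1≡y*1 = ≡.trans (≡.sym (ℤₚ.*-identityʳ x)) (≡.trans x*1≡y*1 (ℤₚ.*-identityʳ y))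

ι-hom : IsHom ℤₚ.+-*-commutativeRing ℚₚ.+-*-commutativeRing ι
ι-hom = record
  { isNearSemiringHomomorphism = record
    { +-isMonoidHomomorphism = record
      { isMagmaHomomorphism = record
        { isRelHomomorphism = record { cong = ≡.cong ι }
        ; homo = ι-+
        }
      ; ε-homo = ≡.refl
      }
    ; *-homo = ι-*
    }
  ; 1#-homo = ≡.refl
  }

ι-neg : ∀ z → ι (ℤ.- z) ≡ ℚ.- ι z
ι-neg = IntegralHom.c-neg ℚₚ.+-*-commutativeRing ι-hom

ι-↧-* : ∀ p → ι (↧ p) ℚ.* p ≡ ι (↥ p)
ι-↧-* p@(mkℚ n d-1 _) = ℚₚ.toℚᵘ-injective (begin
  ℚ.toℚᵘ (ι (+ suc d-1) ℚ.* p)                     ≈⟨ ℚₚ.toℚᵘ-homo-* (ι (+ suc d-1)) p ⟩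
  ℚ.toℚᵘ (ι (+ suc d-1)) ℚᵘ.* ℚ.toℚᵘ p             ≈⟨ ℚᵘₚ.*-congʳ (toℚᵘ-ι (+ suc d-1)) ⟩
  ℚᵘ.mkℚᵘ (+ suc d-1) 0 ℚᵘ.* ℚᵘ.mkℚᵘ n d-1
    ≈⟨ ℚᵘ.*≡* (solve 2 (λ d n → d :* n :* con (+ 1) := n :* (con (+ 1) :* d)) ≡.refl (+ suc d-1) n) ⟩
  ℚᵘ.mkℚᵘ n 0                                      ≈⟨ toℚᵘ-ι n ⟨
  ℚ.toℚᵘ (ι n)                                     ∎)
  where
  open SetoidReasoning ℚᵘₚ.≃-setoid
  open ℤSolver.+-*-Solver using (solve; _:=_; _:*_; con)

-- With p = n/d in lowest terms, D n = z d, and d is coprime to n.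
↧ₙ-∣ : ∀ D {p z} → ι D ℚ.* p ≡ ι z → ↧ₙ p ∣ ℤ.∣ D ∣
↧ₙ-∣ D {p@(mkℚ n d-1 n⊥d)} {z} Dp≡z = Coprimality.coprime-divisor {suc d-1} {ℤ.∣ n ∣} {ℤ.∣ D ∣}
  (Coprimality.sym (Coprimality.recompute n⊥d)) (divides ℤ.∣ z ∣ (begin
    ℤ.∣ n ∣ ℕ.* ℤ.∣ D ∣      ≡⟨ ℕₚ.*-comm ℤ.∣ n ∣ ℤ.∣ D ∣ ⟩
    ℤ.∣ D ∣ ℕ.* ℤ.∣ n ∣      ≡⟨ ℤₚ.abs-* D n ⟨
    ℤ.∣ D ℤ.* n ∣            ≡⟨ ≡.cong ℤ.∣_∣ (ι-injective {D ℤ.* n} {z ℤ.* ↧ p} Dn≡zd) ⟩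
    ℤ.∣ z ℤ.* + suc d-1 ∣    ≡⟨ ℤₚ.abs-* z (+ suc d-1) ⟩
    ℤ.∣ z ∣ ℕ.* suc d-1      ∎))
  where
  open ≡.≡-Reasoning
  Dn≡zd : ι (D ℤ.* n) ≡ ι (z ℤ.* ↧ p)
  Dn≡zd = begin
    ι (D ℤ.* n)               ≡⟨ ι-* D n ⟩
    ι D ℚ.* ι n               ≡⟨ ≡.cong (ℚ._*_ (ι D)) (ι-↧-* p) ⟨
    ι D ℚ.* (ι (↧ p) ℚ.* p)   ≡⟨ x∙yz≈xz∙y (ι D) (ι (↧ p)) p ⟩
    ι D ℚ.* p ℚ.* ι (↧ p)     ≡⟨ ≡.cong (ℚ._* ι (↧ p)) Dp≡z ⟩
    ι z ℚ.* ι (↧ p)           ≡⟨ ι-* z (↧ p) ⟨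
    ι (z ℤ.* ↧ p)             ∎
    where open import Algebra.Properties.CommutativeSemigroup ℚᴿ.*-commutativeSemigroup using (x∙yz≈xz∙y)

Coprime-∣ : ∀ {d k m} → d ∣ k → Coprime k m → Coprime d m
Coprime-∣ d∣k k⊥m (e∣d , e∣m) = k⊥m (∣.∣-trans e∣d d∣k , e∣m)

Coprime-* : ∀ {k l m} → Coprime k m → Coprime l m → Coprime (k ℕ.* l) m
Coprime-* k⊥m l⊥m {d} (d∣kl , d∣m) =
  l⊥m (Coprimality.coprime-divisor (λ (e∣d , e∣k) → k⊥m (e∣k , ∣.∣-trans e∣d d∣m)) d∣kl , d∣m)

Coprime-^ : ∀ {k m} → Coprime k m → ∀ n → Coprime (k ℕ.^ n) m
Coprime-^ {m = m} k⊥m zero    = Coprimality.1-coprimeTo m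
Coprime-^ k⊥m (suc n) = Coprime-* k⊥m (Coprime-^ k⊥m n)

-- In both directions D is a common denominator, so that the congruence can be read off in ℤ.
module _ {m : ℕ} {D : ℤ} {ε : ℚ} (Dε≡1 : ι D ℚ.* ε ≡ 1ℚ) (D⊥m : Coprime ℤ.∣ D ∣ m)
         {p : ℚ} {z c : ℤ} (p≡εz : p ≡ ε ℚ.* ι z) where
  open ≡.≡-Reasoning
  open SemiringSolver ℚ-commutativeSemiring using (solve; _:=_; _:+_; _:*_)

  private
    cancel-D : ∀ x → ι D ℚ.* (ε ℚ.* x) ≡ x
    cancel-D x = ≡.trans (≡.sym (ℚₚ.*-assoc (ι D) ε x)) (≡.trans (≡.cong (ℚ._* x) Dε≡1) (ℚₚ.*-identityˡ x))

    Dp≡z : ι D ℚ.* p ≡ ι z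
    Dp≡z = ≡.trans (≡.cong (ι D ℚ.*_) p≡εz) (cancel-D (ι z))

    prime-to-m : ∀ {q x} → ι D ℚ.* q ≡ ι x → PrimeToDenominator m q
    prime-to-m {q} {x} Dq≡x = Coprime-∣ (↧ₙ-∣ D {q} {x} Dq≡x) D⊥m

  congruentℤ⇒congruentℚ : ∃[ t ] z ≡ D ℤ.* c ℤ.+ + m ℤ.* t → p ≡ ι c [modℚ m ]
  congruentℤ⇒congruentℚ (t , z≡Dc+mt) =
    prime-to-m {p} {z} Dp≡z , prime-to-m {ι c} {D ℤ.* c} (≡.sym (ι-* D c)) ,
    ε ℚ.* ι t , prime-to-m {ε ℚ.* ι t} {t} (cancel-D (ι t)) , (begin
      p ℚ.- ι c                                           ≡⟨ ≡.cong (ℚ._- ι c) p≡ ⟩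
      ι (+ m) ℚ.* (ε ℚ.* ι t) ℚ.+ ι c ℚ.- ι c             ≡⟨ ℚₚ.+-assoc (ι (+ m) ℚ.* (ε ℚ.* ι t)) (ι c) (ℚ.- ι c) ⟩
      ι (+ m) ℚ.* (ε ℚ.* ι t) ℚ.+ (ι c ℚ.- ι c)           ≡⟨ ≡.cong (ι (+ m) ℚ.* (ε ℚ.* ι t) ℚ.+_) (ℚₚ.+-inverseʳ (ι c)) ⟩
      ι (+ m) ℚ.* (ε ℚ.* ι t) ℚ.+ 0ℚ                      ≡⟨ ℚₚ.+-identityʳ _ ⟩
      ι (+ m) ℚ.* (ε ℚ.* ι t)                             ∎)
    where
    p≡ : p ≡ ι (+ m) ℚ.* (ε ℚ.* ι t) ℚ.+ ι c
    p≡ = begin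
      p                                                   ≡⟨ p≡εz ⟩
      ε ℚ.* ι z                                           ≡⟨ ≡.cong (λ x → ε ℚ.* ι x) z≡Dc+mt ⟩
      ε ℚ.* ι (D ℤ.* c ℤ.+ + m ℤ.* t)
        ≡⟨ ≡.cong (ε ℚ.*_) (≡.trans (ι-+ (D ℤ.* c) (+ m ℤ.* t)) (≡.cong₂ ℚ._+_ (ι-* D c) (ι-* (+ m) t))) ⟩
      ε ℚ.* (ι D ℚ.* ι c ℚ.+ ι (+ m) ℚ.* ι t)
        ≡⟨ solve 5 (λ e d c m t → e :* (d :* c :+ m :* t) := m :* (e :* t) :+ d :* (e :* c)) ≡.refl ε (ι D) (ι c) (ι (+ m)) (ι t) ⟩
      ι (+ m) ℚ.* (ε ℚ.* ι t) ℚ.+ ι D ℚ.* (ε ℚ.* ι c)     ≡⟨ ≡.cong (ι (+ m) ℚ.* (ε ℚ.* ι t) ℚ.+_) (cancel-D (ι c)) ⟩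
      ι (+ m) ℚ.* (ε ℚ.* ι t) ℚ.+ ι c                     ∎

  congruentℚ⇒congruentℤ : p ≡ ι c [modℚ m ] → ∃[ t ] z ≡ D ℤ.* c ℤ.+ + m ℤ.* t
  congruentℚ⇒congruentℤ (_ , _ , t , t⊥m , p-c≡mt) = ↥ P , ι-injective {z} {D ℤ.* c ℤ.+ + m ℤ.* ↥ P} (begin
    ι z                                        ≡⟨ Dp≡z ⟨
    ι D ℚ.* p                                  ≡⟨ ≡.cong (ι D ℚ.*_) p≡ ⟩
    ι D ℚ.* (ι c ℚ.+ ι (+ m) ℚ.* t)            ≡⟨ solve 4 (λ d c m t → d :* (c :+ m :* t) := d :* c :+ m :* (d :* t)) ≡.refl (ι D) (ι c) (ι (+ m)) t ⟩
    ι D ℚ.* ι c ℚ.+ ι (+ m) ℚ.* P              ≡⟨ ≡.cong₂ (λ x y → x ℚ.+ ι (+ m) ℚ.* y) (≡.sym (ι-* D c)) P≡ι↥P ⟩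
    ι (D ℤ.* c) ℚ.+ ι (+ m) ℚ.* ι (↥ P)        ≡⟨ ≡.cong (ι (D ℤ.* c) ℚ.+_) (ι-* (+ m) (↥ P)) ⟨
    ι (D ℤ.* c) ℚ.+ ι (+ m ℤ.* ↥ P)            ≡⟨ ι-+ (D ℤ.* c) (+ m ℤ.* ↥ P) ⟨
    ι (D ℤ.* c ℤ.+ + m ℤ.* ↥ P)                ∎)
    where
    P : ℚ
    P = ι D ℚ.* t
    p≡ : p ≡ ι c ℚ.+ ι (+ m) ℚ.* t
    p≡ = begin
      p                              ≡⟨ ℚₚ.+-identityʳ p ⟨
      p ℚ.+ 0ℚ                       ≡⟨ ≡.cong (p ℚ.+_) (ℚₚ.+-inverseˡ (ι c)) ⟨
      p ℚ.+ (ℚ.- ι c ℚ.+ ι c)        ≡⟨ ℚₚ.+-assoc p (ℚ.- ι c) (ι c) ⟨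
      p ℚ.- ι c ℚ.+ ι c              ≡⟨ ≡.cong (ℚ._+ ι c) p-c≡mt ⟩
      ι (+ m) ℚ.* t ℚ.+ ι c          ≡⟨ ℚₚ.+-comm (ι (+ m) ℚ.* t) (ι c) ⟩
      ι c ℚ.+ ι (+ m) ℚ.* t          ∎
    mP≡ : ι (+ m) ℚ.* P ≡ ι (z ℤ.- D ℤ.* c)
    mP≡ = begin
      ι (+ m) ℚ.* P                                                 ≡⟨ ℚₚ.+-identityʳ _ ⟨
      ι (+ m) ℚ.* P ℚ.+ 0ℚ                                          ≡⟨ ≡.cong (ι (+ m) ℚ.* P ℚ.+_) (ℚₚ.+-inverseʳ (ι D ℚ.* ι c)) ⟨
      ι (+ m) ℚ.* P ℚ.+ (ι D ℚ.* ι c ℚ.- ι D ℚ.* ι c)               ≡⟨ ℚₚ.+-assoc (ι (+ m) ℚ.* P) (ι D ℚ.* ι c) _ ⟨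
      ι (+ m) ℚ.* P ℚ.+ ι D ℚ.* ι c ℚ.- ι D ℚ.* ι c
        ≡⟨ ≡.cong (ℚ._- ι D ℚ.* ι c) (solve 4 (λ d c m t → m :* (d :* t) :+ d :* c := d :* (c :+ m :* t)) ≡.refl (ι D) (ι c) (ι (+ m)) t) ⟩
      ι D ℚ.* (ι c ℚ.+ ι (+ m) ℚ.* t) ℚ.- ι D ℚ.* ι c               ≡⟨ ≡.cong (λ x → ι D ℚ.* x ℚ.- ι D ℚ.* ι c) p≡ ⟨
      ι D ℚ.* p ℚ.- ι D ℚ.* ι c                                     ≡⟨ ≡.cong₂ (λ x y → x ℚ.- y) Dp≡z (≡.sym (ι-* D c)) ⟩
      ι z ℚ.- ι (D ℤ.* c)                                           ≡⟨ ≡.cong (ι z ℚ.+_) (ι-neg (D ℤ.* c)) ⟨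
      ι z ℚ.+ ι (ℤ.- (D ℤ.* c))                                     ≡⟨ ι-+ z (ℤ.- (D ℤ.* c)) ⟨
      ι (z ℤ.- D ℤ.* c)                                             ∎
    ↧tP≡ : ι (↧ t) ℚ.* P ≡ ι (D ℤ.* ↥ t)
    ↧tP≡ = begin
      ι (↧ t) ℚ.* (ι D ℚ.* t)  ≡⟨ solve 3 (λ a d t → a :* (d :* t) := d :* (a :* t)) ≡.refl (ι (↧ t)) (ι D) t ⟩
      ι D ℚ.* (ι (↧ t) ℚ.* t)  ≡⟨ ≡.cong (ι D ℚ.*_) (ι-↧-* t) ⟩
      ι D ℚ.* ι (↥ t)          ≡⟨ ι-* D (↥ t) ⟨
      ι (D ℤ.* ↥ t)            ∎
    -- The denominator of P = D t divides that of t, which is prime to m. It also divides m, because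
    -- m P is an integer.
    ↧P≡1 : ↧ₙ P ≡ 1
    ↧P≡1 = t⊥m (↧ₙ-∣ (↧ t) {P} {D ℤ.* ↥ t} ↧tP≡ , ↧ₙ-∣ (+ m) {P} {z ℤ.- D ℤ.* c} mP≡)
    P≡ι↥P : P ≡ ι (↥ P)
    P≡ι↥P = begin
      P                    ≡⟨ ℚₚ.*-identityˡ P ⟨
      ι (+ 1) ℚ.* P        ≡⟨ ≡.cong (λ d → ι (+ d) ℚ.* P) ↧P≡1 ⟨
      ι (↧ P) ℚ.* P        ≡⟨ ι-↧-* P ⟩
      ι (↥ P)              ∎

-- The field ℚ(ζ₁₄)

module HornerHom (R S : CommutativeRing 0ℓ 0ℓ) {f : CommutativeRing.Carrier R → CommutativeRing.Carrier S}
                 (f-hom : IsHom R S f) {n} {T : Vec (CommutativeRing.Carrier R) n → Vec (CommutativeRing.Carrier R) n}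
                 {T′ : Vec (CommutativeRing.Carrier S) n → Vec (CommutativeRing.Carrier S) n}
                 (T-linear : Vectors.IsLinear R T) (T′-linear : Vectors.IsLinear S T′)
                 (T-natural : ∀ v → Vectors._≋_ S (Vec.map f (T v)) (T′ (Vec.map f v))) where
  open Vectors S
  private
    module V = Vectors R
    module H = Cyclic R T T-linear
    module H′ = Cyclic S T′ T′-linear
    module T′ = IsLinear T′-linear
  open IsSemiringHomomorphism f-hom

  map-𝟘 : ∀ n → Vec.map f (V.𝟘 {n}) ≋ 𝟘
  map-𝟘 zero    = []
  map-𝟘 (suc n) = 0#-homo ∷ map-𝟘 n

  map-⊕ : ∀ {n} (u v : Vec (CommutativeRing.Carrier R) n) → Vec.map f (u V.⊕ v) ≋ Vec.map f u ⊕ Vec.map f v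
  map-⊕ []      []      = []
  map-⊕ (x ∷ u) (y ∷ v) = +-homo x y ∷ map-⊕ u v

  map-· : ∀ {n} s (v : Vec (CommutativeRing.Carrier R) n) → Vec.map f (s V.· v) ≋ f s · Vec.map f v
  map-· s []      = []
  map-· s (x ∷ v) = *-homo s x ∷ map-· s v

  map-horner : ∀ {k} (a : Vec (CommutativeRing.Carrier R) k) b → Vec.map f (H.horner a b) ≋ H′.horner (Vec.map f a) (Vec.map f b)
  map-horner []      b = map-𝟘 n
  map-horner (x ∷ a) b = ≋-trans (map-⊕ (x V.· b) (T (H.horner a b)))
    (⊕-cong (map-· x b) (≋-trans (T-natural (H.horner a b)) (T′.cong (map-horner a b))))

private
  module ℚᵛ = Vectors ℚₚ.+-*-commutativeRing
  module ℚX = CyclotomicCompanion ℚₚ.+-*-commutativeRing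

  ζ·≡X· : ∀ v → ζ· v ≡ ℚX.X· v
  ζ·≡X· (a₀ ∷ a₁ ∷ a₂ ∷ a₃ ∷ a₄ ∷ a₅ ∷ []) = ≡.refl

  ζ·-linear : ℚᵛ.IsLinear ζ·_
  ζ·-linear = record
    { cong = λ {u} {v} u≋v → transport₂ u v (ℚᵛ.IsLinear.cong ℚX.X·-linear u≋v)
    ; ⊕-homo = λ u v → ≡.subst₂ ℚᵛ._≋_ (≡.sym (ζ·≡X· (u ℚᵛ.⊕ v))) (≡.sym (≡.cong₂ ℚᵛ._⊕_ (ζ·≡X· u) (ζ·≡X· v)))
                 (ℚᵛ.IsLinear.⊕-homo ℚX.X·-linear u v)
    ; ·-homo = λ s v → ≡.subst₂ ℚᵛ._≋_ (≡.sym (ζ·≡X· (s ℚᵛ.· v))) (≡.sym (≡.cong (s ℚᵛ.·_) (ζ·≡X· v)))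
                 (ℚᵛ.IsLinear.·-homo ℚX.X·-linear s v)
    }
    where
    transport₂ : ∀ u v → ℚX.X· u ℚᵛ.≋ ℚX.X· v → ζ· u ℚᵛ.≋ ζ· v
    transport₂ u v = ≡.subst₂ ℚᵛ._≋_ (≡.sym (ζ·≡X· u)) (≡.sym (ζ·≡X· v))

  ι-ζ· : ∀ v → Vec.map ι (OX.X· v) ℚᵛ.≋ ζ· (Vec.map ι v)
  ι-ζ· (a₀ ∷ a₁ ∷ a₂ ∷ a₃ ∷ a₄ ∷ a₅ ∷ []) =
    ι-neg a₅ ∷ ι-+ a₀ a₅ ∷ ι-- a₁ a₅ ∷ ι-+ a₂ a₅ ∷ ι-- a₃ a₅ ∷ ι-+ a₄ a₅ ∷ []
    where
    ι-- : ∀ x y → ι (x ℤ.- y) ≡ ι x ℚ.- ι y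
    ι-- x y = ≡.trans (ι-+ x (ℤ.- y)) (≡.cong (ι x ℚ.+_) (ι-neg y))

  module ℚC = Cyclic ℚₚ.+-*-commutativeRing ζ·_ ζ·-linear
  module ιH = HornerHom ℤₚ.+-*-commutativeRing ℚₚ.+-*-commutativeRing ι-hom {T = OX.X·_} {ζ·_} OX.X·-linear ζ·-linear ι-ζ·

  ≋⇒≡ : ∀ {n} {u v : Vec ℚ n} → u ℚᵛ.≋ v → u ≡ v
  ≋⇒≡ = Pointwise.Pointwise-≡⇒≡

-- Elements of K are kept as one rational scalar times an integral vector, so that the denominators
-- of powers of α are tracked apart from the arithmetic of ℤ[ζ].
emb : ∀ {n} → ℚ → Vec ℤ n → Vec ℚ n
emb q x = q ℚᵛ.· Vec.map ι x

emb-+ : ∀ q x y → emb q x + emb q y ≡ emb q (x O.+ y)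
emb-+ q x y = ≋⇒≡ (ℚᵛ.≋-trans (ℚᵛ.≋-sym (ℚᵛ.·-distribˡ q (Vec.map ι x) (Vec.map ι y)))
  (ℚᵛ.·-cong {s = q} ≡.refl (ℚᵛ.≋-sym (ιH.map-⊕ x y))))

emb-* : ∀ q r x y → emb q x * emb r y ≡ emb (q ℚ.* r) (x O.* y)
emb-* q r x y = ≋⇒≡ (begin
  ℚC.horner (emb q x) (emb r y)                           ≈⟨ ℚC.horner-·ˡ q (Vec.map ι x) (emb r y) ⟩
  q ℚᵛ.· ℚC.horner (Vec.map ι x) (emb r y)                ≈⟨ ℚᵛ.·-cong {s = q} ≡.refl (ℚC.horner-·ʳ r (Vec.map ι x) (Vec.map ι y)) ⟩
  q ℚᵛ.· r ℚᵛ.· ℚC.horner (Vec.map ι x) (Vec.map ι y)     ≈⟨ ℚᵛ.·-assoc q r _ ⟨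
  (q ℚ.* r) ℚᵛ.· ℚC.horner (Vec.map ι x) (Vec.map ι y)    ≈⟨ ℚᵛ.·-cong {s = q ℚ.* r} ≡.refl (ιH.map-horner x y) ⟨
  emb (q ℚ.* r) (x O.* y)                                 ∎)
  where open SetoidReasoning (ℚᵛ.≋-setoid {6})

module ℚ^ = Powers ℚₚ.+-*-commutativeRing

emb-^ : ∀ q x n → emb q x ^ n ≡ emb (q ℚ^.^ n) (x O.^ n)
emb-^ q x zero    = ≡.refl
emb-^ q x (suc n) = ≡.trans (≡.cong (emb q x *_) (emb-^ q x n)) (emb-* q (q ℚ^.^ n) x (x O.^ n))

emb-const : ∀ q z → emb q (O.const z) ≡ fromℚ (q ℚ.* ι z)
emb-const q z = ≋⇒≡ (≡.refl ∷ ℚᵛ.·-zeroʳ q)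

-- On both sides the automorphism is a Horner evaluation at the image of ζ, so it is enough to
-- compare that image.
emb-⟨$⟩ : ∀ σ {η} → ζ₁₄ ^ residue σ ≡ emb 1ℚ η → ∀ q x → σ ⟨$⟩ emb q x ≡ emb q (σᴼ.eval η x)
emb-⟨$⟩ σ {η} ζ^≡η q x = helper x
  where
  helper : ∀ {k} (x : Vec ℤ k) → Vec.foldr′ (λ aᵢ acc → fromℚ aᵢ + (ζ₁₄ ^ residue σ) * acc) 0# (emb q x) ≡ emb q (σᴼ.eval η x)
  helper []      = ≋⇒≡ (ℚᵛ.≋-sym (ℚᵛ.·-zeroʳ q))
  helper (z ∷ x) = ≡.trans
    (≡.cong₂ _+_ (≡.sym (emb-const q z)) (≡.trans (≡.cong₂ _*_ ζ^≡η (helper x))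
      (≡.trans (emb-* 1ℚ q η (σᴼ.eval η x)) (≡.cong (λ r → emb r (η O.* σᴼ.eval η x)) (ℚₚ.*-identityˡ q)))))
    (emb-+ q (O.const z) (η O.* σᴼ.eval η x))

opaque
  unfolding η₃

  ζ^residue-σ₃ : ζ₁₄ ^ residue σ₃ ≡ emb 1ℚ η₃
  ζ^residue-σ₃ = toWitness {a? = Vecₚ.≡-dec ℚₚ._≟_ _ _} tt

  ζ^residue-σ₅ : ζ₁₄ ^ residue σ₅ ≡ emb 1ℚ η₅
  ζ^residue-σ₅ = toWitness {a? = Vecₚ.≡-dec ℚₚ._≟_ _ _} tt

  ζ^residue-σ₁₃ : ζ₁₄ ^ residue σ₁₃ ≡ emb 1ℚ η₁₃
  ζ^residue-σ₁₃ = toWitness {a? = Vecₚ.≡-dec ℚₚ._≟_ _ _} tt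

opaque
  unfolding b 29⁹

  ε : ℚ
  ε = + 1 ℚ./ 14507145975869

  29⁹ε≡1 : ι 29⁹ ℚ.* ε ≡ 1ℚ
  29⁹ε≡1 = toWitness {a? = _ ℚₚ.≟ _} tt

  ∣29⁹∣≡29^9 : ℤ.∣ 29⁹ ∣ ≡ 29 ℕ.^ 9
  ∣29⁹∣≡29^9 = ≡.refl

  -- The quotient and the group-ring power in α are evaluated here by decision; from now on α is
  -- handled through `ε` and `b`.
  α≡εb : α ≡ emb ε b
  α≡εb = toWitness {a? = Vecₚ.≡-dec ℚₚ._≟_ _ _} tt

δ : ℕ → ℚ
δ N = ε ℚ^.^ N

Dℤ : ℕ → ℤ
Dℤ N = 29⁹ ℤ.^ N

Dℤδ≡1 : ∀ N → ι (Dℤ N) ℚ.* δ N ≡ 1ℚ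
Dℤδ≡1 N = ≡.trans (≡.cong (ℚ._* δ N) (IntegralHom.c-^ ℚₚ.+-*-commutativeRing ι-hom 29⁹ N)) (ℚ^.unit^ 29⁹ε≡1 N)

Dᴼ≈ : ∀ N → O.const (Dℤ N) O.≈ Dᴼ N
Dᴼ≈ = IntegralHom.c-^ Oᴬ.extension O.const-hom 29⁹

-- Stated for a variable a, since the type checker would otherwise evaluate conj α.
trace-power : ∀ {a q x} → a ≡ emb q x → ∀ N → a ^ N + conj a ^ N ≡ emb (q ℚ^.^ N) (x O.^ N O.+ τᴼ x O.^ N)
trace-power {_} {q} {x} ≡.refl N = ≡.trans
  (≡.cong₂ _+_ (emb-^ q x N) (≡.trans (≡.cong (_^ N) (emb-⟨$⟩ σ₁₃ ζ^residue-σ₁₃ q x)) (emb-^ q (τᴼ x) N)))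
  (emb-+ (q ℚ^.^ N) (x O.^ N) (τᴼ x O.^ N))

module SymmetricFunctions (k : ℕ) where
  private
    N = 14 ℕ.^ k
    y = yᴼ N
    d = δ N

  α₁≡ : α₁ k ≡ emb d y
  α₁≡ = trace-power α≡εb N

  α₂≡ : α₂ k ≡ emb d (σ₃ᴼ y)
  α₂≡ = ≡.trans (≡.cong (σ₃ ⟨$⟩_) α₁≡) (emb-⟨$⟩ σ₃ ζ^residue-σ₃ d y)

  α₃≡ : α₃ k ≡ emb d (σ₅ᴼ y)
  α₃≡ = ≡.trans (≡.cong (σ₅ ⟨$⟩_) α₁≡) (emb-⟨$⟩ σ₅ ζ^residue-σ₅ d y)

  S⁽¹⁾≡ : S⁽¹⁾ k ≡ emb d (Pᴼ.e₁ y)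
  S⁽¹⁾≡ = ≡.trans (≡.cong₂ _+_ (≡.trans (≡.cong₂ _+_ α₁≡ α₂≡) (emb-+ d y (σ₃ᴼ y))) α₃≡)
                  (emb-+ d (y O.+ σ₃ᴼ y) (σ₅ᴼ y))

  S⁽²⁾≡ : S⁽²⁾ k ≡ emb (d ℚ.* d) (Pᴼ.e₂ y)
  S⁽²⁾≡ = ≡.trans
    (≡.cong₂ _+_ (≡.trans (≡.cong₂ _+_ (≡.trans (≡.cong₂ _*_ α₁≡ α₂≡) (emb-* d d y (σ₃ᴼ y)))
                                       (≡.trans (≡.cong₂ _*_ α₁≡ α₃≡) (emb-* d d y (σ₅ᴼ y))))
                          (emb-+ (d ℚ.* d) (y O.* σ₃ᴼ y) (y O.* σ₅ᴼ y)))
                 (≡.trans (≡.cong₂ _*_ α₂≡ α₃≡) (emb-* d d (σ₃ᴼ y) (σ₅ᴼ y))))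
    (emb-+ (d ℚ.* d) (y O.* σ₃ᴼ y O.+ y O.* σ₅ᴼ y) (σ₃ᴼ y O.* σ₅ᴼ y))

  S⁽³⁾≡ : S⁽³⁾ k ≡ emb (d ℚ.* d ℚ.* d) (Pᴼ.e₃ y)
  S⁽³⁾≡ = ≡.trans (≡.cong₂ _*_ (≡.trans (≡.cong₂ _*_ α₁≡ α₂≡) (emb-* d d y (σ₃ᴼ y))) α₃≡)
                  (emb-* (d ℚ.* d) d (y O.* σ₃ᴼ y) (σ₅ᴼ y))

  private
    y≈ : b O.^ N O.+ τᴼ (b O.^ N) O.≈ y
    y≈ = O.+-congˡ {b O.^ N} (HomPowers.^-homo Oᴬ.extension Oᴬ.extension τ-hom b N)

    -- `y` is first rewritten in the form x + τ x with x = b^N, on which the symmetric functions are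
    -- known to be fixed by σ₃.
    rational : ∀ {f : O.Carrier → O.Carrier} → (∀ {u v} → u O.≈ v → f u O.≈ f v) →
               (∀ x → σ₃ᴼ (f (x O.+ τᴼ x)) O.≈ f (x O.+ τᴼ x)) → f y O.≈ O.const (Vec.head (f y))
    rational {f} f-cong f-fixed = σ₃-fixed⇒rational {f y}
      (O.trans (IsSemiringHomomorphism.⟦⟧-cong σ₃-hom (f-cong (O.sym y≈))) (O.trans (f-fixed (b O.^ N)) (f-cong y≈)))

  e₁-rational : Pᴼ.e₁ y O.≈ O.const (Vec.head (Pᴼ.e₁ y))
  e₁-rational = rational {Pᴼ.e₁} Pᴼ.e₁-cong (Pᴼ.e₁-fixed σ₃σ₃≈σ₅τ ττ≈id σ₃σ₅≈id)

  e₂-rational : Pᴼ.e₂ y O.≈ O.const (Vec.head (Pᴼ.e₂ y))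
  e₂-rational = rational {Pᴼ.e₂} Pᴼ.e₂-cong (Pᴼ.e₂-fixed σ₃σ₃≈σ₅τ ττ≈id σ₃σ₅≈id)

  e₃-rational : Pᴼ.e₃ y O.≈ O.const (Vec.head (Pᴼ.e₃ y))
  e₃-rational = rational {Pᴼ.e₃} Pᴼ.e₃-cong (Pᴼ.e₃-fixed σ₃σ₃≈σ₅τ ττ≈id σ₃σ₅≈id)

module Transfer {m : ℕ} {D : ℤ} {d : ℚ} (Dd≡1 : ι D ℚ.* d ≡ 1ℚ) (D⊥m : Coprime ℤ.∣ D ∣ m)
                {s : K} {x : O.Carrier} (s≡dx : s ≡ emb d x) (c : ℤ) where
  open OMod m
  open OModProperties m
  private module constᴹ = IsSemiringHomomorphism const-hom

  ≅⇒mod : x O.≈ O.const (Vec.head x) → x ≅ O.const (D ℤ.* c) → s ≡ c [mod m ]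
  ≅⇒mod x-rational x≅Dc = d ℚ.* ι (Vec.head x) ,
    ≡.trans s≡dx (≡.trans (≡.cong (emb d) (Pointwise.Pointwise-≡⇒≡ x-rational)) (emb-const d (Vec.head x))) ,
    congruentℤ⇒congruentℚ {m} {D} {d} Dd≡1 D⊥m {z = Vec.head x} {c} ≡.refl (head-cong x≅Dc)

  private
    cancel-d : ∀ {z} → d ℚ.* ι z ≡ 0ℚ → z ≡ + 0
    cancel-d {z} dz≡0 = ι-injective {z} {+ 0} (begin
      ι z                       ≡⟨ ℚₚ.*-identityˡ (ι z) ⟨
      1ℚ ℚ.* ι z                ≡⟨ ≡.cong (ℚ._* ι z) Dd≡1 ⟨
      ι D ℚ.* d ℚ.* ι z         ≡⟨ ℚₚ.*-assoc (ι D) d (ι z) ⟩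
      ι D ℚ.* (d ℚ.* ι z)       ≡⟨ ≡.cong (ι D ℚ.*_) dz≡0 ⟩
      ι D ℚ.* 0ℚ                ≡⟨ ℚₚ.*-zeroʳ (ι D) ⟩
      0ℚ                        ∎)
      where open ≡.≡-Reasoning

    coordinates : ∀ {x : O.Carrier} {q} → emb d x ≡ fromℚ q → q ≡ d ℚ.* ι (Vec.head x) × x ≡ O.const (Vec.head x)
    coordinates {x₀ ∷ x₁ ∷ x₂ ∷ x₃ ∷ x₄ ∷ x₅ ∷ []} {q} dx≡q with Pointwise.≡⇒Pointwise-≡ dx≡q
    ... | p₀ ∷ p₁ ∷ p₂ ∷ p₃ ∷ p₄ ∷ p₅ ∷ [] = ≡.sym p₀ ,
      Pointwise.Pointwise-≡⇒≡ (≡.refl ∷ cancel-d p₁ ∷ cancel-d p₂ ∷ cancel-d p₃ ∷ cancel-d p₄ ∷ cancel-d p₅ ∷ [])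

  mod⇒≅ : s ≡ c [mod m ] → x ≅ O.const (D ℤ.* c)
  mod⇒≅ (q , s≡q , q≡c) = B.trans (B.reflexive x≡x₀) (B.trans (constᴹ.⟦⟧-cong x₀≡Dc+mt)
    (B.trans (constᴹ.+-homo (D ℤ.* c) (+ m ℤ.* t)) (B.trans (B.+-congˡ {O.const (D ℤ.* c)} (B.trans (constᴹ.*-homo (+ m) t)
      (B.trans (B.*-congʳ {O.const t} m≅0) (B.zeroˡ (O.const t))))) (B.+-identityʳ (O.const (D ℤ.* c))))))
    where
    q≡ = proj₁ (coordinates {x} (≡.trans (≡.sym s≡dx) s≡q))
    x≡x₀ = proj₂ (coordinates {x} (≡.trans (≡.sym s≡dx) s≡q))
    witness = congruentℚ⇒congruentℤ {m} {D} {d} Dd≡1 D⊥m {q} {Vec.head x} {c} q≡ q≡c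
    t = proj₁ witness
    x₀≡Dc+mt = proj₂ witness

-- The criterion

SConditions : ℕ → ℕ → ℤ → Set
SConditions m k s = (S⁽¹⁾ k ≡ s [mod m ]) × (S⁽²⁾ k ≡ -[1+ 1 ] [mod m ]) × (S⁽³⁾ k ≡ ℤ.- s [mod m ])

module Equivalence (m k : ℕ) (29⊥m : Coprime 29 m) where
  open OMod m
  open SymmetricFunctions k
  private
    N = 14 ℕ.^ k
    D = Dℤ N
    d = δ N

    ι-*-inverse : ∀ {x y p q} → ι x ℚ.* p ≡ 1ℚ → ι y ℚ.* q ≡ 1ℚ → ι (x ℤ.* y) ℚ.* (p ℚ.* q) ≡ 1ℚ
    ι-*-inverse {x} {y} {p} {q} xp≡1 yq≡1 = ≡.trans (≡.cong (ℚ._* (p ℚ.* q)) (ι-* x y))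
      (≡.trans (interchange (ι x) (ι y) p q) (≡.cong₂ ℚ._*_ xp≡1 yq≡1))
      where open import Algebra.Properties.CommutativeSemigroup (CommutativeRing.*-commutativeSemigroup ℚₚ.+-*-commutativeRing) using (interchange)

    ∣^∣ : ∀ z n → ℤ.∣ z ℤ.^ n ∣ ≡ ℤ.∣ z ∣ ℕ.^ n
    ∣^∣ z zero    = ≡.refl
    ∣^∣ z (suc n) = ≡.trans (ℤₚ.abs-* z (z ℤ.^ n)) (≡.cong (ℤ.∣ z ∣ ℕ.*_) (∣^∣ z n))

    ∣*∣-coprime : ∀ x y → Coprime ℤ.∣ x ∣ m → Coprime ℤ.∣ y ∣ m → Coprime ℤ.∣ x ℤ.* y ∣ m
    ∣*∣-coprime x y x⊥m y⊥m = ≡.subst (λ n → Coprime n m) (≡.sym (ℤₚ.abs-* x y)) (Coprime-* x⊥m y⊥m)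

    Dd≡1 = Dℤδ≡1 N
    -- S⁽ⁱ⁾ is homogeneous of degree i in the periods, so Dⁱ is its denominator.
    D²d²≡1 = ι-*-inverse {D} {D} {d} {d} Dd≡1 Dd≡1
    D³d³≡1 = ι-*-inverse {D ℤ.* D} {D} {d ℚ.* d} {d} D²d²≡1 Dd≡1

    D⊥m : Coprime ℤ.∣ D ∣ m
    D⊥m = ≡.subst (λ n → Coprime n m) (≡.sym (≡.trans (∣^∣ 29⁹ N) (≡.cong (ℕ._^ N) ∣29⁹∣≡29^9)))
      (Coprime-^ (Coprime-^ 29⊥m 9) N)
    D²⊥m = ∣*∣-coprime D D D⊥m D⊥m
    D³⊥m = ∣*∣-coprime (D ℤ.* D) D D²⊥m D⊥m

    module const = IsSemiringHomomorphism O.const-hom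

    D≈ = Dᴼ≈ N
    D²≈ : O.const (D ℤ.* D) O.≈ Dᴼ N O.* Dᴼ N
    D²≈ = O.trans (const.*-homo D D) (O.*-cong D≈ D≈)
    D³≈ : O.const (D ℤ.* D ℤ.* D) O.≈ Dᴼ N O.* Dᴼ N O.* Dᴼ N
    D³≈ = O.trans (const.*-homo (D ℤ.* D) D) (O.*-cong D²≈ D≈)

    const-scaled : ∀ {E Eᴼ} → O.const E O.≈ Eᴼ → ∀ c → O.const (E ℤ.* c) ≅ Eᴼ O.* O.const c
    const-scaled {E} E≈ c = ≈⇒≅ (O.trans (const.*-homo E c) (O.*-congʳ {O.const c} E≈))

  Congruences⇒S : ∀ {s} → Congruences m N s → SConditions m k s
  Congruences⇒S {s} C =
      Transfer.≅⇒mod {m} {D} {d} Dd≡1 D⊥m S⁽¹⁾≡ s e₁-rational (B.trans cong₁ (B.sym (const-scaled D≈ s)))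
    , Transfer.≅⇒mod {m} {D ℤ.* D} {d ℚ.* d} D²d²≡1 D²⊥m S⁽²⁾≡ -[1+ 1 ] e₂-rational
        (B.trans cong₂ (B.sym (const-scaled D²≈ -[1+ 1 ])))
    , Transfer.≅⇒mod {m} {D ℤ.* D ℤ.* D} {d ℚ.* d ℚ.* d} D³d³≡1 D³⊥m S⁽³⁾≡ (ℤ.- s) e₃-rational
        (B.trans cong₃ (B.sym (const-scaled D³≈ (ℤ.- s))))
    where open Congruences C

  S⇒Congruences : ∀ {s} → SConditions m k s → Congruences m N s
  S⇒Congruences {s} (S₁ , S₂ , S₃) = record
    { cong₁ = B.trans (Transfer.mod⇒≅ {m} {D} {d} Dd≡1 D⊥m S⁽¹⁾≡ s S₁) (const-scaled D≈ s)
    ; cong₂ = B.trans (Transfer.mod⇒≅ {m} {D ℤ.* D} {d ℚ.* d} D²d²≡1 D²⊥m S⁽²⁾≡ -[1+ 1 ] S₂) (const-scaled D²≈ -[1+ 1 ])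
    ; cong₃ = B.trans (Transfer.mod⇒≅ {m} {D ℤ.* D ℤ.* D} {d ℚ.* d ℚ.* d} D³d³≡1 D³⊥m S⁽³⁾≡ (ℤ.- s) S₃) (const-scaled D³≈ (ℤ.- s))
    }

≅-∣ : ∀ {p m} → p ∣ m → ∀ {x y} → OMod._≅_ m x y → OMod._≅_ p x y
≅-∣ {p} (divides j ≡.refl) {x} {y} (t , x≈y+mt) = O.const (+ j) O.* t , O.trans x≈y+mt (O.+-congˡ {y}
  (O.trans (O.*-congʳ {t} (O.trans (const.⟦⟧-cong (≡.trans (≡.cong +_ (ℕₚ.*-comm j p)) (ℤₚ.pos-* p j))) (const.*-homo (+ p) (+ j))))
           (O.*-assoc (O.const (+ p)) (O.const (+ j)) t)))
  where module const = IsSemiringHomomorphism O.const-hom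

Congruences-∣ : ∀ {p m N s} → p ∣ m → Congruences m N s → Congruences p N s
Congruences-∣ p∣m C = record { cong₁ = ≅-∣ p∣m cong₁ ; cong₂ = ≅-∣ p∣m cong₂ ; cong₃ = ≅-∣ p∣m cong₃ }
  where open Congruences C

-- The residues of 14^(2^n) modulo 29 are 20, 23, 7, 20, …
data Residue (x : ℕ) : Set where
  ≡20 : x % 29 ≡ 20 → Residue x
  ≡23 : x % 29 ≡ 23 → Residue x
  ≡7  : x % 29 ≡ 7 → Residue x

residue-14^2^n : ∀ n → Residue (14 ℕ.^ (2 ℕ.^ (2 ℕ.+ n)))
residue-14^2^n zero    = ≡20 ≡.refl
residue-14^2^n (suc n) = ≡.subst Residue (≡.sym square) (step (residue-14^2^n n))
  where
  x = 14 ℕ.^ (2 ℕ.^ (2 ℕ.+ n))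
  square : 14 ℕ.^ (2 ℕ.^ (3 ℕ.+ n)) ≡ x ℕ.* x
  square = ≡.trans (≡.cong (14 ℕ.^_) (≡.cong (2 ℕ.^ (2 ℕ.+ n) ℕ.+_) (ℕₚ.+-identityʳ _)))
                   (ℕₚ.^-distribˡ-+-* 14 (2 ℕ.^ (2 ℕ.+ n)) (2 ℕ.^ (2 ℕ.+ n)))
  square% : ∀ {j} → x % 29 ≡ j → (x ℕ.* x) % 29 ≡ (j ℕ.* j) % 29
  square% {j} x%≡j = ≡.trans (DivMod.%-distribˡ-* x x 29) (≡.cong (λ i → (i ℕ.* i) % 29) x%≡j)
  step : Residue x → Residue (x ℕ.* x)
  step (≡20 x%) = ≡23 (square% x%)
  step (≡23 x%) = ≡7 (square% x%)
  step (≡7 x%)  = ≡20 (square% x%)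

+1-% : ∀ x {j} → x % 29 ≡ j → (x ℕ.+ 1) % 29 ≡ (j ℕ.+ 1) % 29
+1-% x {j} x%≡j = ≡.trans (DivMod.%-distribˡ-+ x 1 29) (≡.cong (λ i → (i ℕ.+ 1) % 29) x%≡j)

29-prime : Prime 29
29-prime = toWitness {a? = prime? 29} tt

%≢0⇒29⊥ : ∀ {M j} → M % 29 ≡ suc j → Coprime 29 M
%≢0⇒29⊥ {M} M%≡ (d∣29 , d∣M) with prime⇒irreducible 29-prime d∣29
... | inj₁ d≡1    = d≡1
... | inj₂ ≡.refl with () ← ≡.trans (≡.sym M%≡) (∣.n∣m⇒m%n≡0 M 29 d∣M)

%⇒modℤ : ∀ {M j} → M % 29 ≡ j → ∀ {c} e → + j ℤ.- c ≡ e ℤ.* + 29 → (+ M) ≡ c [modℤ 29 ]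
%⇒modℤ {M} {j} M%≡j {c} e j-c≡29e = divides ℤ.∣ e ℤ.+ + q ∣ (begin
  ℤ.∣ + M ℤ.- c ∣                          ≡⟨ ≡.cong (λ x → ℤ.∣ + x ℤ.- c ∣) (≡.trans (DivMod.m≡m%n+[m/n]*n M 29) (≡.cong (ℕ._+ q ℕ.* 29) M%≡j)) ⟩
  ℤ.∣ + (j ℕ.+ q ℕ.* 29) ℤ.- c ∣           ≡⟨ ≡.cong (λ x → ℤ.∣ + j ℤ.+ x ℤ.- c ∣) (ℤₚ.pos-* q 29) ⟩
  ℤ.∣ + j ℤ.+ + q ℤ.* + 29 ℤ.- c ∣         ≡⟨ ≡.cong ℤ.∣_∣ (solve 3 (λ j x c → j :+ x :- c := j :- c :+ x) ≡.refl (+ j) (+ q ℤ.* + 29) c) ⟩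
  ℤ.∣ + j ℤ.- c ℤ.+ + q ℤ.* + 29 ∣         ≡⟨ ≡.cong (λ x → ℤ.∣ x ℤ.+ + q ℤ.* + 29 ∣) j-c≡29e ⟩
  ℤ.∣ e ℤ.* + 29 ℤ.+ + q ℤ.* + 29 ∣        ≡⟨ ≡.cong ℤ.∣_∣ (ℤₚ.*-distribʳ-+ (+ 29) e (+ q)) ⟨
  ℤ.∣ (e ℤ.+ + q) ℤ.* + 29 ∣               ≡⟨ ℤₚ.abs-* (e ℤ.+ + q) (+ 29) ⟩
  ℤ.∣ e ℤ.+ + q ∣ ℕ.* 29                   ∎)
  where
  open ≡.≡-Reasoning
  open ℤSolver.+-*-Solver using (solve; _:=_; _:+_; _:-_)
  q = M DivMod./ 29

-- Primality from the size of the prime divisors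

module Primality (k : ℕ) (29⊥M : Coprime 29 (14 ℕ.^ suc k ℕ.+ 1)) {s : ℤ} (ss≡1 : s ℤ.* s ≡ + 1)
                 (C : Congruences (14 ℕ.^ suc k ℕ.+ 1) (14 ℕ.^ k) s)
                 (no-divisor : (x : ℕ) → 1 < x → x < 7 ℕ.^ suc k → ((+ (x ℕ.^ 6)) ≡ + 1 [modℤ 7 ℕ.^ suc k ]) →
                               ¬ (x ∣ 14 ℕ.^ suc k ℕ.+ 1)) where

  private
    r M : ℕ
    r = suc k
    M = 14 ℕ.^ r ℕ.+ 1

    prime-divisor-large : ∀ {p} → Prime p → p ∣ M → ¬ (p < 7 ℕ.^ r)
    prime-divisor-large {p} p-prime p∣M p<7^r = no-divisor p (ℕ.nonTrivial⇒n>1 p) p<7^r p⁶≡1 p∣M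
      where
      instance
        _ = prime⇒nonTrivial p-prime
        _ = prime⇒nonZero p-prime
      p⊥14 : Coprime p 14
      -- A common divisor divides both 14^r + 1 and 14^r, hence 1.
      p⊥14 (d∣p , d∣14) = ∣.∣1⇒≡1 (∣.∣m+n∣m⇒∣n (∣.∣-trans d∣p p∣M) (∣.∣m⇒∣m*n (14 ℕ.^ k) d∣14))
      p^6≡ : p ℕ.^ 6 ≡ suc (ℕ.pred (p ℕ.^ 6))
      p^6≡ = ≡.sym (ℕₚ.suc-pred (p ℕ.^ 6) {{ℕₚ.m^n≢0 p 6}})
      7^r∣ : 7 ℕ.^ r ∣ ℕ.pred (p ℕ.^ 6)
      7^r∣ = Backward.order-divisible p-prime p⊥14 (Coprimality.sym (Coprime-∣ p∣M (Coprimality.sym 29⊥M)))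
        k ss≡1 (Congruences-∣ p∣M C) p^6≡
      p⁶≡1 : (+ (p ℕ.^ 6)) ≡ + 1 [modℤ 7 ℕ.^ r ]
      -- Once p⁶ is written as a successor, the integer difference p⁶ - 1 computes to the
      -- predecessor.
      p⁶≡1 = ≡.subst (λ n → (+ n) ≡ + 1 [modℤ 7 ℕ.^ r ]) (≡.sym p^6≡) 7^r∣

    M>1 : 1 < M
    M>1 = ℕₚ.≤-trans (ℕ.s≤s (ℕ.>-nonZero⁻¹ _)) (ℕₚ.≤-reflexive (ℕₚ.+-comm 1 (14 ℕ.^ r)))
      where instance _ = ℕₚ.m^n≢0 14 r

    -- A divisor of M at the current bound has no smaller divisor above 1, so it is prime, and
    -- `prime-divisor-large` excludes it.
    rough : ∀ j → 2 ℕ.+ j ℕ.≤ 7 ℕ.^ r → (2 ℕ.+ j) Rough M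
    rough zero    _   = 2-rough
    rough (suc j) j<7^r = ∤⇒rough-suc
      (λ j∣M → prime-divisor-large (rough∧∣⇒prime (rough j (ℕₚ.<⇒≤ j<7^r)) j∣M) j∣M j<7^r)
      (rough j (ℕₚ.<⇒≤ j<7^r))

    7^r≥2 : 2 ℕ.≤ 7 ℕ.^ r
    7^r≥2 = ℕₚ.≤-trans (ℕₚ.m≤n+m 2 5) (ℕₚ.m≤m*n 7 (7 ℕ.^ k) {{ℕₚ.m^n≢0 7 k}})

    7^r-rough : (7 ℕ.^ r) Rough M
    7^r-rough = ≡.subst (_Rough M) (ℕₚ.m+[n∸m]≡n 7^r≥2) (rough (7 ℕ.^ r ∸ 2) (ℕₚ.≤-reflexive (ℕₚ.m+[n∸m]≡n 7^r≥2)))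

    M<49^r : M < 7 ℕ.^ r ℕ.* 7 ℕ.^ r
    M<49^r = begin-strict
      14 ℕ.^ r ℕ.+ 1                           ≡⟨ ≡.cong (ℕ._+ 1) (14^n≡2^n*7^n r) ⟩
      2 ℕ.^ r ℕ.* 7 ℕ.^ r ℕ.+ 1                <⟨ ℕₚ.+-monoʳ-< (2 ℕ.^ r ℕ.* 7 ℕ.^ r) 7^r≥2 ⟩
      2 ℕ.^ r ℕ.* 7 ℕ.^ r ℕ.+ 7 ℕ.^ r          ≡⟨ ℕₚ.+-comm _ (7 ℕ.^ r) ⟩
      suc (2 ℕ.^ r) ℕ.* 7 ℕ.^ r                ≤⟨ ℕₚ.*-monoˡ-≤ (7 ℕ.^ r) (2^<7^ k) ⟩
      7 ℕ.^ r ℕ.* 7 ℕ.^ r                      ∎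
      where
      open ℕₚ.≤-Reasoning
      2^<7^ : ∀ k → 2 ℕ.^ suc k < 7 ℕ.^ suc k
      2^<7^ k = ℕₚ.^-monoˡ-< (suc k) {2} {7} (ℕₚ.m≤n+m 3 4)

  M-prime : Prime (14 ℕ.^ suc k ℕ.+ 1)
  M-prime = rough∧square>⇒prime {{ℕ.n>1⇒nonTrivial M>1}} 7^r-rough M<49^r

-- R stands for 2ⁿ. As a variable it can be matched as a successor, and the shape of 2ⁿ is recorded
-- in the residue of 14^R modulo 29.
Prime⇔S : ∀ R → 1 < R → Residue (14 ℕ.^ R) → let M = 14 ℕ.^ R ℕ.+ 1 in
  ((x : ℕ) → 1 < x → x < 7 ℕ.^ R → ((+ (x ℕ.^ 6)) ≡ + 1 [modℤ 7 ℕ.^ R ]) → ¬ (x ∣ M)) →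
  Prime M ⇔
    ( ( (((+ M) ≡ + 8 [modℤ 29 ]) ⊎ ((+ M) ≡ -ℤ (+ 8) [modℤ 29 ])) × SConditions M (R ∸ 1) (+ 1) )
    ⊎ ( ((+ M) ≡ -ℤ (+ 5) [modℤ 29 ]) × SConditions M (R ∸ 1) -1ℤ ) )
Prime⇔S (suc zero) (ℕ.s≤s ()) _ _
Prime⇔S (suc k@(suc j)) _ residue no-divisor = mk⇔ (forward residue) backward
  where
  N M : ℕ
  N = 14 ℕ.^ k
  M = 14 ℕ.^ suc k ℕ.+ 1

  M≡1+14N : M ≡ suc (14 ℕ.* N)
  M≡1+14N = ℕₚ.+-comm (14 ℕ.^ suc k) 1

  coprime : Residue (14 ℕ.^ suc k) → Coprime 29 M
  coprime (≡20 x%) = %≢0⇒29⊥ {M} (+1-% (14 ℕ.^ suc k) x%)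
  coprime (≡23 x%) = %≢0⇒29⊥ {M} (+1-% (14 ℕ.^ suc k) x%)
  coprime (≡7  x%) = %≢0⇒29⊥ {M} (+1-% (14 ℕ.^ suc k) x%)

  29⊥M : Coprime 29 M
  29⊥M = coprime residue

  module E = Equivalence M k 29⊥M

  conditions : Prime M → ∀ {i} → M % 29 ≡ i → ∀ {z s} → PeriodValues z s → A.evalᵀ i g A.≈ A.const z A.* g →
               SConditions M k s
  conditions M-prime M% {z} values e = E.Congruences⇒S
    -- k is itself a successor because R > 1; so 14 divides N = 14^k, and the root of unity ζ^(6N)
    -- is 1.
    (Forward.congruences {M} {N} M-prime M≡1+14N (∣.m∣m*n (14 ℕ.^ j)) 29⊥M values
      (Reciprocity.a^N≅z {M} {N} M-prime M≡1+14N M% z e))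

  forward : Residue (14 ℕ.^ suc k) → Prime M →
    ( ( (((+ M) ≡ + 8 [modℤ 29 ]) ⊎ ((+ M) ≡ -ℤ (+ 8) [modℤ 29 ])) × SConditions M k (+ 1) )
    ⊎ ( ((+ M) ≡ -ℤ (+ 5) [modℤ 29 ]) × SConditions M k -1ℤ ) )
  forward (≡20 x%) M-prime = let M% = +1-% (14 ℕ.^ suc k) x% in
    -- 20 + 1 = 21 = -8 + 1 · 29; likewise 24 = -5 + 1 · 29 in the next case.
    inj₁ (inj₂ (%⇒modℤ {M} M% { -[1+ 7 ]} (+ 1) ≡.refl) , conditions M-prime M% values-ζ¹³ evalᵀ-21)
  forward (≡23 x%) M-prime = let M% = +1-% (14 ℕ.^ suc k) x% in
    inj₂ (%⇒modℤ {M} M% { -[1+ 4 ]} (+ 1) ≡.refl , conditions M-prime M% values-ζ² evalᵀ-24)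
  forward (≡7  x%) M-prime = let M% = +1-% (14 ℕ.^ suc k) x% in
    inj₁ (inj₁ (%⇒modℤ {M} M% {+ 8} (+ 0) ≡.refl) , conditions M-prime M% values-ζ¹³ evalᵀ-8)

  backward : _ → Prime M
  backward (inj₁ (_ , S)) = Primality.M-prime k 29⊥M {+ 1} ≡.refl (E.S⇒Congruences S) no-divisor
  backward (inj₂ (_ , S)) = Primality.M-prime k 29⊥M { -1ℤ} ≡.refl (E.S⇒Congruences S) no-divisor

proposition4p3 : (n : ℕ) → 1 < n →
    let r = 2 ℕ.^ n
        M = 14 ℕ.^ (2 ℕ.^ n) ℕ.+ 1
    in
    ((x : ℕ) → 1 < x → x < 7 ℕ.^ r → ((+ (x ℕ.^ 6)) ≡ + 1 [modℤ 7 ℕ.^ r ]) → ¬ (x ∣ M)) →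
    Prime M ⇔
      ( ( (((+ M) ≡ + 8 [modℤ 29 ]) ⊎ ((+ M) ≡ -ℤ (+ 8) [modℤ 29 ]))
        × (S⁽¹⁾ (r ∸ 1) ≡ + 1 [mod M ])
        × (S⁽²⁾ (r ∸ 1) ≡ -ℤ (+ 2) [mod M ])
        × (S⁽³⁾ (r ∸ 1) ≡ -ℤ (+ 1) [mod M ]) )
      ⊎ ( ((+ M) ≡ -ℤ (+ 5) [modℤ 29 ])
        × (S⁽¹⁾ (r ∸ 1) ≡ -ℤ (+ 1) [mod M ])
        × (S⁽²⁾ (r ∸ 1) ≡ -ℤ (+ 2) [mod M ])
        × (S⁽³⁾ (r ∸ 1) ≡ + 1 [mod M ]) ) )
proposition4p3 (suc (suc n)) _ = Prime⇔S (2 ℕ.^ (2 ℕ.+ n)) 1<r (residue-14^2^n n)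
  where
  1<r : 1 < 2 ℕ.^ (2 ℕ.+ n)
  1<r = ℕₚ.≤-trans (ℕₚ.m≤m*n 2 (2 ℕ.^ suc n) {{ℕₚ.m^n≢0 2 (suc n)}}) ℕₚ.≤-refl
proposition4p3 (suc zero) (ℕ.s≤s ())
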